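{- Let $\mathcal{C}$ be a covering of $\mathbb{R}^2$ by complete folding curves. Then $\mathcal{C}$ satisfies the local isomorphism property if and only if all the curves of $\mathcal{C}$ have the same type, satisfy $E_k(C)=E_k(C')$ for all $C,C'\in\mathcal{C}$ and all $k\in\mathbb{N}$, and have pairwise locally isomorphic associated sequences.
   Context: All sequences take values in $\{+1,-1\}$. For $S=(a_1,\dots,a_n)$ write $\overline{S}=(-a_n,\dots,-a_1)$. The $n$-folding sequences are defined recursively: the only $0$-folding sequence is the empty sequence, and the $(n+1)$-folding sequences are exactly $(\overline{S},+1,S)$ and $(\overline{S},-1,S)$ with $S$ an $n$-folding sequence. A subword of a sequence $(b_k)$ is a block $(b_{h+1},\dots,b_{h+m})$. A complete folding sequence is a sequence $(a_k)_{k\in\mathbb{Z}}$ each finite subword of which is a subword of some $n$-folding sequence. Two sequences indexed by $\mathbb{Z}$ are locally isomorphic if they have the same finite subwords. For a complete folding sequence $S=(a_h)$ and each $n\in\mathbb{N}$ there is $h_n$ with $a_{h_n+k2^{n+1}}=(-1)^k a_{h_n}$ for all $k\in\mathbb{Z}$; the set $E_n(S)=h_n+2^n\mathbb{Z}$ does not depend on the choice of $h_n$. A segment is an oriented unit edge of $\mathbb{Z}^2$. A complete curve is a sequence $C=(C_i)_{i\in\mathbb{Z}}$ of segments such that the terminal point of $C_i$ is the initial point of $C_{i+1}$, consecutive supports are perpendicular, and all supports are pairwise distinct (curves differing by an index shift are identified). Its associated sequence is $(\eta_i)_{i\in\mathbb{Z}}$ with $\eta_i=+1$ (resp. $-1$)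 if one turns left (resp. right) from $C_i$ to $C_{i+1}$. A complete folding curve is a complete curve whose associated sequence $S$ is a complete folding sequence; it has type $H$ (resp. $V$) if all segments $C_i$ with $i\in E_1(S)$ have horizontal (resp. vertical) supports. Let $\Lambda_{2k}=2^k\mathbb{Z}^2$, $\Lambda_{2k+1}=\mathbb{Z}(2^k,2^k)+\mathbb{Z}(2^k,-2^k)$; $E_n(C)=X+\Lambda_n$ where $X$ is the terminal point of any $C_i$ with $i\in E_n(S)$ (independent of $i$). A covering of $\mathbb{R}^2$ by complete folding curves is a set $\mathcal{C}$ of complete folding curves such that every unit edge of $\mathbb{Z}^2$ is the support of exactly one segment of exactly one curve of $\mathcal{C}$. A decorated segment of $\mathcal{C}$ is a segment of a curve of $\mathcal{C}$ together with, at each endpoint, the support of the segment of the same curve which precedes/follows it there. $\mathcal{C}$ satisfies the local isomorphism property if for every finite set $F$ of decorated segments of $\mathcal{C}$ there is $r>0$ such that every disk of radius $r$ contains a translate $v+F$ ($v\in\mathbb{Z}^2$) which is a set of decorated segments of $\mathcal{C}$. -}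

module Defs where

open import Data.Nat as ℕ using (ℕ; zero; suc)
open import Data.Integer as ℤ using (ℤ; +_; _+_; _-_; _*_; -_; ∣_∣)
open import Data.Integer.Divisibility using () renaming (_∣_ to _∣ℤ_)
open import Data.List using (List; []; _∷_; _++_; map; reverse; upTo; length)
open import Data.List.Relation.Unary.All using (All)
open import Data.Product using (Σ; ∃; _×_; _,_)
open import Data.Sum using (_⊎_)
open import Data.Empty using (⊥)
open import Relation.Nullary using (¬_; Dec; yes; no)
open import Relation.Binary.PropositionalEquality using (_≡_; _≢_; refl)
open import Level using (Level; suc) renaming (zero to lzero)

data Sgn : Set where
  pos neg : Sgn

negate : Sgn → Sgn
negate pos = neg
negate neg = pos

-- (-1)^k · s  for k ∈ ℤ (parity of k = parity of |k|)
evenℕ? : ℕ → Sgn → Sgn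
evenℕ? zero s = s
evenℕ? (suc zero) s = negate s
evenℕ? (suc (suc n)) s = evenℕ? n s

alt : ℤ → Sgn → Sgn
alt k s = evenℕ? ∣ k ∣ s

Seq : Set
Seq = ℤ → Sgn

bar : List Sgn → List Sgn
bar S = reverse (map negate S)

data Folding : ℕ → List Sgn → Set where
  fold0 : Folding 0 []
  foldS : ∀ {n S} (s : Sgn) → Folding n S → Folding (ℕ.suc n) (bar S ++ s ∷ S)

Subword : List Sgn → List Sgn → Set
Subword u v = Σ (List Sgn) λ p → Σ (List Sgn) λ q → p ++ u ++ q ≡ v

-- the finite subword (a_{h+1}, …, a_{h+m})   (we index it as a_h, …, a_{h+m-1})
window : Seq → ℤ → ℕ → List Sgn
window a h m = map (λ i → a (h + + i)) (upTo m)

CompleteFoldingSeq : Seq → Set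
CompleteFoldingSeq a = ∀ (h : ℤ) (m : ℕ) →
  Σ ℕ λ n → Σ (List Sgn) λ w → Folding n w × Subword (window a h m) w

LocIso : Seq → Seq → Set
LocIso a b =
  (∀ h m → Σ ℤ λ h' → window a h m ≡ window b h' m) ×
  (∀ h m → Σ ℤ λ h' → window b h m ≡ window a h' m)

pow2 : ℕ → ℤ
pow2 n = + (2 ℕ.^ n)

IsH : Seq → ℕ → ℤ → Set
IsH a n h = ∀ (k : ℤ) → a (h + k * pow2 (ℕ.suc n)) ≡ alt k (a h)

InE : Seq → ℕ → ℤ → Set
InE a n i = Σ ℤ λ h → IsH a n h × (pow2 n ∣ℤ (i - h))

Point : Set
Point = ℤ × ℤ

_⊕_ : Point → Point → Point
(a , b) ⊕ (c , d) = (a + c , b + d)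

_⊖_ : Point → Point → Point
(a , b) ⊖ (c , d) = (a - c , b - d)

data Dir : Set where
  E N W S : Dir

unit : Dir → Point
unit E = (+ 1 , + 0)
unit N = (+ 0 , + 1)
unit W = (- + 1 , + 0)
unit S = (+ 0 , - + 1)

rotL : Dir → Dir
rotL E = N
rotL N = W
rotL W = S
rotL S = E

_≟D_ : (d e : Dir) → Dec (d ≡ e)
E ≟D E = yes refl
E ≟D N = no λ ()
E ≟D W = no λ ()
E ≟D S = no λ ()
N ≟D E = no λ ()
N ≟D N = yes refl
N ≟D W = no λ ()
N ≟D S = no λ ()
W ≟D E = no λ ()
W ≟D N = no λ ()
W ≟D W = yes refl
W ≟D S = no λ ()
S ≟D E = no λ ()
S ≟D N = no λ ()
S ≟D W = no λ ()
S ≟D S = yes refl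

data Orient : Set where
  hor ver : Orient

orient : Dir → Orient
orient E = hor
orient W = hor
orient N = ver
orient S = ver

record Segment : Set where
  constructor seg
  field
    start : Point
    dir   : Dir
open Segment public

finish : Segment → Point
finish s = start s ⊕ unit (dir s)

-- an (unoriented) unit edge of ℤ²: its lower/left endpoint and orientation
Edge : Set
Edge = Point × Orient

support : Segment → Edge
support (seg p E) = (p , hor)
support (seg p W) = (p ⊕ unit W , hor)
support (seg p N) = (p , ver)
support (seg p S) = (p ⊕ unit S , ver)

Curve : Set
Curve = ℤ → Segment

CompleteCurve : Curve → Set
CompleteCurve C =
  (∀ i → finish (C i) ≡ start (C (i + + 1))) ×
  (∀ i → orient (dir (C i)) ≢ orient (dir (C (i + + 1)))) ×
  (∀ i j → support (C i) ≡ support (C j) → i ≡ j)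

turn : Dir → Dir → Sgn
turn d d' with d' ≟D rotL d
... | yes _ = pos
... | no _  = neg

assoc : Curve → Seq
assoc C i = turn (dir (C i)) (dir (C (i + + 1)))

CompleteFoldingCurve : Curve → Set
CompleteFoldingCurve C = CompleteCurve C × CompleteFoldingSeq (assoc C)

TypeH : Curve → Set
TypeH C = ∀ i → InE (assoc C) 1 i → orient (dir (C i)) ≡ hor

TypeV : Curve → Set
TypeV C = ∀ i → InE (assoc C) 1 i → orient (dir (C i)) ≡ ver

-- generators of Λ_n : Λ_0 = ℤ², Λ_1 = ℤ(1,1)+ℤ(1,-1), Λ_{n+2} = 2 Λ_n
-- (so Λ_{2k} = 2^k ℤ², Λ_{2k+1} = ℤ(2^k,2^k)+ℤ(2^k,-2^k))
scale : ℤ → Point → Point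
scale c (a , b) = (c * a , c * b)

gens : ℕ → Point × Point
gens zero = ((+ 1 , + 0) , (+ 0 , + 1))
gens (ℕ.suc zero) = ((+ 1 , + 1) , (+ 1 , - + 1))
gens (ℕ.suc (ℕ.suc n)) with gens n
... | (g , g') = (scale (+ 2) g , scale (+ 2) g')

InΛ : ℕ → Point → Set
InΛ n p with gens n
... | (g , g') = Σ ℤ λ a → Σ ℤ λ b → p ≡ scale a g ⊕ scale b g'

InEC : Curve → ℕ → Point → Set
InEC C n p = Σ ℤ λ i → InE (assoc C) n i × InΛ n (p ⊖ finish (C i))

-- A set of curves, given as a predicate on parametrised curves (curves
-- differing by a shift of index represent the same curve).
CurveSet : Set₁
CurveSet = Curve → Set

SameSeg : Curve → ℤ → Curve → ℤ → Set
SameSeg C i C' j = ∀ k → C (i + k) ≡ C' (j + k)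

Covering : CurveSet → Set
Covering 𝒞 =
  (∀ C → 𝒞 C → CompleteFoldingCurve C) ×
  (∀ (e : Edge) → Σ Curve λ C → Σ ℤ λ i → 𝒞 C × support (C i) ≡ e) ×
  (∀ (e : Edge) C i C' j → 𝒞 C → 𝒞 C' →
     support (C i) ≡ e → support (C' j) ≡ e → SameSeg C i C' j)

record DecSeg : Set where
  constructor dseg
  field
    prevSupp : Edge
    theSeg   : Segment
    nextSupp : Edge

IsDecSeg : CurveSet → DecSeg → Set
IsDecSeg 𝒞 d = Σ Curve λ C → Σ ℤ λ i → 𝒞 C ×
  d ≡ dseg (support (C (i - + 1))) (C i) (support (C (i + + 1)))

translateE : Point → Edge → Edge
translateE v (p , o) = (p ⊕ v , o)

translateD : Point → DecSeg → DecSeg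
translateD v (dseg e (seg p d) e') = dseg (translateE v e) (seg (p ⊕ v) d) (translateE v e')

sq : ℤ → ℕ
sq x = ∣ x ∣ ℕ.* ∣ x ∣

InDisk : Point → ℕ → Point → Set
InDisk c r p with p ⊖ c
... | (x , y) = sq x ℕ.+ sq y ℕ.≤ r ℕ.* r

DecInDisk : Point → ℕ → DecSeg → Set
DecInDisk c r (dseg _ s _) = InDisk c r (start s) × InDisk c r (finish s)

LocalIsoProperty : CurveSet → Set
LocalIsoProperty 𝒞 =
  ∀ (F : List DecSeg) → All (IsDecSeg 𝒞) F →
  Σ ℕ λ r → (0 ℕ.< r) × (∀ (c : Point) → Σ Point λ v →
     All (λ d → IsDecSeg 𝒞 d × DecInDisk c r d) (map (translateD v) F))

SameTypeEtc : CurveSet → Set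
SameTypeEtc 𝒞 =
  ((∀ C → 𝒞 C → TypeH C) ⊎ (∀ C → 𝒞 C → TypeV C)) ×
  (∀ C C' → 𝒞 C → 𝒞 C' → ∀ (k : ℕ) (p : Point) →
     (InEC C k p → InEC C' k p) × (InEC C' k p → InEC C k p)) ×
  (∀ C C' → 𝒞 C → 𝒞 C' → LocIso (assoc C) (assoc C'))

{-# OPTIONS --safe #-}
module Submission where

-- A complete folding sequence alternates on one class of indices mod 2, and its restriction to the other class is
-- again a complete folding sequence.  Correspondingly a folding curve C has a derivative D, obtained by replacing
-- the two segments around each alternating turn by their sum divided by 1 + i; the vertices of D are those of
-- E_1(C), and properties of curves propagate by induction between D and C.
--
-- If the local isomorphism property holds: every folding curve contains all edges of arbitrarily large squares,
-- because three equal consecutive turns of a derivative produce two neighbouring vertices with all four edges on the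
-- curve, and such vertices spread when one passes from D to C, a square of side m giving one of side 2m after two
-- steps.  A long piece of a curve C and one of a curve C' therefore have a common translate inside C', which
-- forces equal types, equal classes E_k and locally isomorphic sequences.
--
-- Conversely, local isomorphism fixes on which side of a left turn of level k the next vertex of E_{k+2} comes.
-- Together with the type and the classes E_k this determines the turn at every vertex of level k from its class
-- modulo Λ_{k+2}, for all curves of the covering at once.  So a finite pattern whose vertices have bounded level
-- recurs along a lattice; at most one vertex of a finite pattern can have large level, and it is translated to a
-- vertex of some fixed large level with the same turn.

open import Defs
open import Data.Nat as ℕ using (ℕ; zero; suc; z≤n; s≤s)
import Data.Nat.Properties as ℕP
open import Data.Integer using (ℤ; +_; -[1+_]; _+_; _-_; _*_; -_; ∣_∣)
import Data.Integer.Properties as ℤP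
import Data.Integer.DivMod as ℤD
open import Data.Integer.Divisibility.Signed using (divides; ∣ᵤ⇒∣; ∣⇒∣ᵤ)
open import Data.Integer.Tactic.RingSolver using (solve-∀)
open import Data.List using (List; []; _∷_; _++_; map; upTo; length; applyUpTo)
import Data.List.Properties as LP
open import Data.List.Membership.Propositional using (find)
open import Data.List.Membership.Propositional.Properties using (∈-map⁺; ∈-++⁺ˡ; ∈-++⁺ʳ; ∈-applyUpTo⁺)
open import Data.List.Relation.Unary.All as All using (All; []; _∷_)
import Data.List.Relation.Unary.All.Properties as AllP
open import Data.List.Relation.Unary.Any using (Any)
open import Data.Product using (Σ; _×_; _,_; proj₁; proj₂)
open import Data.Sum using (_⊎_; inj₁; inj₂)
open import Data.Empty using (⊥; ⊥-elim)
open import Relation.Nullary using (¬_; yes; no)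
open import Relation.Binary.PropositionalEquality using (_≡_; _≢_; refl; sym; trans; cong; cong₂; subst; subst₂; module ≡-Reasoning)

-- An index can lie in E_n for every n, so a level is not a number that can be computed: case
-- analysis only asks whether the level is below a given n or the index is in E_n. Such an index is
-- also the obstacle in the converse: its class modulo any Λ_n contains vertices of both turns, so
-- its turn has to be matched with that of a vertex of finite level. The choice of the alternating
-- class is settled by a short window, because four consecutive terms of a folding sequence never
-- alternate; no compactness argument enters. In the plane, Z^2 is read as the Gaussian integers.
-- Derivation divides by 1 + i and lowers the index of every Λ_k and E_k by one. Two curves stay
-- comparable only if both are divided from the same origin, which is why `Derived` has the origin
-- as a parameter; the conditions in `Compat` are chosen so that derivatives inherit them. The bound
-- 4b comes from Λ_{4b} = 2^{2b} Z^2: points of norm at most b differ by at most 2b < 2^{2b} in each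
-- coordinate, so congruent ones are equal.

-- Signs, parity and induction on the integers

negate-invol : ∀ s → negate (negate s) ≡ s
negate-invol pos = refl
negate-invol neg = refl

s≢negate : ∀ {s} → s ≢ negate s
s≢negate {pos} ()
s≢negate {neg} ()

negate-inj : ∀ {s t} → negate s ≡ negate t → s ≡ t
negate-inj {s} {t} e = trans (sym (negate-invol s)) (trans (cong negate e) (negate-invol t))

sgn-cases : ∀ s t → (s ≡ t) ⊎ (s ≡ negate t)
sgn-cases pos pos = inj₁ refl
sgn-cases pos neg = inj₂ refl
sgn-cases neg pos = inj₂ refl
sgn-cases neg neg = inj₁ refl

evenℕ?-suc : ∀ n s → evenℕ? (suc n) s ≡ negate (evenℕ? n s)
evenℕ?-suc zero s = refl
evenℕ?-suc (suc zero) s = sym (negate-invol s)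
evenℕ?-suc (suc (suc n)) s = evenℕ?-suc n s

evenℕ?-negate : ∀ n s → evenℕ? n (negate s) ≡ negate (evenℕ? n s)
evenℕ?-negate zero s = refl
evenℕ?-negate (suc zero) s = refl
evenℕ?-negate (suc (suc n)) s = evenℕ?-negate n s

evenℕ?-invol : ∀ n s → evenℕ? n (evenℕ? n s) ≡ s
evenℕ?-invol zero s = refl
evenℕ?-invol (suc zero) s = negate-invol s
evenℕ?-invol (suc (suc n)) s = evenℕ?-invol n s

ℤ-ind : (P : ℤ → Set) → P (+ 0) → (∀ k → P k → P (k + + 1)) → (∀ k → P (k + + 1) → P k) → ∀ k → P k
ℤ-ind P p0 up down (+ zero) = p0
ℤ-ind P p0 up down (+ suc n) = subst P (cong +_ (ℕP.+-comm n 1)) (up (+ n) (ℤ-ind P p0 up down (+ n)))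
ℤ-ind P p0 up down -[1+ zero ] = down -[1+ 0 ] p0
ℤ-ind P p0 up down -[1+ suc n ] = down -[1+ suc n ] (ℤ-ind P p0 up down -[1+ n ])

alt-suc : ∀ k s → alt (k + + 1) s ≡ negate (alt k s)
alt-suc (+ n) s = trans (cong (λ m → evenℕ? m s) (ℕP.+-comm n 1)) (evenℕ?-suc n s)
alt-suc -[1+ zero ] s = sym (negate-invol s)
alt-suc -[1+ suc n ] s = trans (sym (negate-invol _)) (cong negate (sym (evenℕ?-suc (suc n) s)))

alt-+ : ∀ m n s → alt (m + n) s ≡ alt m (alt n s)
alt-+ m n s = ℤ-ind (λ m → alt (m + n) s ≡ alt m (alt n s))
  (cong (λ x → alt x s) (ℤP.+-identityˡ n))
  (λ k e → trans (cong (λ x → alt x s) (lem k n))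
             (trans (alt-suc (k + n) s) (trans (cong negate e) (sym (alt-suc k (alt n s))))))
  (λ k e → negate-inj (trans (sym (alt-suc (k + n) s))
             (trans (cong (λ x → alt x s) (sym (lem k n))) (trans e (alt-suc k (alt n s))))))
  m
  where
  lem : ∀ k n → k + + 1 + n ≡ k + n + + 1
  lem = solve-∀

alt-negate : ∀ k s → alt k (negate s) ≡ negate (alt k s)
alt-negate k s = evenℕ?-negate ∣ k ∣ s

alt-double : ∀ k s → alt (k + k) s ≡ s
alt-double k s = trans (alt-+ k k s) (evenℕ?-invol ∣ k ∣ s)

k*2 : ∀ k → k * + 2 ≡ k + k
k*2 = solve-∀

alt-even : ∀ k s → alt (k * + 2) s ≡ s
alt-even k s = trans (cong (λ x → alt x s) (k*2 k)) (alt-double k s)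

parity : ∀ x → Σ ℤ λ k → (x ≡ k * + 2) ⊎ (x ≡ k * + 2 + + 1)
parity x with x ℤD.%ℕ 2 | ℤD.n%ℕd<d x 2 | ℤD.a≡a%ℕn+[a/ℕn]*n x 2
... | 0 | _ | e = (x ℤD./ℕ 2) , inj₁ (trans e (ℤP.+-identityˡ ((x ℤD./ℕ 2) * + 2)))
... | 1 | _ | e = (x ℤD./ℕ 2) , inj₂ (trans e (ℤP.+-comm (+ 1) ((x ℤD./ℕ 2) * + 2)))
... | suc (suc _) | s≤s (s≤s ()) | e

i≡h+[i-h] : ∀ h i → i ≡ h + (i - h)
i≡h+[i-h] = solve-∀

parity-from : ∀ h i → Σ ℤ λ k → (i ≡ h + k * + 2) ⊎ (i ≡ h + k * + 2 + + 1)
parity-from h i with parity (i - h)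
... | k , inj₁ e = k , inj₁ (trans (i≡h+[i-h] h i) (cong (λ z → h + z) e))
... | k , inj₂ e = k , inj₂
  (trans (i≡h+[i-h] h i) (trans (cong (λ z → h + z) e) (sym (ℤP.+-assoc h (k * + 2) (+ 1)))))

even≢odd : ∀ k l → k * + 2 ≢ l * + 2 + + 1
even≢odd k l e = s≢negate {pos} (trans (sym (alt-even k pos)) (trans (cong (λ x → alt x pos) e)
  (trans (alt-suc (l * + 2) pos) (cong negate (alt-even l pos)))))

+-cancelˡ : ∀ h {x y} → h + x ≡ h + y → x ≡ y
+-cancelˡ h {x} {y} e = trans (lem h x) (trans (cong (_- h) e) (sym (lem h y)))
  where
  lem : ∀ h x → x ≡ h + x - h
  lem = solve-∀

+-cancelʳ : ∀ h {x y} → x + h ≡ y + h → x ≡ y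
+-cancelʳ h {x} {y} e = +-cancelˡ h (trans (ℤP.+-comm h x) (trans e (ℤP.+-comm y h)))

even≢odd-from : ∀ h k l → h + k * + 2 ≢ h + l * + 2 + + 1
even≢odd-from h k l e = even≢odd k l (+-cancelˡ h {k * + 2} {l * + 2 + + 1} (trans e (ℤP.+-assoc h (l * + 2) (+ 1))))

*2-inj : ∀ k l → k * + 2 ≡ l * + 2 → k ≡ l
*2-inj k l e = ℤP.*-cancelʳ-≡ k l (+ 2) e

pow2-suc : ∀ n → pow2 (suc n) ≡ + 2 * pow2 n
pow2-suc n = ℤP.pos-* 2 (2 ℕ.^ n)

-- Folding words

interleave : Sgn → List Sgn → List Sgn
interleave s [] = s ∷ []
interleave s (x ∷ b) = s ∷ x ∷ interleave (negate s) b

evenℕ?-suc-negate : ∀ n s → evenℕ? (suc n) (negate s) ≡ evenℕ? n s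
evenℕ?-suc-negate n s =
  trans (evenℕ?-suc n (negate s)) (trans (cong negate (evenℕ?-negate n s)) (negate-invol _))

interleave-++ : ∀ s b x t b' → t ≡ evenℕ? (suc (length b)) s →
  interleave s b ++ x ∷ interleave t b' ≡ interleave s (b ++ x ∷ b')
interleave-++ s [] x t b' refl = refl
interleave-++ s (y ∷ b) x t b' e = cong (λ l → s ∷ y ∷ l)
  (interleave-++ (negate s) b x t b' (trans e (sym (evenℕ?-suc-negate (length b) s))))

bar-∷ : ∀ x xs → bar (x ∷ xs) ≡ bar xs ++ negate x ∷ []
bar-∷ x xs = LP.unfold-reverse (negate x) (map negate xs)

length-bar : ∀ xs → length (bar xs) ≡ length xs
length-bar xs = trans (LP.length-reverse (map negate xs)) (LP.length-map negate xs)

evenℕ?-length-bar : ∀ b t → t ≡ evenℕ? (suc (length (bar b))) (evenℕ? (suc (length b)) t)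
evenℕ?-length-bar b t = trans (sym (evenℕ?-invol (suc (length b)) t))
  (cong (λ m → evenℕ? (suc m) (evenℕ? (suc (length b)) t)) (sym (length-bar b)))

-- The alternation ends with (-1)^|b| s, and this entry, negated, opens the reversed word.
bar-interleave : ∀ s b → bar (interleave s b) ≡ interleave (evenℕ? (suc (length b)) s) (bar b)
bar-interleave s [] = refl
bar-interleave s (x ∷ b) = begin
  bar (s ∷ x ∷ interleave (negate s) b)
    ≡⟨ bar-∷ s (x ∷ interleave (negate s) b) ⟩
  bar (x ∷ interleave (negate s) b) ++ negate s ∷ []
    ≡⟨ cong (_++ negate s ∷ []) (bar-∷ x (interleave (negate s) b)) ⟩
  (bar (interleave (negate s) b) ++ negate x ∷ []) ++ negate s ∷ []
    ≡⟨ LP.++-assoc (bar (interleave (negate s) b)) _ _ ⟩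
  bar (interleave (negate s) b) ++ negate x ∷ interleave (negate s) []
    ≡⟨ cong (_++ negate x ∷ interleave (negate s) []) (bar-interleave (negate s) b) ⟩
  interleave (evenℕ? (suc (length b)) (negate s)) (bar b) ++ negate x ∷ interleave (negate s) []
    ≡⟨ interleave-++ _ (bar b) (negate x) (negate s) [] (evenℕ?-length-bar b (negate s)) ⟩
  interleave (evenℕ? (suc (length b)) (negate s)) (bar b ++ negate x ∷ [])
    ≡⟨ cong₂ interleave (evenℕ?-suc-negate (length b) s) (sym (bar-∷ x b)) ⟩
  interleave (evenℕ? (length b) s) (bar (x ∷ b)) ∎
  where open ≡-Reasoning

-- The definition inserts the middle term; here the finest alternation is split off instead. The
-- left half begins with the sign that makes its alternation continue across the middle term, which
-- itself becomes the middle term of the shorter folding word.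
folding-interleave : ∀ {n w} → Folding (suc n) w →
  Σ Sgn λ s → Σ (List Sgn) λ b → Folding n b × w ≡ interleave s b
folding-interleave (foldS x fold0) = x , [] , fold0 , refl
folding-interleave (foldS x f@(foldS _ _)) with folding-interleave f
... | s , b , fb , e = evenℕ? (suc (length b)) s , bar b ++ x ∷ b , foldS x fb ,
  trans (cong (λ l → bar l ++ x ∷ l) e)
    (trans (cong (_++ x ∷ interleave s b) (bar-interleave s b))
      (interleave-++ _ (bar b) x s b (evenℕ?-length-bar b s)))

module _ {A : Set} where
  evens odds : List A → List A
  evens [] = []
  evens (x ∷ xs) = x ∷ odds xs
  odds [] = []
  odds (x ∷ xs) = evens xs

  evens-odds-++ : ∀ p r →
    (evens (p ++ r) ≡ evens p ++ evens r × odds (p ++ r) ≡ odds p ++ odds r) ⊎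
    (evens (p ++ r) ≡ evens p ++ odds r × odds (p ++ r) ≡ odds p ++ evens r)
  evens-odds-++ [] r = inj₁ (refl , refl)
  evens-odds-++ (x ∷ p) r with evens-odds-++ p r
  ... | inj₁ (e , o) = inj₂ (cong (x ∷_) o , e)
  ... | inj₂ (e , o) = inj₁ (cong (x ∷_) o , e)

-- The parity of the length of the prefix decides whether the even positions of `u` fall on even or
-- on odd positions of `v`.
subword-split : ∀ u v → Subword u v →
  (Subword (evens u) (evens v) × Subword (odds u) (odds v)) ⊎
  (Subword (odds u) (evens v) × Subword (evens u) (odds v))
subword-split u v (p , q , refl) with evens-odds-++ p (u ++ q) | evens-odds-++ u q
... | inj₁ (e , o) | inj₁ (e' , o') = inj₁
  ((evens p , evens q , sym (trans e (cong (evens p ++_) e'))) ,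
   (odds p , odds q , sym (trans o (cong (odds p ++_) o'))))
... | inj₁ (e , o) | inj₂ (e' , o') = inj₁
  ((evens p , odds q , sym (trans e (cong (evens p ++_) e'))) ,
   (odds p , evens q , sym (trans o (cong (odds p ++_) o'))))
... | inj₂ (e , o) | inj₁ (e' , o') = inj₂
  ((evens p , odds q , sym (trans e (cong (evens p ++_) o'))) ,
   (odds p , evens q , sym (trans o (cong (odds p ++_) e'))))
... | inj₂ (e , o) | inj₂ (e' , o') = inj₂
  ((evens p , evens q , sym (trans e (cong (evens p ++_) o'))) ,
   (odds p , odds q , sym (trans o (cong (odds p ++_) e'))))

alternating : Sgn → ℕ → List Sgn
alternating s zero = []
alternating s (suc n) = s ∷ alternating (negate s) n

evens-interleave : ∀ s b → evens (interleave s b) ≡ alternating s (suc (length b))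
evens-interleave s [] = refl
evens-interleave s (x ∷ b) = cong (s ∷_) (evens-interleave (negate s) b)

odds-interleave : ∀ s b → odds (interleave s b) ≡ b
odds-interleave s [] = refl
odds-interleave s (x ∷ b) = cong (x ∷_) (odds-interleave (negate s) b)

prefix-alternating : ∀ u q s n → u ++ q ≡ alternating s n → u ≡ alternating s (length u)
prefix-alternating [] q s n e = refl
prefix-alternating (x ∷ u) q s (suc n) e with LP.∷-injective e
... | refl , e' = cong (x ∷_) (prefix-alternating u q (negate s) n e')

subword-alternating : ∀ u s n → Subword u (alternating s n) → Σ Sgn λ t → u ≡ alternating t (length u)
subword-alternating u s n ([] , q , e) = s , prefix-alternating u q s n e
subword-alternating u s (suc n) (x ∷ p , q , e) =
  subword-alternating u (negate s) n (p , q , LP.∷-injectiveʳ e)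

subword-trans : ∀ {u v w} → Subword u v → Subword v w → Subword u w
subword-trans {u} (p , q , refl) (p' , q' , refl) = p' ++ p , q ++ q' ,
  trans (LP.++-assoc p' p (u ++ q ++ q'))
    (cong (p' ++_) (trans (cong (p ++_) (sym (LP.++-assoc u q q'))) (sym (LP.++-assoc p (u ++ q) q'))))

-- Doubling by recursion, so that `evens` and `odds` of a list of this length compute.
dbl : ℕ → ℕ
dbl zero = zero
dbl (suc m) = suc (suc (dbl m))

evens-applyUpTo : ∀ {A : Set} (f : ℕ → A) m → evens (applyUpTo f (dbl m)) ≡ applyUpTo (λ t → f (dbl t)) m
evens-applyUpTo f zero = refl
evens-applyUpTo f (suc m) = cong (f 0 ∷_) (evens-applyUpTo (λ t → f (suc (suc t))) m)

odds-applyUpTo : ∀ {A : Set} (f : ℕ → A) m → odds (applyUpTo f (dbl m)) ≡ applyUpTo (λ t → f (suc (dbl t))) m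
odds-applyUpTo f zero = refl
odds-applyUpTo f (suc m) = cong (f 1 ∷_) (odds-applyUpTo (λ t → f (suc (suc t))) m)

applyUpTo-++ : ∀ {A : Set} (f : ℕ → A) k m →
  applyUpTo f (k ℕ.+ m) ≡ applyUpTo f k ++ applyUpTo (λ t → f (k ℕ.+ t)) m
applyUpTo-++ f zero m = refl
applyUpTo-++ f (suc k) m = cong (f 0 ∷_) (applyUpTo-++ (λ t → f (suc t)) k m)

applyUpTo-cong : ∀ {A : Set} {f g : ℕ → A} m → (∀ t → f t ≡ g t) → applyUpTo f m ≡ applyUpTo g m
applyUpTo-cong zero e = refl
applyUpTo-cong (suc m) e = cong₂ _∷_ (e 0) (applyUpTo-cong m (λ t → e (suc t)))

AltOn : (ℕ → Sgn) → ℕ → Set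
AltOn g m = ∀ k → k ℕ.< m → g k ≡ evenℕ? k (g 0)

FoldOn : (ℕ → Sgn) → ℕ → Set
FoldOn g m = Σ ℕ λ n → Σ (List Sgn) λ w → Folding n w × Subword (applyUpTo g m) w

altOn-cong : ∀ {f g} m → (∀ t → f t ≡ g t) → AltOn f m → AltOn g m
altOn-cong m e al k k<m = trans (sym (e k)) (trans (al k k<m) (cong (evenℕ? k) (e 0)))

foldOn-cong : ∀ {f g} m → (∀ t → f t ≡ g t) → FoldOn f m → FoldOn g m
foldOn-cong m e (n , w , fw , sw) = n , w , fw , subst (λ l → Subword l w) (applyUpTo-cong m e) sw

foldOn-suffix : ∀ {g} k m → FoldOn g (k ℕ.+ m) → FoldOn (λ t → g (k ℕ.+ t)) m
foldOn-suffix {g} k m (n , w , fw , sw) = n , w , fw ,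
  subword-trans (applyUpTo g k , [] , trans (cong (applyUpTo g k ++_) (LP.++-identityʳ _))
    (sym (applyUpTo-++ g k m))) sw

foldOn-prefix : ∀ {g} m r → FoldOn g (m ℕ.+ r) → FoldOn g m
foldOn-prefix {g} m r (n , w , fw , sw) = n , w , fw ,
  subword-trans ([] , applyUpTo (λ t → g (m ℕ.+ t)) r , sym (applyUpTo-++ g m r)) sw

applyUpTo-alternating : ∀ f m t n → applyUpTo f m ≡ alternating t n → ∀ k → k ℕ.< m → f k ≡ evenℕ? k t
applyUpTo-alternating f (suc m) t (suc n) e zero k<m = LP.∷-injectiveˡ e
applyUpTo-alternating f (suc m) t (suc n) e (suc k) (s≤s k<m) =
  trans (applyUpTo-alternating (λ i → f (suc i)) m (negate t) n (LP.∷-injectiveʳ e) k k<m)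
    (trans (evenℕ?-negate k t) (sym (evenℕ?-suc k t)))

altOn-subword : ∀ g m s n → Subword (applyUpTo g m) (alternating s n) → AltOn g m
altOn-subword g m s n sw k k<m with subword-alternating _ s n sw
... | t , e = trans (al k k<m) (cong (evenℕ? k) (sym (al 0 (ℕP.≤-trans (s≤s z≤n) k<m))))
  where al = applyUpTo-alternating g m t _ e

foldOn-split : ∀ f m → FoldOn f (dbl m) →
  (AltOn (λ t → f (dbl t)) m × FoldOn (λ t → f (suc (dbl t))) m) ⊎
  (AltOn (λ t → f (suc (dbl t))) m × FoldOn (λ t → f (dbl t)) m)
foldOn-split f zero _ = inj₁ ((λ _ ()) , 0 , [] , fold0 , [] , [] , refl)
foldOn-split f (suc m) (zero , .[] , fold0 , [] , q , ())
foldOn-split f (suc m) (zero , .[] , fold0 , _ ∷ _ , q , ())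
foldOn-split f m@(suc _) (suc n , w , fw , sw) with folding-interleave fw
... | s , b , fb , refl with subword-split (applyUpTo f (dbl m)) (interleave s b) sw
... | inj₁ (se , so) = inj₁
  (altOn-subword (λ t → f (dbl t)) m s (suc (length b)) (subst₂ Subword (evens-applyUpTo f m)
    (evens-interleave s b) se) ,
   n , b , fb , subst₂ Subword (odds-applyUpTo f m) (odds-interleave s b) so)
... | inj₂ (so , se) = inj₂
  (altOn-subword (λ t → f (suc (dbl t))) m s (suc (length b)) (subst₂ Subword (odds-applyUpTo f m)
    (evens-interleave s b) so) ,
   n , b , fb , subst₂ Subword (evens-applyUpTo f m) (odds-interleave s b) se)

-- In an alternation, terms at distance 2 agree; among four consecutive terms of a folding word, one
-- parity class changes sign between its two terms.
foldOn-not-alt : ∀ g → FoldOn g 4 → ¬ AltOn g 4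
foldOn-not-alt g fo al with foldOn-split g 2 fo
... | inj₁ (al' , _) = s≢negate (trans (sym (al 2 (s≤s (s≤s (s≤s z≤n))))) (al' 1 (s≤s (s≤s z≤n))))
... | inj₂ (al' , _) = s≢negate (trans (sym (trans (al 3 (s≤s (s≤s (s≤s (s≤s z≤n))))) (sym (al 1 (s≤s (s≤s z≤n))))))
  (al' 1 (s≤s (s≤s z≤n))))

dbl-*2 : ∀ t → + dbl t ≡ + t * + 2
dbl-*2 t = trans (cong +_ (go t)) (ℤP.pos-* t 2)
  where
  go : ∀ t → dbl t ≡ t ℕ.* 2
  go zero = refl
  go (suc t) = cong (λ m → suc (suc m)) (go t)

cfs-split : ∀ a → CompleteFoldingSeq a → ∀ h m →
  (AltOn (λ t → a (h + + t * + 2)) m × FoldOn (λ t → a (h + + t * + 2 + + 1)) m) ⊎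
  (AltOn (λ t → a (h + + t * + 2 + + 1)) m × FoldOn (λ t → a (h + + t * + 2)) m)
cfs-split a cfs h m = go (foldOn-split (λ i → a (h + + i)) m
  (subst (λ l → Σ ℕ λ n → Σ (List Sgn) λ w → Folding n w × Subword l w) (LP.map-upTo (λ i → a (h + + i)) (dbl m))
    (cfs h (dbl m))))
  where
  ev : ∀ t → a (h + + dbl t) ≡ a (h + + t * + 2)
  ev t = cong (λ z → a (h + z)) (dbl-*2 t)
  od : ∀ t → a (h + + suc (dbl t)) ≡ a (h + + t * + 2 + + 1)
  od t = cong a (trans (cong (λ z → h + z) (trans (cong +_ (ℕP.+-comm 1 (dbl t))) (cong (_+ + 1) (dbl-*2 t))))
    (sym (ℤP.+-assoc h (+ t * + 2) (+ 1))))
  go : _ ⊎ _ → _ ⊎ _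
  go (inj₁ (al , fo)) = inj₁ (altOn-cong m ev al , foldOn-cong m od fo)
  go (inj₂ (al , fo)) = inj₂ (altOn-cong m od al , foldOn-cong m ev fo)

-- The alternating class and the derived sequence

derivedSeq : Seq → ℤ → Seq
derivedSeq a h k = a (h + k * + 2 + + 1)

module _ (a : Seq) (cfs : CompleteFoldingSeq a) (h : ℤ) (base : AltOn (λ t → a (h + + t * + 2)) 4) where

  private
    -- All windows around the four terms of `base` choose the same class: the other choice would
    -- make these alternating terms consecutive in a folding word.
    alternates-around : ∀ k m →
      AltOn (λ t → a (h - + k * + 2 + + t * + 2)) (k ℕ.+ (4 ℕ.+ m)) ×
      FoldOn (λ t → a (h - + k * + 2 + + t * + 2 + + 1)) (k ℕ.+ (4 ℕ.+ m))
    alternates-around k m with cfs-split a cfs (h - + k * + 2) (k ℕ.+ (4 ℕ.+ m))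
    ... | inj₁ p = p
    ... | inj₂ (_ , fo) = ⊥-elim (foldOn-not-alt _
      (foldOn-cong 4 shift (foldOn-prefix {λ t → ev (k ℕ.+ t)} 4 m (foldOn-suffix {ev} k (4 ℕ.+ m) fo))) base)
      where
      ev : ℕ → Sgn
      ev t = a (h - + k * + 2 + + t * + 2)
      lem : ∀ h k t → h - k * + 2 + (k + t) * + 2 ≡ h + t * + 2
      lem = solve-∀
      shift : ∀ t → a (h - + k * + 2 + + (k ℕ.+ t) * + 2) ≡ a (h + + t * + 2)
      shift t = cong a (lem h (+ k) (+ t))

  alternates-everywhere : IsH a 0 h
  alternates-everywhere (+ n) =
    trans (cong a (lem h (+ n)))
      (trans (proj₁ (alternates-around 0 n) n (ℕP.≤-trans (ℕP.m≤n+m (suc n) 3) ℕP.≤-refl))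
        (cong (λ z → evenℕ? n (a z)) (lem' h)))
    where
    lem : ∀ h n → h + n * + 2 ≡ h - + 0 * + 2 + n * + 2
    lem = solve-∀
    lem' : ∀ h → h - + 0 * + 2 + + 0 * + 2 ≡ h
    lem' = solve-∀
  alternates-everywhere -[1+ n ] =
    trans (sym (evenℕ?-invol (suc n) _)) (cong (evenℕ? (suc n))
      (trans (cong (λ z → evenℕ? (suc n) (a z)) (lem' h (+ suc n)))
        (trans (sym (proj₁ (alternates-around (suc n) 0) (suc n) (ℕP.≤-trans (ℕP.m≤m+n (suc (suc n)) 3)
          (ℕP.≤-reflexive (lem₃ n)))))
          (cong a (lem h (+ suc n))))))
    where
    lem : ∀ h n → h - n * + 2 + n * + 2 ≡ h
    lem = solve-∀
    lem' : ∀ h n → h + (- n) * + 2 ≡ h - n * + 2 + + 0 * + 2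
    lem' = solve-∀
    lem₃ : ∀ n → suc (suc n) ℕ.+ 3 ≡ suc n ℕ.+ 4
    lem₃ n = cong suc (sym (ℕP.+-suc n 3))

  derived-cfs : CompleteFoldingSeq (derivedSeq a h)
  derived-cfs h' m = subst (λ l → Σ ℕ λ n → Σ (List Sgn) λ w → Folding n w × Subword l w)
    (sym (LP.map-upTo _ m)) (go (offset h'))
    where
    -- The window starts |h'| places to the left of `h`, so that the position h' becomes the natural
    -- number h' + |h'|.
    offset : ∀ z → Σ ℕ λ t → + t ≡ z + + ∣ z ∣
    offset (+ n) = n ℕ.+ n , refl
    offset -[1+ n ] = 0 , sym (ℤP.+-inverseˡ (+ suc n))
    go : (Σ ℕ λ t → + t ≡ h' + + ∣ h' ∣) → FoldOn (λ i → derivedSeq a h (h' + + i)) m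
    go (t₀ , e) = foldOn-cong m shift (foldOn-prefix {λ t → od (t₀ ℕ.+ t)} m (k ℕ.+ 4)
      (foldOn-suffix {od} t₀ (m ℕ.+ (k ℕ.+ 4))
      (subst (FoldOn od) size (proj₂ (alternates-around k (t₀ ℕ.+ m))))))
      where
      k = ∣ h' ∣
      od : ℕ → Sgn
      od t = a (h - + k * + 2 + + t * + 2 + + 1)
      size : k ℕ.+ (4 ℕ.+ (t₀ ℕ.+ m)) ≡ t₀ ℕ.+ (m ℕ.+ (k ℕ.+ 4))
      size = trans (sym (ℕP.+-assoc k 4 _)) (trans (ℕP.+-comm (k ℕ.+ 4) _) (ℕP.+-assoc t₀ m _))
      lem : ∀ h h' k t → h - k * + 2 + (h' + k + t) * + 2 + + 1 ≡ h + (h' + t) * + 2 + + 1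
      lem = solve-∀
      shift : ∀ t → a (h - + k * + 2 + + (t₀ ℕ.+ t) * + 2 + + 1) ≡ derivedSeq a h (h' + + t)
      shift t = cong a (trans (cong (λ z → h - + k * + 2 + (z + + t) * + 2 + + 1) e) (lem h h' (+ k) (+ t)))

cfs-cong : ∀ {a b} → (∀ i → a i ≡ b i) → CompleteFoldingSeq a → CompleteFoldingSeq b
cfs-cong e cfs h m with cfs h m
... | n , w , fw , sw = n , w , fw , subst (λ l → Subword l w) (LP.map-cong (λ i → e (h + + i)) (upTo m)) sw

-- Levels of indices

-- `IsH`, and below `InE`, are wrapped in records so that sequence and index can be inferred from a
-- proof.
record AtLevel (a : Seq) (n : ℕ) (i : ℤ) : Set where
  constructor atLevel
  field alternates : IsH a n i
open AtLevel public

record OnE (a : Seq) (n : ℕ) (i : ℤ) : Set where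
  constructor onE
  field
    {rep}   : ℤ
    rep-lev : AtLevel a n rep
    mult    : ℤ
    eq      : i ≡ rep + mult * pow2 n

InE⇒OnE : ∀ {a n i} → InE a n i → OnE a n i
InE⇒OnE {a} {n} {i} (h , hh , d) with ∣ᵤ⇒∣ {pow2 n} {i - h} d
... | divides k e = onE {rep = h} (atLevel hh) k (trans (i≡h+[i-h] h i) (cong (λ z → h + z) e))

OnE⇒InE : ∀ {a n i} → OnE a n i → InE a n i
OnE⇒InE {a} {n} {i} (onE {h} hh k e) = h , alternates hh , ∣⇒∣ᵤ {pow2 n} {i - h}
  (divides k (trans (cong (_- h) e) (lem h (k * pow2 n))))
  where
  lem : ∀ h x → h + x - h ≡ x
  lem = solve-∀

level-shift : ∀ {a n i} m → AtLevel a n i → AtLevel a n (i + m * pow2 (suc n))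
level-shift {a} {n} {i} m (atLevel hi) = atLevel λ k → begin
  a (i + m * P + k * P)     ≡⟨ cong a (lem i m k P) ⟩
  a (i + (k + m) * P)       ≡⟨ hi (k + m) ⟩
  alt (k + m) (a i)         ≡⟨ alt-+ k m (a i) ⟩
  alt k (alt m (a i))       ≡⟨ cong (alt k) (sym (hi m)) ⟩
  alt k (a (i + m * P))     ∎
  where
  open ≡-Reasoning
  P = pow2 (suc n)
  lem : ∀ i m k P → i + m * P + k * P ≡ i + (k + m) * P
  lem = solve-∀

level-step : ∀ {a n i} → AtLevel a n i → a (i + pow2 (suc n)) ≡ negate (a i)
level-step {a} {n} {i} (atLevel hi) = trans (cong (λ z → a (i + z)) (sym (ℤP.*-identityˡ (pow2 (suc n))))) (hi (+ 1))

OnE-shift : ∀ {a n i} m → OnE a n i → OnE a n (i + m * pow2 n)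
OnE-shift {a} {n} {i} m (onE {h} hh k e) = onE hh (k + m) (trans (cong (_+ m * pow2 n) e) (lem h k m (pow2 n)))
  where
  lem : ∀ h k m P → h + k * P + m * P ≡ h + (k + m) * P
  lem = solve-∀

derive : ∀ a → CompleteFoldingSeq a → Σ ℤ λ h → AtLevel a 0 h × CompleteFoldingSeq (derivedSeq a h)
derive a cfs with cfs-split a cfs (+ 0) 4
... | inj₁ (al , _) = + 0 , atLevel (alternates-everywhere a cfs (+ 0) al) , derived-cfs a cfs (+ 0) al
... | inj₂ (al , _) = + 1 , atLevel (alternates-everywhere a cfs (+ 1) al') , derived-cfs a cfs (+ 1) al'
  where
  lem : ∀ t → + 0 + t * + 2 + + 1 ≡ + 1 + t * + 2
  lem = solve-∀
  al' = altOn-cong 4 (λ t → cong a (lem (+ t))) al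

module Derivation (a : Seq) (h : ℤ) (h-lev : AtLevel a 0 h) where

  b : Seq
  b = derivedSeq a h

  private
    index-shift : ∀ k m n → h + (k + m * pow2 n) * + 2 + + 1 ≡ h + k * + 2 + + 1 + m * pow2 (suc n)
    index-shift k m n = trans (lem h k m (pow2 n)) (cong (λ z → h + k * + 2 + + 1 + m * z) (sym (pow2-suc n)))
      where
      lem : ∀ h k m P → h + (k + m * P) * + 2 + + 1 ≡ h + k * + 2 + + 1 + m * (+ 2 * P)
      lem = solve-∀

  level-lift : ∀ {n k} → AtLevel b n k → AtLevel a (suc n) (h + k * + 2 + + 1)
  level-lift {n} {k} (atLevel hk) = atLevel λ m → trans (cong a (sym (index-shift k m (suc n)))) (hk m)

  level-drop : ∀ {n k} → AtLevel a (suc n) (h + k * + 2 + + 1) → AtLevel b n k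
  level-drop {n} {k} (atLevel hk) = atLevel λ m → trans (cong a (index-shift k m (suc n))) (hk m)

  level-odd : ∀ {n i} → AtLevel a (suc n) i → Σ ℤ λ k → i ≡ h + k * + 2 + + 1
  level-odd {n} {i} hi with parity-from h i
  ... | k , inj₂ e = k , e
  -- On the alternating class, 2^(n+2) is an even number of steps and keeps the sign, but level n +
  -- 1 requires a change.
  ... | k , inj₁ refl = ⊥-elim (s≢negate (trans (sym same) (level-step hi)))
    where
    P = pow2 n
    lem : ∀ h k P → h + k * + 2 + + 2 * (+ 2 * P) ≡ h + (P * + 2 + k) * + 2
    lem = solve-∀
    same : a (i + pow2 (suc (suc n))) ≡ a i
    same = trans (cong (λ z → a (h + k * + 2 + z)) (trans (pow2-suc (suc n)) (cong (λ z → + 2 * z) (pow2-suc n))))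
      (trans (cong a (lem h k P)) (trans (alternates h-lev (P * + 2 + k)) (trans (alt-+ (P * + 2) k (a h))
        (trans (alt-even P (alt k (a h))) (sym (alternates h-lev k))))))

  OnE-lift : ∀ {n k} → OnE b n k → OnE a (suc n) (h + k * + 2 + + 1)
  OnE-lift {n} {k} (onE {h₁} hh m refl) = onE (level-lift hh) m (index-shift h₁ m n)

  OnE-drop : ∀ {n i} → OnE a (suc n) i → Σ ℤ λ k → (i ≡ h + k * + 2 + + 1) × OnE b n k
  OnE-drop {n} {i} (onE {h₁} hh m e) with level-odd hh
  ... | k₁ , refl = k₁ + m * pow2 n , trans e (sym (index-shift k₁ m n)) , onE {rep = k₁} (level-drop hh) m refl

  odd-index-inj : ∀ {k l} → h + k * + 2 + + 1 ≡ h + l * + 2 + + 1 → k ≡ l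
  odd-index-inj {k} {l} e = *2-inj k l
    (+-cancelˡ h {k * + 2} {l * + 2} (+-cancelʳ (+ 1) {h + k * + 2} {h + l * + 2} e))

  OnE-drop′ : ∀ {n k} → OnE a (suc n) (h + k * + 2 + + 1) → OnE b n k
  OnE-drop′ {n} {k} oe with OnE-drop oe
  ... | k' , e , oe' = subst (OnE b n) (sym (odd-index-inj e)) oe'

  -- Outside the class of `h`, an index of level 0 would make the whole derived sequence alternate
  -- with step 1, hence have period 2; but on its own alternating class a shift by 2 changes the
  -- sign.
  level₀-even : CompleteFoldingSeq b → ∀ {i} → AtLevel a 0 i → Σ ℤ λ k → i ≡ h + k * + 2
  level₀-even cfs {i} hi with parity-from h i
  ... | k , inj₁ e = k , e
  ... | k , inj₂ refl with derive b cfs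
  ... | h' , hh' , _ = ⊥-elim (s≢negate (trans (sym same) (level-step hh')))
    where
    step : ∀ m → b (k + m) ≡ alt m (b k)
    step m = trans (cong a (lem h k m)) (alternates hi m)
      where
      lem : ∀ h k m → h + (k + m) * + 2 + + 1 ≡ h + k * + 2 + + 1 + m * + 2
      lem = solve-∀
    same : b (h' + + 2) ≡ b h'
    same = trans (cong b (lem h' k))
      (trans (step (h' - k + + 2)) (trans (cong (λ z → alt z (b k)) (ℤP.+-comm (h' - k) (+ 2)))
      (trans (alt-+ (+ 2) (h' - k) (b k)) (trans (sym (step (h' - k))) (cong b (lem' h' k))))))
      where
      lem : ∀ h' k → h' + + 2 ≡ k + (h' - k + + 2)
      lem = solve-∀
      lem' : ∀ h' k → k + (h' - k) ≡ h'
      lem' = solve-∀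

OnE₀ : ∀ {a} → CompleteFoldingSeq a → ∀ i → OnE a 0 i
OnE₀ {a} cfs i with derive a cfs
... | h , hh , _ = onE hh (i - h) (lem h i)
  where
  lem : ∀ h i → i ≡ h + (i - h) * + 1
  lem = solve-∀

level-cases : ∀ n a → CompleteFoldingSeq a → ∀ i → OnE a n i ⊎ (Σ ℕ λ m → m ℕ.< n × AtLevel a m i)
level-cases zero a cfs i = inj₁ (OnE₀ cfs i)
level-cases (suc n) a cfs i with derive a cfs
... | h , hh , cfs' with parity-from h i
... | k , inj₁ refl = inj₂ (0 , s≤s z≤n , level-shift k hh)
... | k , inj₂ refl with level-cases n (derivedSeq a h) cfs' k
... | inj₁ oe = inj₁ (Derivation.OnE-lift a h hh oe)
... | inj₂ (m , m<n , hk) = inj₂ (suc m , s≤s m<n , Derivation.level-lift a h hh hk)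

-- E_n consists of the indices of level n and those of E_{n+1}, which take turns at distance 2^n.
level-near : ∀ n a → CompleteFoldingSeq a → ∀ i → OnE a n i → AtLevel a n i ⊎ AtLevel a n (i + pow2 n)
level-near zero a cfs i _ with derive a cfs
... | h , hh , _ with parity-from h i
... | k , inj₁ refl = inj₁ (level-shift k hh)
... | k , inj₂ refl = inj₂ (subst (AtLevel a 0) (lem h k) (level-shift (k + + 1) hh))
  where
  lem : ∀ h k → h + (k + + 1) * + 2 ≡ h + k * + 2 + + 1 + + 1
  lem = solve-∀
level-near (suc n) a cfs i oe with derive a cfs
... | h , hh , cfs' with Derivation.OnE-drop a h hh oe
... | k , refl , oe' with level-near n (derivedSeq a h) cfs' k oe'
... | inj₁ hk = inj₁ (Derivation.level-lift a h hh hk)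
... | inj₂ hk = inj₂ (subst (AtLevel a (suc n))
  (trans (lem h k (pow2 n)) (cong (λ z → h + k * + 2 + + 1 + z) (sym (pow2-suc n))))
  (Derivation.level-lift a h hh hk))
  where
  lem : ∀ h k P → h + (k + P) * + 2 + + 1 ≡ h + k * + 2 + + 1 + + 2 * P
  lem = solve-∀

OnE-unique : ∀ n a → CompleteFoldingSeq a → ∀ i j → OnE a n i → OnE a n j → Σ ℤ λ k → i ≡ j + k * pow2 n
OnE-unique zero a cfs i j _ _ = i - j , lem i j
  where
  lem : ∀ i j → i ≡ j + (i - j) * + 1
  lem = solve-∀
OnE-unique (suc n) a cfs i j oi oj with derive a cfs
... | h , hh , cfs' with Derivation.OnE-drop a h hh oi | Derivation.OnE-drop a h hh oj
... | k , refl , ok | l , refl , ol with OnE-unique n (derivedSeq a h) cfs' k l ok ol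
... | m , refl = m , trans (lem h l m (pow2 n)) (cong (λ z → h + l * + 2 + + 1 + m * z) (sym (pow2-suc n)))
  where
  lem : ∀ h l m P → h + (l + m * P) * + 2 + + 1 ≡ h + l * + 2 + + 1 + m * (+ 2 * P)
  lem = solve-∀

level-unique : ∀ n a → CompleteFoldingSeq a → ∀ i j → AtLevel a n i → AtLevel a n j → Σ ℤ λ k → i ≡ j + k * pow2
  (suc n)
level-unique zero a cfs i j hi hj with derive a cfs
... | h , hh , cfs' with Derivation.level₀-even a h hh cfs' hi | Derivation.level₀-even a h hh cfs' hj
... | k , refl | l , refl = k - l , lem h k l
  where
  lem : ∀ h k l → h + k * + 2 ≡ h + l * + 2 + (k - l) * + 2
  lem = solve-∀
level-unique (suc n) a cfs i j hi hj with derive a cfs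
... | h , hh , cfs' with Derivation.level-odd a h hh hi | Derivation.level-odd a h hh hj
... | k , refl | l , refl with level-unique n (derivedSeq a h) cfs' k l (Derivation.level-drop a h hh hi)
  (Derivation.level-drop a h hh hj)
... | m , refl = m , trans (lem h l m (pow2 (suc n))) (cong (λ z → h + l * + 2 + + 1 + m * z)
  (sym (pow2-suc (suc n))))
  where
  lem : ∀ h l m P → h + (l + m * P) * + 2 + + 1 ≡ h + l * + 2 + + 1 + m * (+ 2 * P)
  lem = solve-∀

level-unique-sign : ∀ n a → CompleteFoldingSeq a → ∀ i j → AtLevel a n i → AtLevel a n j → a i ≡ a j →
  Σ ℤ λ k → i ≡ j + k * pow2 (suc (suc n))
level-unique-sign n a cfs i j hi hj e with level-unique n a cfs i j hi hj
... | k , refl with parity k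
... | l , inj₁ refl = l , trans (lem j l (pow2 (suc n))) (cong (λ z → j + l * z) (sym (pow2-suc (suc n))))
  where
  lem : ∀ j l P → j + l * + 2 * P ≡ j + l * (+ 2 * P)
  lem = solve-∀
... | l , inj₂ refl = ⊥-elim (s≢negate (trans (sym e) (trans (alternates hj (l * + 2 + + 1))
  (trans (alt-suc (l * + 2) (a j)) (cong negate (alt-even l (a j)))))))

level-not-OnE : ∀ n a → CompleteFoldingSeq a → ∀ i → AtLevel a n i → ¬ OnE a (suc n) i
level-not-OnE zero a cfs i hi oe with derive a cfs
... | h , hh , cfs' with Derivation.level₀-even a h hh cfs' hi | Derivation.OnE-drop a h hh oe
... | k , e | l , e' , _ = even≢odd-from h k l (trans (sym e) e')
level-not-OnE (suc n) a cfs i hi oe with derive a cfs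
... | h , hh , cfs' with Derivation.level-odd a h hh hi
... | k , refl = level-not-OnE n (derivedSeq a h) cfs' k (Derivation.level-drop a h hh hi)
  (Derivation.OnE-drop′ a h hh oe)

OnE-mono : ∀ n a → CompleteFoldingSeq a → ∀ i → OnE a (suc n) i → OnE a n i
OnE-mono zero a cfs i _ = OnE₀ cfs i
OnE-mono (suc n) a cfs i oe with derive a cfs
... | h , hh , cfs' with Derivation.OnE-drop a h hh oe
... | k , refl , oe' = Derivation.OnE-lift a h hh (OnE-mono n (derivedSeq a h) cfs' k oe')

level⇒OnE : ∀ {a n i} → AtLevel a n i → OnE a n i
level⇒OnE {a} {n} {i} hi = onE hi (+ 0) (lem i (pow2 n))
  where
  lem : ∀ i P → i ≡ i + + 0 * P
  lem = solve-∀

level⇒OnE-next : ∀ n a → CompleteFoldingSeq a → ∀ i → AtLevel a n i → OnE a (suc n) (i + pow2 n)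
level⇒OnE-next zero a cfs i hi with level-cases 1 a cfs (i + + 1)
... | inj₁ oe = oe
... | inj₂ (zero , _ , h') with level-unique 0 a cfs (i + + 1) i h' hi
... | k , e = ⊥-elim (even≢odd-from i k (+ 0) (trans (sym e) (cong (_+ + 1) (sym (ℤP.+-identityʳ i)))))
level⇒OnE-next zero a cfs i hi | inj₂ (suc _ , s≤s () , _)
level⇒OnE-next (suc n) a cfs i hi with derive a cfs
... | h , hh , cfs' with Derivation.level-odd a h hh hi
... | k , refl = subst (OnE a (suc (suc n)))
  (trans (lem h k (pow2 n)) (cong (λ z → h + k * + 2 + + 1 + z) (sym (pow2-suc n))))
  (Derivation.OnE-lift a h hh (level⇒OnE-next n (derivedSeq a h) cfs' k (Derivation.level-drop a h hh hi)))
  where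
  lem : ∀ h k P → h + (k + P) * + 2 + + 1 ≡ h + k * + 2 + + 1 + + 2 * P
  lem = solve-∀

OnE-exclusive : ∀ n a → CompleteFoldingSeq a → ∀ i → OnE a (suc n) i → ¬ OnE a (suc n) (i + pow2 n)
OnE-exclusive zero a cfs i oi oj with OnE-unique 1 a cfs _ _ oj oi
... | k , e = even≢odd-from i k (+ 0) (trans (sym e) (cong (_+ + 1) (sym (ℤP.+-identityʳ i))))
OnE-exclusive (suc n) a cfs i oi oj with derive a cfs
... | h , hh , cfs' with Derivation.OnE-drop a h hh oi
... | k , refl , ok = OnE-exclusive n (derivedSeq a h) cfs' k ok
  (Derivation.OnE-drop′ a h hh (subst (OnE a (suc (suc n))) (trans (cong (λ z → h + k * + 2 + + 1 + z) (pow2-suc n))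
    (sym (lem h k (pow2 n)))) oj))
  where
  lem : ∀ h k P → h + (k + P) * + 2 + + 1 ≡ h + k * + 2 + + 1 + + 2 * P
  lem = solve-∀

-- Recognising levels in a window

record Agree (a : Seq) (i : ℤ) (a' : Seq) (j : ℤ) (m : ℕ) : Set where
  constructor agree
  field at : ∀ t → t ℕ.< m → a (i + + t) ≡ a' (j + + t)
open Agree public

agree-sym : ∀ {a i a' j m} → Agree a i a' j m → Agree a' j a i m
agree-sym ag = agree λ t t<m → sym (at ag t t<m)

agree-≤ : ∀ {a i a' j m n} → m ℕ.≤ n → Agree a i a' j n → Agree a i a' j m
agree-≤ m≤n ag = agree λ t t<m → at ag t (ℕP.≤-trans t<m m≤n)

agree-head : ∀ {a i a' j m} → Agree a i a' j (suc m) → a i ≡ a' j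
agree-head {a} {i} {a'} {j} ag = trans (cong a (sym (ℤP.+-identityʳ i)))
  (trans (at ag 0 (s≤s z≤n)) (cong a' (ℤP.+-identityʳ j)))

agree⇒window : ∀ {a i a' j m} → Agree a i a' j m → window a i m ≡ window a' j m
agree⇒window {a} {i} {a'} {j} {m} ag = trans (LP.map-upTo _ m) (trans (go _ _ m (at ag)) (sym (LP.map-upTo _ m)))
  where
  go : ∀ (f g : ℕ → Sgn) m → (∀ t → t ℕ.< m → f t ≡ g t) → applyUpTo f m ≡ applyUpTo g m
  go f g zero e = refl
  go f g (suc m) e = cong₂ _∷_ (e 0 (s≤s z≤n)) (go _ _ m (λ t t<m → e (suc t) (s≤s t<m)))

window⇒agree : ∀ {a i a' j m} → window a i m ≡ window a' j m → Agree a i a' j m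
window⇒agree {a} {i} {a'} {j} {m} e = agree (go _ _ m (trans (sym (LP.map-upTo _ m)) (trans e (LP.map-upTo _ m))))
  where
  go : ∀ (f g : ℕ → Sgn) m → applyUpTo f m ≡ applyUpTo g m → ∀ t → t ℕ.< m → f t ≡ g t
  go f g (suc m) e zero t<m = LP.∷-injectiveˡ e
  go f g (suc m) e (suc t) (s≤s t<m) = go _ _ m (LP.∷-injectiveʳ e) t t<m

-- If `j` were not of level 0, then `j` or `j + 2` would have level 1 and a shift by 4 from it would
-- change the sign, which level 0 at `i` forbids. The farthest term read is at distance 6, hence the
-- 7.
agree-level₀ : ∀ {a a'} → CompleteFoldingSeq a' → ∀ {i j} → Agree a i a' j 7 → AtLevel a 0 i → AtLevel a' 0 j
agree-level₀ {a} {a'} cfs' {i} {j} ag lev with level-cases 1 a' cfs' j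
... | inj₂ (zero , _ , lev') = lev'
... | inj₂ (suc _ , s≤s () , _)
... | inj₁ oe = ⊥-elim (absurd (level-near 1 a' cfs' j oe))
  where
  four : a (i + + 4) ≡ a i
  four = alternates lev (+ 2)
  six : a (i + + 6) ≡ a (i + + 2)
  six = trans (alternates lev (+ 3)) (sym (alternates lev (+ 1)))
  lem : ∀ j → j + + 2 + + 4 ≡ j + + 6
  lem = solve-∀
  absurd : AtLevel a' 1 j ⊎ AtLevel a' 1 (j + + 2) → ⊥
  absurd (inj₁ l) = s≢negate
    (trans (trans (sym (agree-head ag)) (trans (sym four) (at ag 4 (s≤s (s≤s (s≤s (s≤s (s≤s z≤n))))))))
    (level-step l))
  absurd (inj₂ l) = s≢negate (trans (trans (sym (at ag 2 (s≤s (s≤s (s≤s z≤n))))) (trans (sym six)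
    (trans (at ag 6 (s≤s (s≤s (s≤s (s≤s (s≤s (s≤s (s≤s z≤n)))))))) (cong a' (sym (lem j)))))) (level-step l))

dbl-< : ∀ {t m} → t ℕ.< m → dbl t ℕ.< dbl m
dbl-< {zero} {suc m} _ = s≤s z≤n
dbl-< {suc t} {suc m} (s≤s t<m) = s≤s (s≤s (dbl-< t<m))

agree-derived : ∀ {a a'} h h' m k k' →
  Agree a (h + k * + 2 + + 1) a' (h' + k' * + 2 + + 1) (7 ℕ.+ dbl m) →
  Agree (derivedSeq a h) k (derivedSeq a' h') k' m
agree-derived {a} {a'} h h' m k k' ag = agree λ t t<m → trans (cong a (idx t h k))
  (trans (at ag (dbl t) (ℕP.≤-trans (dbl-< t<m) (ℕP.m≤n+m (dbl m) 7))) (cong a' (sym (idx t h' k'))))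
  where
  lem : ∀ h k t → h + (k + t) * + 2 + + 1 ≡ h + k * + 2 + + 1 + t * + 2
  lem = solve-∀
  idx : ∀ t h k → h + (k + + t) * + 2 + + 1 ≡ h + k * + 2 + + 1 + + dbl t
  idx t h k = trans (lem h k (+ t)) (cong (λ z → h + k * + 2 + + 1 + z) (sym (dbl-*2 t)))

-- Seven terms settle the class modulo 2; the `detect n` terms needed of the derived sequence are
-- spread over twice as many.
detect : ℕ → ℕ
detect zero = 7
detect (suc n) = 7 ℕ.+ dbl (detect n)

agree-odd : ∀ {a a'} → CompleteFoldingSeq a → CompleteFoldingSeq a' → ∀ m {i j} h' → AtLevel a' 0 h' →
  Agree a i a' j (7 ℕ.+ m) → OnE a 1 i → Σ ℤ λ k → j ≡ h' + k * + 2 + + 1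
agree-odd {a} {a'} cfs cfs' m {i} {j} h' lev' ag oe with parity-from h' j
... | k , inj₂ e = k , e
... | k , inj₁ refl = ⊥-elim (level-not-OnE 0 a cfs i
  (agree-level₀ cfs (agree-sym (agree-≤ (ℕP.m≤m+n 7 m) ag)) (level-shift k lev')) oe)

OnE-mono₁ : ∀ n a → CompleteFoldingSeq a → ∀ i → OnE a (suc n) i → OnE a 1 i
OnE-mono₁ zero a cfs i oe = oe
OnE-mono₁ (suc n) a cfs i oe = OnE-mono₁ n a cfs i (OnE-mono (suc n) a cfs i oe)

agree-level : ∀ n {a a'} → CompleteFoldingSeq a → CompleteFoldingSeq a' → ∀ {i j} →
  Agree a i a' j (detect n) → AtLevel a n i → AtLevel a' n j
agree-level zero cfs cfs' ag lev = agree-level₀ cfs' ag lev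
agree-level (suc n) {a} {a'} cfs cfs' {i} {j} ag lev with derive a cfs | derive a' cfs'
... | h , lh , cfsb | h' , lh' , cfsb' with Derivation.level-odd a h lh lev
    | agree-odd cfs cfs' (dbl (detect n)) h' lh' ag (OnE-mono₁ n a cfs i (level⇒OnE lev))
... | k , refl | k' , refl = Derivation.level-lift a' h' lh'
  (agree-level n cfsb cfsb' (agree-derived {a} {a'} h h' (detect n) k k' ag) (Derivation.level-drop a h lh lev))

agree-OnE : ∀ n {a a'} → CompleteFoldingSeq a → CompleteFoldingSeq a' → ∀ {i j} →
  Agree a i a' j (detect n) → OnE a n i → OnE a' n j
agree-OnE zero cfs cfs' ag oe = OnE₀ cfs' _
agree-OnE (suc n) {a} {a'} cfs cfs' {i} {j} ag oe with derive a cfs | derive a' cfs'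
... | h , lh , cfsb | h' , lh' , cfsb' with Derivation.OnE-drop a h lh oe
    | agree-odd cfs cfs' (dbl (detect n)) h' lh' ag (OnE-mono₁ n a cfs i oe)
... | k , refl , ok | k' , refl = Derivation.OnE-lift a' h' lh'
  (agree-OnE n cfsb cfsb' (agree-derived {a} {a'} h h' (detect n) k k' ag) ok)

-- Three equal turns close up a unit square; the two outer turns make the curve pass twice through its corner.
record Triple (a : Seq) : Set where
  field
    j : ℤ
    σ : Sgn
    before : a j ≡ negate σ
    first  : a (j + + 1) ≡ σ
    second : a (j + + 1 + + 1) ≡ σ
    third  : a (j + + 1 + + 1 + + 1) ≡ σ
    after  : a (j + + 1 + + 1 + + 1 + + 1) ≡ negate σ

-- The pattern occurs at `s` once b s = b (s + 1) = A (s + 1). Along the alternating class of `b` a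
-- shift by 2 changes the sign of `b` but not of `A`, so some `u` has b u = A (u + 1) and b (u + 2)
-- = A u. The value b (u + 1) then equals one of these two, and s = u or s = u + 1 works.
triple : ∀ a → CompleteFoldingSeq a → Triple a
triple a cfs with derive a cfs
... | h , lh , cfsb with derive (derivedSeq a h) cfsb
... | u₀ , lu₀ , _ = go choose
  where
  b A : Seq
  b = derivedSeq a h
  A k = a (h + k * + 2)
  A-suc : ∀ k → A (k + + 1) ≡ negate (A k)
  A-suc k = trans (alternates lh (k + + 1)) (trans (alt-suc k (a h)) (cong negate (sym (alternates lh k))))
  A-suc₂ : ∀ k → A (k + + 1 + + 1) ≡ A k
  A-suc₂ k = trans (A-suc (k + + 1)) (trans (cong negate (A-suc k)) (negate-invol _))
  A-2 : ∀ k → A (k + + 2) ≡ A k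
  A-2 k = trans (cong A (sym (ℤP.+-assoc k (+ 1) (+ 1)))) (A-suc₂ k)

  mk : ∀ s → b s ≡ A (s + + 1) → b (s + + 1) ≡ A (s + + 1) → Triple a
  mk s e₁ e₂ = record
    { j = h + s * + 2 ; σ = A (s + + 1)
    ; before = trans (sym (negate-invol _)) (cong negate (sym (A-suc s)))
    ; first = e₁
    ; second = cong a (l₁ h s)
    ; third = trans (cong a (l₂ h s)) e₂
    ; after = trans (cong a (l₃ h s)) (A-suc (s + + 1)) }
    where
    l₁ : ∀ h s → h + s * + 2 + + 1 + + 1 ≡ h + (s + + 1) * + 2
    l₁ = solve-∀
    l₂ : ∀ h s → h + s * + 2 + + 1 + + 1 + + 1 ≡ h + (s + + 1) * + 2 + + 1
    l₂ = solve-∀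
    l₃ : ∀ h s → h + s * + 2 + + 1 + + 1 + + 1 + + 1 ≡ h + (s + + 1 + + 1) * + 2
    l₃ = solve-∀

  choose : Σ ℤ λ u → AtLevel b 0 u × b (u + + 2) ≡ A u
  choose with sgn-cases (b (u₀ + + 2)) (A u₀)
  ... | inj₁ e = u₀ , lu₀ , e
  ... | inj₂ e = u₀ + + 2 , level-shift (+ 1) lu₀ ,
    trans (level-step (level-shift (+ 1) lu₀)) (trans (cong negate e) (trans (negate-invol _) (sym (A-2 u₀))))

  go : (Σ ℤ λ u → AtLevel b 0 u × b (u + + 2) ≡ A u) → Triple a
  go (u , lu , e) with sgn-cases (b (u + + 1)) (A u)
  ... | inj₁ e' = mk (u + + 1) (trans e' (sym (A-suc₂ u)))
    (trans (cong b (ℤP.+-assoc u (+ 1) (+ 1))) (trans e (sym (A-suc₂ u))))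
  ... | inj₂ e' = mk u (trans (sym (negate-invol _)) (trans (cong negate (trans (sym (level-step lu)) e))
    (sym (A-suc u))))
    (trans e' (sym (A-suc u)))

-- Lattices and derived curves

-- Multiplication by 1 + i on Gaussian integers, so that Λ_n = (1 + i)ⁿ ℤ[i].
θ : Point → Point
θ (a , b) = (a - b , a + b)

⊕-assoc : ∀ p q r → (p ⊕ q) ⊕ r ≡ p ⊕ (q ⊕ r)
⊕-assoc (a , b) (c , d) (e , f) = cong₂ _,_ (ℤP.+-assoc a c e) (ℤP.+-assoc b d f)

⊕-comm : ∀ p q → p ⊕ q ≡ q ⊕ p
⊕-comm (a , b) (c , d) = cong₂ _,_ (ℤP.+-comm a c) (ℤP.+-comm b d)

⊕-cancelˡ : ∀ p {q r} → p ⊕ q ≡ p ⊕ r → q ≡ r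
⊕-cancelˡ (a , b) {c , d} {e , f} eq = cong₂ _,_ (+-cancelˡ a (cong proj₁ eq)) (+-cancelˡ b (cong proj₂ eq))

⊕-cancelʳ : ∀ v {p q} → p ⊕ v ≡ q ⊕ v → p ≡ q
⊕-cancelʳ v {p} {q} e = ⊕-cancelˡ v (trans (⊕-comm v p) (trans e (⊕-comm q v)))

⊕-⊖ : ∀ p q → p ⊕ (q ⊖ p) ≡ q
⊕-⊖ (a , b) (c , d) = cong₂ _,_ (lem a c) (lem b d)
  where
  lem : ∀ a c → a + (c - a) ≡ c
  lem = solve-∀

⊖-cancelˡ : ∀ o p q → (o ⊕ p) ⊖ (o ⊕ q) ≡ p ⊖ q
⊖-cancelˡ (a , b) (c , d) (e , f) = cong₂ _,_ (lem a c e) (lem b d f)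
  where
  lem : ∀ a c e → a + c - (a + e) ≡ c - e
  lem = solve-∀

⊖-telescope : ∀ p q r → (p ⊖ q) ⊕ (q ⊖ r) ≡ p ⊖ r
⊖-telescope (a , b) (c , d) (e , f) = cong₂ _,_ (lem a c e) (lem b d f)
  where
  lem : ∀ a c e → a - c + (c - e) ≡ a - e
  lem = solve-∀

θ-⊕ : ∀ p q → θ (p ⊕ q) ≡ θ p ⊕ θ q
θ-⊕ (a , b) (c , d) = cong₂ _,_ (lem a b c d) (lem' a b c d)
  where
  lem : ∀ a b c d → a + c - (b + d) ≡ a - b + (c - d)
  lem = solve-∀
  lem' : ∀ a b c d → a + c + (b + d) ≡ a + b + (c + d)
  lem' = solve-∀

θ-⊖ : ∀ p q → θ (p ⊖ q) ≡ θ p ⊖ θ q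
θ-⊖ (a , b) (c , d) = cong₂ _,_ (lem a b c d) (lem' a b c d)
  where
  lem : ∀ a b c d → a - c - (b - d) ≡ a - b - (c - d)
  lem = solve-∀
  lem' : ∀ a b c d → a - c + (b - d) ≡ a + b - (c + d)
  lem' = solve-∀

θ-inj : ∀ {p q} → θ p ≡ θ q → p ≡ q
θ-inj {a , b} {c , d} e = cong₂ _,_ a≡c (+-cancelˡ a (trans (cong proj₂ e) (cong (_+ d) (sym a≡c))))
  where
  lem : ∀ a b → a * + 2 ≡ a - b + (a + b)
  lem = solve-∀
  a≡c : a ≡ c
  a≡c = *2-inj a c (trans (lem a b) (trans (cong₂ _+_ (cong proj₁ e) (cong proj₂ e)) (sym (lem c d))))

-- One constructor per factor 1 + i, in step with derivation; `gens` advances two factors at a time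
-- and is compared with this form later.
data Λ : ℕ → Point → Set where
  Λ-all : ∀ {p} → Λ 0 p
  Λ-θ   : ∀ {n q} → Λ n q → Λ (suc n) (θ q)

Λ-⊕ : ∀ {n p q} → Λ n p → Λ n q → Λ n (p ⊕ q)
Λ-⊕ Λ-all Λ-all = Λ-all
Λ-⊕ (Λ-θ {q = p} l) (Λ-θ {q = q} m) = subst (Λ _) (θ-⊕ p q) (Λ-θ (Λ-⊕ l m))

Λ-⊖ : ∀ {n p q} → Λ n p → Λ n q → Λ n (p ⊖ q)
Λ-⊖ Λ-all Λ-all = Λ-all
Λ-⊖ (Λ-θ {q = p} l) (Λ-θ {q = q} m) = subst (Λ _) (θ-⊖ p q) (Λ-θ (Λ-⊖ l m))

⊖-self : ∀ p → p ⊖ p ≡ (+ 0 , + 0)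
⊖-self (a , b) = cong₂ _,_ (ℤP.+-inverseʳ a) (ℤP.+-inverseʳ b)

Λ-origin : ∀ n → Λ n (+ 0 , + 0)
Λ-origin zero = Λ-all
Λ-origin (suc n) = Λ-θ (Λ-origin n)

Λ-swap : ∀ {n} p q → Λ n (p ⊖ q) → Λ n (q ⊖ p)
Λ-swap {n} p@(a , b) q@(c , d) l = subst (Λ n) (cong₂ _,_ (lem a c) (lem b d)) (Λ-⊖ (Λ-origin n) l)
  where
  lem : ∀ a c → + 0 - (a - c) ≡ c - a
  lem = solve-∀

Λ-telescope : ∀ {n} p q r → Λ n (p ⊖ q) → Λ n (q ⊖ r) → Λ n (p ⊖ r)
Λ-telescope {n} p q r l m = subst (Λ n) (⊖-telescope p q r) (Λ-⊕ l m)

Λ-mono : ∀ {n p} → Λ (suc n) p → Λ n p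
Λ-mono {zero} l = Λ-all
Λ-mono {suc n} (Λ-θ l) = Λ-θ (Λ-mono l)

Λ-≤ : ∀ {m n p} → m ℕ.≤ n → Λ n p → Λ m p
Λ-≤ z≤n l = Λ-all
Λ-≤ (s≤s m≤n) (Λ-θ l) = Λ-θ (Λ-≤ m≤n l)

Λ-θ⁻¹′ : ∀ {n p q} → p ≡ θ q → Λ (suc n) p → Λ n q
Λ-θ⁻¹′ e (Λ-θ l) = subst (Λ _) (θ-inj e) l

Λ-θ⁻¹ : ∀ {n q} → Λ (suc n) (θ q) → Λ n q
Λ-θ⁻¹ = Λ-θ⁻¹′ refl

-- The checkerboard colour; the points of colour `pos` form Λ_1.
par : Point → Sgn
par (a , b) = alt (a + b) pos

alt-neg : ∀ k s → alt (- k) s ≡ alt k s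
alt-neg k s = cong (λ n → evenℕ? n s) (ℤP.∣-i∣≡∣i∣ k)

par-⊖ : ∀ p q → par (p ⊖ q) ≡ alt (proj₁ p + proj₂ p) (par q)
par-⊖ (a , b) (c , d) = trans (cong (λ z → alt z pos) (lem a b c d))
  (trans (alt-+ (a + b) (- (c + d)) pos) (cong (alt (a + b)) (alt-neg (c + d) pos)))
  where
  lem : ∀ a b c d → a - c + (b - d) ≡ a + b + - (c + d)
  lem = solve-∀

par≡⇒ : ∀ p q → par p ≡ par q → par (p ⊖ q) ≡ pos
par≡⇒ p@(a , b) q e = trans (par-⊖ p q) (trans (cong (alt (a + b)) (sym e)) (evenℕ?-invol ∣ a + b ∣ pos))

par≡⇐ : ∀ p q → par (p ⊖ q) ≡ pos → par p ≡ par q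
par≡⇐ p@(a , b) q e = trans (cong (alt (a + b)) (trans (sym e) (par-⊖ p q))) (evenℕ?-invol ∣ a + b ∣ (par q))

par-θ : ∀ q → par (θ q) ≡ pos
par-θ (a , b) = trans (cong (λ z → alt z pos) (lem a b)) (alt-even a pos)
  where
  lem : ∀ a b → a - b + (a + b) ≡ a * + 2
  lem = solve-∀

θ-surj : ∀ p → par p ≡ pos → Σ Point λ q → p ≡ θ q
θ-surj (a , b) e with parity (a + b)
... | k , inj₁ f = (k , k - a) , cong₂ _,_ (lem a k) (trans (lem₂ a b) (trans (cong (_- a) f) (lem₃ a k)))
  where
  lem : ∀ a k → a ≡ k - (k - a)
  lem = solve-∀
  lem₂ : ∀ a b → b ≡ a + b - a
  lem₂ = solve-∀
  lem₃ : ∀ a k → k * + 2 - a ≡ k + (k - a)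
  lem₃ = solve-∀
... | k , inj₂ f = ⊥-elim (s≢negate {pos} (trans (sym e) (trans (cong (λ z → alt z pos) f)
  (trans (alt-suc (k * + 2) pos) (cong negate (alt-even k pos))))))

Λ₁⇒par : ∀ p q → Λ 1 (p ⊖ q) → par p ≡ par q
Λ₁⇒par p q l = par≡⇐ p q (go refl l)
  where
  go : ∀ {x y} → x ≡ y → Λ 1 x → par y ≡ pos
  go refl (Λ-θ {q = r} _) = par-θ r

rotR opp : Dir → Dir
rotR E = S
rotR N = E
rotR W = N
rotR S = W
opp E = W
opp N = S
opp W = E
opp S = N

step : Sgn → Dir → Dir
step pos = rotL
step neg = rotR

turn-step : ∀ d e → orient d ≢ orient e → e ≡ step (turn d e) d
turn-step E E ne = ⊥-elim (ne refl)
turn-step E N ne = refl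
turn-step E W ne = ⊥-elim (ne refl)
turn-step E S ne = refl
turn-step N E ne = refl
turn-step N N ne = ⊥-elim (ne refl)
turn-step N W ne = refl
turn-step N S ne = ⊥-elim (ne refl)
turn-step W E ne = ⊥-elim (ne refl)
turn-step W N ne = refl
turn-step W W ne = ⊥-elim (ne refl)
turn-step W S ne = refl
turn-step S E ne = refl
turn-step S N ne = ⊥-elim (ne refl)
turn-step S W ne = refl
turn-step S S ne = ⊥-elim (ne refl)

-- The direction of (unit d + unit (step s d)) / (1 + i).
diag : Sgn → Dir → Dir
diag pos d = d
diag neg d = rotR d

diag-unit : ∀ s d → unit d ⊕ unit (step s d) ≡ θ (unit (diag s d))
diag-unit pos E = refl
diag-unit pos N = refl
diag-unit pos W = refl
diag-unit pos S = refl
diag-unit neg E = refl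
diag-unit neg N = refl
diag-unit neg W = refl
diag-unit neg S = refl

-- Alternation enters here: since the inner turns of consecutive pairs are opposite, the turn
-- between the pairs becomes the turn of the derivative.
diag-turn : ∀ s t d → turn (diag s d) (diag (negate s) (step t (step s d))) ≡ t
diag-turn pos pos E = refl
diag-turn pos pos N = refl
diag-turn pos pos W = refl
diag-turn pos pos S = refl
diag-turn pos neg E = refl
diag-turn pos neg N = refl
diag-turn pos neg W = refl
diag-turn pos neg S = refl
diag-turn neg pos E = refl
diag-turn neg pos N = refl
diag-turn neg pos W = refl
diag-turn neg pos S = refl
diag-turn neg neg E = refl
diag-turn neg neg N = refl
diag-turn neg neg W = refl
diag-turn neg neg S = refl

-- Orientations as signs, so that their alternation along a curve is governed by `alt`.
orientSgn : Dir → Sgn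
orientSgn d with orient d
... | hor = pos
... | ver = neg

orientSgn-step : ∀ s d → orientSgn (step s d) ≡ negate (orientSgn d)
orientSgn-step pos E = refl
orientSgn-step pos N = refl
orientSgn-step pos W = refl
orientSgn-step pos S = refl
orientSgn-step neg E = refl
orientSgn-step neg N = refl
orientSgn-step neg W = refl
orientSgn-step neg S = refl

orientSgn-inj : ∀ d e → orientSgn d ≡ orientSgn e → orient d ≡ orient e
orientSgn-inj d e eq with orient d | orient e
... | hor | hor = refl
... | ver | ver = refl
orientSgn-inj d e () | hor | ver
orientSgn-inj d e () | ver | hor

orientSgn-cong : ∀ d e → orient d ≡ orient e → orientSgn d ≡ orientSgn e
orientSgn-cong d e eq with orient d | orient e
... | hor | hor = refl
... | ver | ver = refl
orientSgn-cong d e () | hor | ver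
orientSgn-cong d e () | ver | hor

orientSgn≢⇒ : ∀ d e → orientSgn e ≡ negate (orientSgn d) → orient d ≢ orient e
orientSgn≢⇒ d e eq oe = s≢negate (trans (orientSgn-cong d e oe) eq)

par-unit : ∀ p d → par (p ⊕ unit d) ≡ negate (par p)
par-unit (a , b) d = go d
  where
  P = a + b
  up : ∀ z → z ≡ P + + 1 → alt z pos ≡ negate (alt P pos)
  up z refl = alt-suc P pos
  down : ∀ z → z + + 1 ≡ P → alt z pos ≡ negate (alt P pos)
  down z e = trans (sym (negate-invol _)) (cong negate (trans (sym (alt-suc z pos)) (cong (λ x → alt x pos) e)))
  lE : ∀ a b → a + + 1 + (b + + 0) ≡ a + b + + 1
  lE = solve-∀
  lN : ∀ a b → a + + 0 + (b + + 1) ≡ a + b + + 1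
  lN = solve-∀
  lW : ∀ a b → a + - + 1 + (b + + 0) + + 1 ≡ a + b
  lW = solve-∀
  lS : ∀ a b → a + + 0 + (b + - + 1) + + 1 ≡ a + b
  lS = solve-∀
  go : ∀ d → par ((a , b) ⊕ unit d) ≡ negate (par (a , b))
  go E = up _ (lE a b)
  go N = up _ (lN a b)
  go W = down (a + - + 1 + (b + + 0)) (lW a b)
  go S = down (a + + 0 + (b + - + 1)) (lS a b)

alternating-alt : (f : ℤ → Sgn) → (∀ i → f (i + + 1) ≡ negate (f i)) → ∀ i k → f (i + k) ≡ alt k (f i)
alternating-alt f st i = ℤ-ind (λ k → f (i + k) ≡ alt k (f i)) (cong f (ℤP.+-identityʳ i))
  (λ k e → trans (cong f (sym (ℤP.+-assoc i k (+ 1))))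
    (trans (st (i + k)) (trans (cong negate e) (sym (alt-suc k (f i))))))
  (λ k e → negate-inj (trans (sym (st (i + k))) (trans (cong f (ℤP.+-assoc i k (+ 1))) (trans e (alt-suc k (f i))))))

-- The properties carried over to derivatives; distinctness of supports stays with the curves of the
-- covering.
record FoldCurve (C : Curve) : Set where
  field
    conn : ∀ i → finish (C i) ≡ start (C (i + + 1))
    perp : ∀ i → orient (dir (C i)) ≢ orient (dir (C (i + + 1)))
    cfs  : CompleteFoldingSeq (assoc C)

  dir-suc : ∀ i → dir (C (i + + 1)) ≡ step (assoc C i) (dir (C i))
  dir-suc i = turn-step _ _ (perp i)

  orient-suc : ∀ i → orientSgn (dir (C (i + + 1))) ≡ negate (orientSgn (dir (C i)))
  orient-suc i = trans (cong orientSgn (dir-suc i)) (orientSgn-step (assoc C i) _)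

  orient-alt : ∀ i k → orientSgn (dir (C (i + k))) ≡ alt k (orientSgn (dir (C i)))
  orient-alt = alternating-alt (λ i → orientSgn (dir (C i))) orient-suc

  par-suc : ∀ i → par (start (C (i + + 1))) ≡ negate (par (start (C i)))
  par-suc i = trans (cong par (sym (conn i))) (par-unit (start (C i)) (dir (C i)))

  par-alt : ∀ i k → par (start (C (i + k))) ≡ alt k (par (start (C i)))
  par-alt = alternating-alt (λ i → par (start (C i))) par-suc

level-cong : ∀ {a b n i} → (∀ j → a j ≡ b j) → AtLevel a n i → AtLevel b n i
level-cong {i = i} e (atLevel l) = atLevel λ k → trans (sym (e _)) (trans (l k) (cong (alt k) (e i)))

OnE-cong : ∀ {a b n i} → (∀ j → a j ≡ b j) → OnE a n i → OnE b n i
OnE-cong e (onE l k eq) = onE (level-cong e l) k eq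

record Derived (C : Curve) (h : ℤ) (o : Point) : Set where
  field
    D      : Curve
    fold-D : FoldCurve D
    at-start  : ∀ k → start (C (h + k * + 2)) ≡ o ⊕ θ (start (D k))
    at-finish : ∀ k → finish (C (h + k * + 2 + + 1)) ≡ o ⊕ θ (finish (D k))
    dir-D   : ∀ k → dir (D k) ≡ diag (assoc C (h + k * + 2)) (dir (C (h + k * + 2)))
    assoc-D : ∀ k → derivedSeq (assoc C) h k ≡ assoc D k

mkDerived : ∀ {C} → FoldCurve C → ∀ h → AtLevel (assoc C) 0 h → CompleteFoldingSeq (derivedSeq (assoc C) h) →
  ∀ o → par (start (C h)) ≡ par o → Derived C h o
mkDerived {C} fc h lh cfsb o po = record
  { D = D
  ; fold-D = record { conn = connD ; perp = perpD ; cfs = cfs-cong assocD cfsb }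
  ; at-start = at-start ; at-finish = at-finish ; dir-D = λ k → refl ; assoc-D = assocD }
  where
  open FoldCurve fc
  a = assoc C
  e : ℤ → ℤ
  e k = h + k * + 2
  q : ∀ k → Σ Point λ q → start (C (e k)) ⊖ o ≡ θ q
  q k = θ-surj _ (par≡⇒ (start (C (e k))) o (trans (par-alt h (k * + 2)) (trans (alt-even k _) po)))
  D : Curve
  D k = seg (proj₁ (q k)) (diag (a (e k)) (dir (C (e k))))
  at-start : ∀ k → start (C (e k)) ≡ o ⊕ θ (start (D k))
  at-start k = trans (sym (⊕-⊖ o _)) (cong (o ⊕_) (proj₂ (q k)))
  at-finish : ∀ k → finish (C (e k + + 1)) ≡ o ⊕ θ (finish (D k))
  at-finish k = begin
    start (C (e k + + 1)) ⊕ unit (dir (C (e k + + 1)))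
      ≡⟨ cong₂ _⊕_ (sym (conn (e k))) (cong unit (dir-suc (e k))) ⟩
    (start (C (e k)) ⊕ unit d) ⊕ unit (step s d)
      ≡⟨ ⊕-assoc (start (C (e k))) (unit d) (unit (step s d)) ⟩
    start (C (e k)) ⊕ (unit d ⊕ unit (step s d))
      ≡⟨ cong₂ _⊕_ (at-start k) (diag-unit s d) ⟩
    (o ⊕ θ (start (D k))) ⊕ θ (unit (diag s d))
      ≡⟨ ⊕-assoc o (θ (start (D k))) (θ (unit (diag s d))) ⟩
    o ⊕ (θ (start (D k)) ⊕ θ (unit (diag s d)))
      ≡⟨ cong (o ⊕_) (sym (θ-⊕ (start (D k)) (unit (diag s d)))) ⟩
    o ⊕ θ (finish (D k)) ∎
    where
    open ≡-Reasoning
    s = a (e k)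
    d = dir (C (e k))
  e-suc : ∀ k → e (k + + 1) ≡ e k + + 1 + + 1
  e-suc k = lem h k
    where
    lem : ∀ h k → h + (k + + 1) * + 2 ≡ h + k * + 2 + + 1 + + 1
    lem = solve-∀
  connD : ∀ k → finish (D k) ≡ start (D (k + + 1))
  connD k = θ-inj (⊕-cancelˡ o (trans (sym (at-finish k)) (trans (conn (e k + + 1))
    (trans (cong (λ z → start (C z)) (sym (e-suc k))) (at-start (k + + 1))))))
  next-dir : ∀ k → dir (D (k + + 1)) ≡ diag (negate (a (e k))) (step (a (e k + + 1)) (step (a (e k)) (dir (C (e k)))))
  next-dir k = cong₂ diag
    (trans (alternates lh (k + + 1)) (trans (alt-suc k (a h)) (cong negate (sym (alternates lh k)))))
    (trans (cong (λ z → dir (C z)) (e-suc k))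
      (trans (dir-suc (e k + + 1)) (cong (step (a (e k + + 1))) (dir-suc (e k)))))
  assocD : ∀ k → a (e k + + 1) ≡ assoc D k
  assocD k = sym (trans (cong (turn (dir (D k))) (next-dir k)) (diag-turn (a (e k)) (a (e k + + 1)) (dir (C (e k)))))
  diag-perp : ∀ s t d → orientSgn (diag (negate s) (step t (step s d))) ≡ negate (orientSgn (diag s d))
  diag-perp pos t d = trans (orientSgn-step neg (step t (rotL d))) (trans (cong negate (orientSgn-step t (rotL d)))
    (trans (negate-invol _) (orientSgn-step pos d)))
  diag-perp neg t d = orientSgn-step t (rotR d)
  perpD : ∀ k → orient (dir (D k)) ≢ orient (dir (D (k + + 1)))
  perpD k = orientSgn≢⇒ _ _ (trans (cong orientSgn (next-dir k)) (diag-perp (a (e k)) (a (e k + + 1))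
    (dir (C (e k)))))

opaque
  derived : ∀ {C} → FoldCurve C → ∀ h → AtLevel (assoc C) 0 h → CompleteFoldingSeq (derivedSeq (assoc C) h) →
    ∀ o → par (start (C h)) ≡ par o → Derived C h o
  derived = mkDerived

E-points : ∀ n {C} → FoldCurve C → ∀ {i j} → OnE (assoc C) n i → OnE (assoc C) n j → Λ n (finish (C i) ⊖ finish (C j))
E-points zero fc oi oj = Λ-all
E-points (suc n) {C} fc oi oj with derive (assoc C) (FoldCurve.cfs fc)
... | h , lh , cfsb with Derivation.OnE-drop (assoc C) h lh oi | Derivation.OnE-drop (assoc C) h lh oj
... | k , refl , ok | l , refl , ol = subst (Λ (suc n))
    (sym (trans (cong₂ _⊖_ (at-finish k) (at-finish l)) (trans (⊖-cancelˡ o (θ (finish (D k))) (θ (finish (D l))))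
      (sym (θ-⊖ (finish (D k)) (finish (D l)))))))
    (Λ-θ {q = finish (D k) ⊖ finish (D l)} (E-points n fold-D (OnE-cong assoc-D ok) (OnE-cong assoc-D ol)))
  where
  o = start (C h)
  open Derived (derived fc h lh cfsb o refl)

-- Turns of compatible curves

OnE-halves : ∀ n a → CompleteFoldingSeq a → ∀ i → OnE a n i → OnE a (suc n) i ⊎ OnE a (suc n) (i + pow2 n)
OnE-halves n a cfs i oe with level-near n a cfs i oe
... | inj₁ l = inj₂ (level⇒OnE-next n a cfs i l)
... | inj₂ l = inj₁ (subst (OnE a (suc n)) back (OnE-shift (- + 1) (level⇒OnE-next n a cfs (i + pow2 n) l)))
  where
  lem : ∀ i P → i + P + P + - + 1 * (+ 2 * P) ≡ i
  lem = solve-∀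
  back : i + pow2 n + pow2 n + - + 1 * pow2 (suc n) ≡ i
  back = trans (cong (λ z → i + pow2 n + pow2 n + - + 1 * z) (pow2-suc n)) (lem i (pow2 n))

module _ {C : Curve} (fc : FoldCurve C) where
  open FoldCurve fc

  par-finish-suc : ∀ i → par (finish (C (i + + 1))) ≡ par (start (C i))
  par-finish-suc i = trans (par-unit (start (C (i + + 1))) (dir (C (i + + 1))))
    (trans (cong negate (par-suc i)) (negate-invol _))

  finish-suc-not-Λ₁ : ∀ i → ¬ Λ 1 (finish (C (i + + 1)) ⊖ finish (C i))
  finish-suc-not-Λ₁ i l = s≢negate (trans (Λ₁⇒par (finish (C (i + + 1))) (finish (C i)) l)
    (trans (par-unit (start (C i)) (dir (C i))) (cong negate (sym (par-finish-suc i)))))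

  finish-pred : ∀ i → finish (C (i - + 1)) ≡ start (C i)
  finish-pred i = trans (conn (i - + 1)) (cong (λ z → start (C z)) (lem i))
    where
    lem : ∀ i → i - + 1 + + 1 ≡ i
    lem = solve-∀

-- Two perpendicular units add up to 1 + i times a unit, and no unit is in Λ_1.
Λ₂-perp : ∀ d e → orientSgn e ≡ negate (orientSgn d) → ¬ Λ 2 (unit d ⊕ unit e)
Λ₂-perp d e oe l = absurd (diag s d) (Λ-θ⁻¹ {1} {unit (diag s d)} (subst (Λ 2) eq l))
  where
  s = turn d e
  eq : unit d ⊕ unit e ≡ θ (unit (diag s d))
  eq = trans (cong (λ x → unit d ⊕ unit x) (turn-step d e (orientSgn≢⇒ d e oe))) (diag-unit s d)
  absurd : ∀ x → ¬ Λ 1 (unit x)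
  absurd x l' = s≢negate {pos} (trans (sym (Λ₁⇒par (unit x) (+ 0 , + 0) (subst (Λ 1) (sym (⊖-0 (unit x))) l')))
    (par-one x))
    where
    ⊖-0 : ∀ p → p ⊖ (+ 0 , + 0) ≡ p
    ⊖-0 (a , b) = cong₂ _,_ (ℤP.+-identityʳ a) (ℤP.+-identityʳ b)
    par-one : ∀ x → par (unit x) ≡ neg
    par-one E = refl
    par-one N = refl
    par-one W = refl
    par-one S = refl

Λ₂-around : ∀ p s d e → Λ 2 ((p ⊕ unit d) ⊖ s) → Λ 2 ((s ⊕ unit e) ⊖ p) → Λ 2 (unit d ⊕ unit e)
Λ₂-around (a , b) (x , y) d e l m = subst (Λ 2) (cong₂ _,_ (lem a x (proj₁ (unit d)) (proj₁ (unit e)))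
  (lem b y (proj₂ (unit d)) (proj₂ (unit e)))) (Λ-⊕ l m)
  where
  lem : ∀ a x u v → a + u - x + (x + v - a) ≡ u + v
  lem = solve-∀

-- `fold-compat` is what is kept of local isomorphism: after an index `i` of level k, the index i +
-- 2^k is in E_{k+1}, and whether it is in E_{k+2} is read off from the turn at `i` by the same rule
-- on both curves.
record Compat (C C' : Curve) : Set where
  field
    E-compat : ∀ k {i j} → OnE (assoc C) k i → OnE (assoc C') k j → Λ k (finish (C i) ⊖ finish (C' j))
    type-compat : ∀ {i j} → OnE (assoc C) 1 i → OnE (assoc C') 1 j → orientSgn (dir (C i)) ≡ orientSgn (dir (C' j))
    fold-compat : ∀ k {i j} → AtLevel (assoc C) k i → AtLevel (assoc C') k j → assoc C i ≡ assoc C' j →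
      OnE (assoc C) (suc (suc k)) (i + pow2 k) → OnE (assoc C') (suc (suc k)) (j + pow2 k)

orientSgn-diag : ∀ s d d' → orientSgn d ≡ orientSgn d' → orientSgn (diag s d) ≡ orientSgn (diag s d')
orientSgn-diag pos d d' e = e
orientSgn-diag neg d d' e = trans (orientSgn-step neg d) (trans (cong negate e) (sym (orientSgn-step neg d')))

module Pair {C C' : Curve} (fc : FoldCurve C) (fc' : FoldCurve C') (cp : Compat C C') where
  open Compat cp
  open FoldCurve
  a a' : Seq
  a = assoc C
  a' = assoc C'

  level₀-orient : ∀ {i j} → AtLevel a 0 i → AtLevel a' 0 j → orientSgn (dir (C i)) ≡ orientSgn (dir (C' j))
  level₀-orient {i} {j} l l' = negate-inj (trans (sym (orient-suc fc i))
    (trans (type-compat (level⇒OnE-next 0 a (cfs fc) i l) (level⇒OnE-next 0 a' (cfs fc') j l')) (orient-suc fc' j)))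

  -- Colours force `j` to level 0. If the turns differed, `fold-compat` would place E_2 next to `i`
  -- and `j` on opposite sides: at i + 1 and j - 1, or at i - 1 and j + 1. These two vertices are
  -- congruent modulo Λ_2, as are the vertices at i and j, so a sum of two perpendicular units would
  -- lie in Λ_2.
  level₀-determined : ∀ {i j} → AtLevel a 0 i → Λ 2 (finish (C' j) ⊖ finish (C i)) → a' j ≡ a i
  level₀-determined {i} {j} li l with level-cases 1 a' (cfs fc') j
  ... | inj₁ oe = ⊥-elim (finish-suc-not-Λ₁ fc i (Λ-telescope (finish (C (i + + 1))) (finish (C' j)) (finish (C i))
          (E-compat 1 (level⇒OnE-next 0 a (cfs fc) i li) oe) (Λ-mono l)))
  ... | inj₂ (suc _ , s≤s () , _)
  ... | inj₂ (zero , _ , lj) with sgn-cases (a' j) (a i)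
  ... | inj₁ e = e
  ... | inj₂ e = ⊥-elim (absurd (OnE-halves 1 a (cfs fc) (i + + 1) (level⇒OnE-next 0 a (cfs fc) i li)))
    where
    lem : ∀ j → j + + 2 + + 1 + - + 1 * + 4 ≡ j - + 1
    lem = solve-∀
    lem' : ∀ j → j + + 1 + + 2 + - + 1 * + 4 ≡ j - + 1
    lem' = solve-∀
    oo = level₀-orient li lj
    absurd : OnE a 2 (i + + 1) ⊎ OnE a 2 (i + + 1 + + 2) → ⊥
    absurd (inj₁ oe) = Λ₂-perp (dir (C (i + + 1))) (dir (C' j))
      (trans (sym oo) (trans (sym (negate-invol _)) (cong negate (sym (orient-suc fc i)))))
      (Λ₂-around (finish (C i)) (start (C' j)) (dir (C (i + + 1))) (dir (C' j))
        (subst (Λ 2) (cong₂ _⊖_ (cong (_⊕ unit (dir (C (i + + 1)))) (sym (conn fc i))) (finish-pred fc' j))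
          (E-compat 2 oe oe'))
        l)
      where
      oe' : OnE a' 2 (j - + 1)
      -- The turn at j + 2 equals the one at i, so j + 3 is in E_2, and with it j - 1.
      oe' = subst (OnE a' 2) (lem j) (OnE-shift (- + 1) (fold-compat 0 li (level-shift (+ 1) lj)
        (sym (trans (level-step lj) (trans (cong negate e) (negate-invol _)))) oe))
    absurd (inj₂ oe) = Λ₂-perp (dir (C' (j + + 1))) (dir (C i))
      (trans oo (trans (sym (negate-invol _)) (cong negate (sym (orient-suc fc' j)))))
      (Λ₂-around (finish (C' j)) (start (C i)) (dir (C' (j + + 1))) (dir (C i))
        (subst (Λ 2) (cong₂ _⊖_ (cong (_⊕ unit (dir (C' (j + + 1)))) (sym (conn fc' j))) (finish-pred fc i))
          (Λ-swap (finish (C (i - + 1))) (finish (C' (j + + 1))) (E-compat 2 oe₁ oe')))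
        (Λ-swap (finish (C' j)) (finish (C i)) l))
      where
      oe₁ : OnE a 2 (i - + 1)
      oe₁ = subst (OnE a 2) (lem' i) (OnE-shift (- + 1) oe)
      lem₂ : ∀ i → i + + 1 + + 2 ≡ i + + 2 + + 1
      lem₂ = solve-∀
      oe' : OnE a' 2 (j + + 1)
      oe' = fold-compat 0 (level-shift (+ 1) li) lj (trans (level-step li) (sym e)) (subst (OnE a 2) (lem₂ i) oe)

  -- Otherwise the turn at y + 2 would equal the one at x, and E_2 would contain both y + 1 and y +
  -- 3. Derivatives get equal types from this, as `diag` exchanges the orientations for only one
  -- value of the inner turn.
  level₀-turns : ∀ {x y} → AtLevel a 0 x → AtLevel a' 0 y → OnE a 2 (x + + 1) → OnE a' 2 (y + + 1) → a x ≡ a' y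
  level₀-turns {x} {y} lx ly ox oy with sgn-cases (a x) (a' y)
  ... | inj₁ e = e
  ... | inj₂ e = ⊥-elim (OnE-exclusive 1 a' (cfs fc') (y + + 1) oy (subst (OnE a' 2) (lem y)
    (fold-compat 0 lx (level-shift (+ 1) ly) (trans e (sym (level-step ly))) ox)))
    where
    lem : ∀ x → x + + 2 + + 1 ≡ x + + 1 + + 2
    lem = solve-∀

  module Descend (h h' : ℤ) (lh : AtLevel a 0 h) (lh' : AtLevel a' 0 h')
    (cfsb : CompleteFoldingSeq (derivedSeq a h)) (cfsb' : CompleteFoldingSeq (derivedSeq a' h')) where

    o : Point
    o = start (C h)

    -- The E_1 vertices of both curves have one colour, so the origin of the first derivative also
    -- suits the second.
    po : par (start (C' h')) ≡ par o
    po = trans (sym (par-finish-suc fc' h'))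
      (trans (sym (Λ₁⇒par (finish (C (h + + 1))) (finish (C' (h' + + 1)))
      (E-compat 1 (level⇒OnE-next 0 a (cfs fc) h lh) (level⇒OnE-next 0 a' (cfs fc') h' lh'))))
      (par-finish-suc fc h))

    der : Derived C h o
    der = derived fc h lh cfsb o refl
    der' : Derived C' h' o
    der' = derived fc' h' lh' cfsb' o po

    open Derived der public
    open Derived der' public using () renaming
      (D to D'; fold-D to fold-D'; at-finish to at-finish'; dir-D to dir-D'; assoc-D to assoc-D')

    private
      module X = Derivation a h lh
      module X' = Derivation a' h' lh'

      up : ∀ {n i} → OnE (assoc D) n i → OnE a (suc n) (h + i * + 2 + + 1)
      up oe = X.OnE-lift (OnE-cong (λ j → sym (assoc-D j)) oe)
      up' : ∀ {n i} → OnE (assoc D') n i → OnE a' (suc n) (h' + i * + 2 + + 1)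
      up' oe = X'.OnE-lift (OnE-cong (λ j → sym (assoc-D' j)) oe)

    Λ-derived : ∀ k i j → Λ (suc k) (finish (C' (h' + j * + 2 + + 1)) ⊖ finish (C (h + i * + 2 + + 1))) → Λ k
      (finish (D' j) ⊖ finish (D i))
    Λ-derived k i j l = Λ-θ⁻¹ {k} {finish (D' j) ⊖ finish (D i)} (subst (Λ (suc k))
      (trans (cong₂ _⊖_ (at-finish' j) (at-finish i)) (trans (⊖-cancelˡ o (θ (finish (D' j))) (θ (finish (D i))))
        (sym (θ-⊖ (finish (D' j)) (finish (D i))))))
      l)

    compat : Compat D D'
    compat = record { E-compat = E-c ; type-compat = type-c ; fold-compat = fold-c }
      where
      E-c : ∀ k {i j} → OnE (assoc D) k i → OnE (assoc D') k j → Λ k (finish (D i) ⊖ finish (D' j))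
      E-c k {i} {j} oi oj = Λ-swap (finish (D' j)) (finish (D i))
        (Λ-derived k i j (Λ-swap (finish (C (h + i * + 2 + + 1))) (finish (C' (h' + j * + 2 + + 1)))
        (E-compat (suc k) (up oi) (up' oj))))
      type-c : ∀ {i j} → OnE (assoc D) 1 i → OnE (assoc D') 1 j → orientSgn (dir (D i)) ≡ orientSgn (dir (D' j))
      type-c {i} {j} oi oj = trans (cong orientSgn (dir-D i)) (trans (orientSgn-diag s d d' (level₀-orient li lj))
        (trans (cong (λ x → orientSgn (diag x d')) same) (sym (cong orientSgn (dir-D' j)))))
        where
        s = a (h + i * + 2)
        s' = a' (h' + j * + 2)
        d = dir (C (h + i * + 2))
        d' = dir (C' (h' + j * + 2))
        li : AtLevel a 0 (h + i * + 2)
        li = level-shift i lh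
        lj : AtLevel a' 0 (h' + j * + 2)
        lj = level-shift j lh'
        same : s ≡ s'
        same = level₀-turns li lj (up oi) (up' oj)
      idx : ∀ h i k → h + (i + pow2 k) * + 2 + + 1 ≡ h + i * + 2 + + 1 + pow2 (suc k)
      idx h i k = trans (lem h i (pow2 k)) (cong (λ z → h + i * + 2 + + 1 + z) (sym (pow2-suc k)))
        where
        lem : ∀ h i P → h + (i + P) * + 2 + + 1 ≡ h + i * + 2 + + 1 + + 2 * P
        lem = solve-∀
      fold-c : ∀ k {i j} → AtLevel (assoc D) k i → AtLevel (assoc D') k j → assoc D i ≡ assoc D' j →
        OnE (assoc D) (suc (suc k)) (i + pow2 k) → OnE (assoc D') (suc (suc k)) (j + pow2 k)
      fold-c k {i} {j} li lj e oe = OnE-cong assoc-D'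
        (X'.OnE-drop′ (subst (OnE a' (suc (suc (suc k)))) (sym (idx h' j k))
        (fold-compat (suc k) (X.level-lift (level-cong (λ x → sym (assoc-D x)) li))
          (X'.level-lift (level-cong (λ x → sym (assoc-D' x)) lj))
          (trans (assoc-D i) (trans e (sym (assoc-D' j))))
          (subst (OnE a (suc (suc (suc k)))) (idx h i k) (up oe)))))

-- Each derivation removes one level and one factor 1 + i, leaving two factors for level 0. An index
-- `j` in the alternating class of C' is excluded by its colour.
turn-determined : ∀ k {C C'} → FoldCurve C → FoldCurve C' → Compat C C' → ∀ {i j} →
  AtLevel (assoc C) k i → Λ (suc (suc k)) (finish (C' j) ⊖ finish (C i)) → assoc C' j ≡ assoc C i
turn-determined zero fc fc' cp li l = Pair.level₀-determined fc fc' cp li l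
turn-determined (suc k) {C} {C'} fc fc' cp {i} {j} li l
  with derive (assoc C) (FoldCurve.cfs fc) | derive (assoc C') (FoldCurve.cfs fc')
... | h , lh , cfsb | h' , lh' , cfsb' with Derivation.level-odd (assoc C) h lh li | parity-from h' j
... | m , refl | m' , inj₂ refl = trans (assoc-D' m') (trans
    (turn-determined k fold-D fold-D' compat (level-cong assoc-D (Derivation.level-drop (assoc C) h lh li))
      (Λ-derived (suc (suc k)) m m' l))
    (sym (assoc-D m)))
  where open Pair.Descend fc fc' cp h h' lh lh' cfsb cfsb'
... | m , refl | m' , inj₁ refl = ⊥-elim (finish-suc-not-Λ₁ fc' j (Λ-swap (finish (C' j)) (finish (C' (j + + 1)))
    (Λ-telescope (finish (C' j)) (finish (C i)) (finish (C' (j + + 1))) (Λ-≤ (s≤s z≤n) l)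
      (Compat.E-compat cp 1 (OnE-mono₁ k _ (FoldCurve.cfs fc) i (level⇒OnE li))
        (level⇒OnE-next 0 (assoc C') (FoldCurve.cfs fc') j (level-shift m' lh'))))))

-- Vertices with all four edges on the curve

by-dir : (P : Dir → Set) → P E → P N → P W → P S → ∀ d → P d
by-dir P pE pN pW pS E = pE
by-dir P pE pN pW pS N = pN
by-dir P pE pN pW pS W = pW
by-dir P pE pN pW pS S = pS

opp-opp : ∀ d → opp (opp d) ≡ d
opp-opp = by-dir _ refl refl refl refl

rotL-rotR : ∀ d → rotL (rotR d) ≡ d
rotL-rotR = by-dir _ refl refl refl refl

⊕-identityʳ : ∀ p → p ⊕ (+ 0 , + 0) ≡ p
⊕-identityʳ (a , b) = cong₂ _,_ (ℤP.+-identityʳ a) (ℤP.+-identityʳ b)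

-- A vertex all of whose four edges belong to the curve: two opposite arrivals with equal turns.
record Full (C : Curve) (p : Point) : Set where
  constructor full
  field
    i j : ℤ
    at-i : finish (C i) ≡ p
    at-j : finish (C j) ≡ p
    opposite : dir (C j) ≡ opp (dir (C i))
    same-turn : assoc C i ≡ assoc C j

data Cov (C : Curve) (q : Point) (d : Dir) : Set where
  out  : ∀ i → start (C i) ≡ q → dir (C i) ≡ d → Cov C q d
  into : ∀ i → finish (C i) ≡ q → dir (C i) ≡ opp d → Cov C q d

rotL-cases : ∀ e d → (d ≡ e) ⊎ (d ≡ opp e) ⊎ (d ≡ rotL e) ⊎ (d ≡ rotL (opp e))
rotL-cases E E = inj₁ refl
rotL-cases E N = inj₂ (inj₂ (inj₁ refl))
rotL-cases E W = inj₂ (inj₁ refl)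
rotL-cases E S = inj₂ (inj₂ (inj₂ refl))
rotL-cases N E = inj₂ (inj₂ (inj₂ refl))
rotL-cases N N = inj₁ refl
rotL-cases N W = inj₂ (inj₂ (inj₁ refl))
rotL-cases N S = inj₂ (inj₁ refl)
rotL-cases W E = inj₂ (inj₁ refl)
rotL-cases W N = inj₂ (inj₂ (inj₂ refl))
rotL-cases W W = inj₁ refl
rotL-cases W S = inj₂ (inj₂ (inj₁ refl))
rotL-cases S E = inj₂ (inj₂ (inj₁ refl))
rotL-cases S N = inj₂ (inj₁ refl)
rotL-cases S W = inj₂ (inj₂ (inj₂ refl))
rotL-cases S S = inj₁ refl

dir-cases : ∀ s e d → (d ≡ e) ⊎ (d ≡ opp e) ⊎ (d ≡ step s e) ⊎ (d ≡ step s (opp e))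
dir-cases pos e d = rotL-cases e d
dir-cases neg e d with rotL-cases e d
... | inj₁ x = inj₁ x
... | inj₂ (inj₁ x) = inj₂ (inj₁ x)
... | inj₂ (inj₂ (inj₁ x)) = inj₂ (inj₂ (inj₂ (trans x (by-dir (λ e → rotL e ≡ rotR (opp e)) refl refl refl refl e))))
... | inj₂ (inj₂ (inj₂ x)) = inj₂ (inj₂ (inj₁ (trans x (by-dir (λ e → rotL (opp e) ≡ rotR e) refl refl refl refl e))))

full⇒cov : ∀ {C} → FoldCurve C → ∀ {p} → Full C p → ∀ d → Cov C p d
full⇒cov {C} fc (full i j at-i at-j opposite same) d with dir-cases (assoc C i) (dir (C i)) d
... | inj₁ e = into j at-j (trans opposite (cong opp (sym e)))
... | inj₂ (inj₁ e) = into i at-i (trans (sym (opp-opp _)) (cong opp (sym e)))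
... | inj₂ (inj₂ (inj₁ e)) = out (i + + 1) (trans (sym (FoldCurve.conn fc i)) at-i)
  (trans (FoldCurve.dir-suc fc i) (sym e))
... | inj₂ (inj₂ (inj₂ e)) = out (j + + 1) (trans (sym (FoldCurve.conn fc j)) at-j)
  (trans (FoldCurve.dir-suc fc j) (trans (cong₂ step (sym same) opposite) (sym e)))

⊕-unit-opp : ∀ p d → (p ⊕ unit d) ⊕ unit (opp d) ≡ p
⊕-unit-opp p d = trans (⊕-assoc p (unit d) (unit (opp d))) (trans (cong (p ⊕_)
  (by-dir (λ d → unit d ⊕ unit (opp d) ≡ (+ 0 , + 0)) refl refl refl refl d)) (⊕-identityʳ p))

start-from-finish : ∀ s → start s ≡ finish s ⊕ unit (opp (dir s))
start-from-finish (seg p d) = sym (⊕-unit-opp p d)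

cov-sym : ∀ {C q d} → Cov C q d → Cov C (q ⊕ unit d) (opp d)
cov-sym {d = d} (out i e f) = into i (cong₂ _⊕_ e (cong unit f)) (trans f (sym (opp-opp d)))
cov-sym {C} {d = d} (into i e f) = out i
  (trans (start-from-finish (C i)) (cong₂ _⊕_ e (cong unit (trans (cong opp f) (opp-opp d))))) f

cov-at : ∀ {C q q' d d'} → q ≡ q' → d ≡ d' → Cov C q d → Cov C q' d'
cov-at refl refl c = c

-- From a derivative back to its curve

undiag : Sgn → Dir → Dir
undiag pos d = d
undiag neg d = rotL d

undiag-diag : ∀ s d → undiag s (diag s d) ≡ d
undiag-diag pos d = refl
undiag-diag neg d = rotL-rotR d

undiag-opp : ∀ s d → undiag s (opp d) ≡ opp (undiag s d)
undiag-opp pos d = refl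
undiag-opp neg d = by-dir (λ d → rotL (opp d) ≡ opp (rotL d)) refl refl refl refl d

step-opp : ∀ s d → step s (opp d) ≡ opp (step s d)
step-opp pos = by-dir _ refl refl refl refl
step-opp neg = by-dir _ refl refl refl refl

orientSgn-opp : ∀ d → orientSgn (opp d) ≡ orientSgn d
orientSgn-opp = by-dir _ refl refl refl refl

alt-fixes : ∀ k x y → alt k x ≡ x → alt k y ≡ y
alt-fixes k x y e with sgn-cases y x
... | inj₁ refl = e
... | inj₂ refl = trans (alt-negate k x) (cong negate e)

module Inflate {C : Curve} (fc : FoldCurve C) (h : ℤ) (lh : AtLevel (assoc C) 0 h) (o : Point)
  (der : Derived C h o) where
  open Derived der
  private
    a = assoc C
    e : ℤ → ℤ
    e k = h + k * + 2

  τ : Seq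
  τ k = a (h + k * + 2)

  τ-suc : ∀ k → τ (k + + 1) ≡ negate (τ k)
  τ-suc k = trans (alternates lh (k + + 1)) (trans (alt-suc k (a h)) (cong negate (sym (alternates lh k))))

  -- Inner turns and orientations both alternate along D.
  τ-orient : ∀ i j → orientSgn (dir (D i)) ≡ orientSgn (dir (D j)) → τ i ≡ τ j
  τ-orient i j eq = sym (trans (cong τ (sym (lem i j))) (trans (alternating-alt τ τ-suc i (j - i))
    (alt-fixes (j - i) (orientSgn (dir (D i))) (τ i) (trans (sym (FoldCurve.orient-alt fold-D i (j - i)))
      (trans (cong (λ z → orientSgn (dir (D z))) (lem i j)) (sym eq))))))
    where
    lem : ∀ i j → i + (j - i) ≡ j
    lem = solve-∀

  first-dir : ∀ k → dir (C (e k)) ≡ undiag (τ k) (dir (D k))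
  first-dir k = sym (trans (cong (undiag (τ k)) (dir-D k)) (undiag-diag (τ k) (dir (C (e k)))))

  -- The two arrivals are parallel, so they have the same inner turn, bend alike and end in opposite
  -- directions again.
  keep : ∀ {q} → Full D q → Full C (o ⊕ θ q)
  keep (full i j at-i at-j opposite same) = full (e i + + 1) (e j + + 1)
    (trans (at-finish i) (cong (λ z → o ⊕ θ z) at-i)) (trans (at-finish j) (cong (λ z → o ⊕ θ z) at-j))
    (trans (second j) (trans (cong₂ (λ s d → step s (undiag s d)) (sym ττ) opposite)
      (trans (cong (step (τ i)) (undiag-opp (τ i) (dir (D i))))
        (trans (step-opp (τ i) _) (cong opp (sym (second i)))))))
    (trans (assoc-D i) (trans same (sym (assoc-D j))))
    where
    ττ : τ i ≡ τ j
    ττ = τ-orient i j (trans (sym (orientSgn-opp _)) (cong orientSgn (sym opposite)))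
    second : ∀ k → dir (C (e k + + 1)) ≡ step (τ k) (undiag (τ k) (dir (D k)))
    second k = trans (FoldCurve.dir-suc fc (e k)) (cong (step (τ k)) (first-dir k))

  middle : ∀ k → finish (C (e k)) ≡ o ⊕ (θ (start (D k)) ⊕ unit (undiag (τ k) (dir (D k))))
  middle k = trans (cong₂ _⊕_ (at-start k) (cong unit (first-dir k)))
    (⊕-assoc o (θ (start (D k))) (unit (undiag (τ k) (dir (D k)))))

  full-middle : ∀ i j p → τ i ≡ τ j → dir (D j) ≡ opp (dir (D i)) →
    θ (start (D i)) ⊕ unit (undiag (τ i) (dir (D i))) ≡ p → θ (start (D j)) ⊕ unit (undiag (τ j) (dir (D j))) ≡ p →
      Full C (o ⊕ p)
  full-middle i j p ττ opposite ei ej = full (e i) (e j)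
    (trans (middle i) (cong (o ⊕_) ei)) (trans (middle j) (cong (o ⊕_) ej))
    (trans (first-dir j) (trans (cong₂ undiag (sym ττ) opposite)
      (trans (undiag-opp (τ i) _) (cong opp (sym (first-dir i))))))
    ττ

  -- β q is the turn of C inside the segments of D starting at q.  If it is neg, every edge of D at q bends, as seen
  -- from q, to the left in C; otherwise every one bends to the right.
  β : Point → Sgn
  β (x , y) = alt (x + y) (alt (proj₁ (start (D (+ 0))) + proj₂ (start (D (+ 0)))) (τ (+ 0)))

  private
    alt-via-pos : ∀ m n s → alt m pos ≡ negate (alt n pos) → alt m s ≡ negate (alt n s)
    alt-via-pos m n pos eq = eq
    alt-via-pos m n neg eq = trans (alt-negate m pos) (trans (cong negate eq) (cong negate (sym (alt-negate n pos))))

  β-unit : ∀ q d → β (q ⊕ unit d) ≡ negate (β q)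
  β-unit q@(x , y) d = alt-via-pos (proj₁ (q ⊕ unit d) + proj₂ (q ⊕ unit d)) (x + y) _ (par-unit q d)

  β-start : ∀ i {q} → start (D i) ≡ q → τ i ≡ β q
  β-start i refl = sym (trans (cong (λ z → β (start (D z))) (sym (ℤP.+-identityˡ i)))
    (trans (alternating-alt (λ k → β (start (D k))) (λ k → trans (cong β (sym (FoldCurve.conn fold-D k)))
      (β-unit (start (D k)) (dir (D k)))) (+ 0) i)
      (trans (cong (alt i) (evenℕ?-invol ∣ proj₁ (start (D (+ 0))) + proj₂ (start (D (+ 0))) ∣ (τ (+ 0))))
        (trans (sym (alternating-alt τ τ-suc (+ 0) i)) (cong τ (ℤP.+-identityˡ i))))))

  β-finish : ∀ i {q} → finish (D i) ≡ q → τ i ≡ negate (β q)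
  β-finish i eq = trans (sym (negate-invol _))
    (cong negate (trans (sym (τ-suc i)) (β-start (i + + 1) (trans (sym (FoldCurve.conn fold-D i)) eq))))

  -- The point θ q + unit (rotL d) is the image of the centre of the unit square to the left of the
  -- edge `d` at q. Opposite corners have the same `β`, so this edge and the opposite one both bend
  -- into the centre. If one ran away from its corner and the other towards its own, they would have
  -- the same direction but different inner turns.
  center : ∀ q d → β q ≡ neg → Cov D q d → Cov D (q ⊕ (unit d ⊕ unit (rotL d))) (opp d) → Full C
    (o ⊕ (θ q ⊕ unit (rotL d)))
  center q d bq c c' = go c c'
    where
    ld = rotL d
    q' = q ⊕ (unit d ⊕ unit ld)
    bq' : β q' ≡ neg
    bq' = trans (cong β (sym (⊕-assoc q (unit d) (unit ld))))
      (trans (β-unit (q ⊕ unit d) ld) (trans (cong negate (β-unit q d)) (trans (negate-invol _) bq)))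
    pull : ∀ v w → θ (q ⊕ v) ⊕ w ≡ θ q ⊕ (θ v ⊕ w)
    pull v w = trans (cong (_⊕ w) (θ-⊕ q v)) (⊕-assoc (θ q) (θ v) w)
    mid : ∀ k {r x} → start (D k) ≡ r → τ k ≡ x → ∀ {f} → dir (D k) ≡ f →
      θ (start (D k)) ⊕ unit (undiag (τ k) (dir (D k))) ≡ θ r ⊕ unit (undiag x f)
    mid k refl refl refl = refl
    clash : ∀ i j → dir (D i) ≡ dir (D j) → τ i ≡ neg → τ j ≡ pos → ⊥
    clash i j dd ti tj with trans (sym ti) (trans (τ-orient i j (cong orientSgn dd)) tj)
    ... | ()
    go : Cov D q d → Cov D q' (opp d) → Full C (o ⊕ (θ q ⊕ unit ld))
    go (out i s f) (out j s' f') = full-middle i j _ (trans ti (sym tj)) (trans f' (cong opp (sym f)))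
      (mid i s ti f)
      (trans (mid j s' tj f') (trans (pull _ _) (cong (θ q ⊕_)
        (by-dir (λ d → θ (unit d ⊕ unit (rotL d)) ⊕ unit (rotL (opp d)) ≡ unit (rotL d)) refl refl refl refl d))))
      where
      ti = trans (β-start i s) bq
      tj = trans (β-start j s') bq'
    go (into i s f) (into j s' f') = full-middle i j _ (trans ti (sym tj)) (trans f' (cong opp (sym f)))
      (trans (mid i si ti f) (trans (pull _ _) (cong (θ q ⊕_)
        (by-dir (λ d → θ (unit (opp (opp d))) ⊕ unit (opp d) ≡ unit (rotL d)) refl refl refl refl d))))
      (trans (mid j sj tj f') (trans (pull _ _) (cong (θ q ⊕_)
        (by-dir (λ d → θ ((unit d ⊕ unit (rotL d)) ⊕ unit (opp (opp (opp d)))) ⊕ unit (opp (opp d)) ≡ unit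
          (rotL d)) refl refl refl refl d))))
      where
      ti = trans (β-finish i s) (cong negate bq)
      tj = trans (β-finish j s') (cong negate bq')
      si : start (D i) ≡ q ⊕ unit (opp (opp d))
      si = trans (start-from-finish (D i)) (cong₂ _⊕_ s (cong (λ x → unit (opp x)) f))
      sj : start (D j) ≡ q ⊕ ((unit d ⊕ unit ld) ⊕ unit (opp (opp (opp d))))
      sj = trans (start-from-finish (D j)) (trans (cong₂ _⊕_ s' (cong (λ x → unit (opp x)) f'))
        (⊕-assoc q (unit d ⊕ unit ld) (unit (opp (opp (opp d))))))
    go (out i s f) (into j s' f') = ⊥-elim (clash i j (trans f (trans (sym (opp-opp d)) (sym f')))
      (trans (β-start i s) bq) (trans (β-finish j s') (cong negate bq')))
    go (into i s f) (out j s' f') = ⊥-elim (clash j i (trans f' (sym f)) (trans (β-start j s') bq')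
      (trans (β-finish i s) (cong negate bq)))

  -- Adjacent corners have opposite `β`, so one of the two pairs of opposite edges bends inwards.
  face : ∀ q d → Cov D q d → Cov D (q ⊕ unit d) (rotL d) → Cov D (q ⊕ (unit d ⊕ unit (rotL d))) (opp d) →
    Cov D (q ⊕ unit (rotL d)) (opp (rotL d)) → Full C (o ⊕ (θ q ⊕ unit (rotL d)))
  face q d c₁ c₂ c₃ c₄ with sgn-cases (β q) neg
  ... | inj₁ bq = center q d bq c₁ c₃
  ... | inj₂ bq = subst (Full C) (cong (o ⊕_) (trans (cong (_⊕ unit (rotL (rotL d))) (θ-⊕ q (unit d)))
      (trans (⊕-assoc (θ q) (θ (unit d)) (unit (rotL (rotL d)))) (cong (θ q ⊕_)
        (by-dir (λ d → θ (unit d) ⊕ unit (rotL (rotL d)) ≡ unit (rotL d)) refl refl refl refl d)))))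
    (center (q ⊕ unit d) (rotL d) (trans (β-unit q d) (cong negate bq)) c₂
      (cov-at (trans (cong (q ⊕_)
        (by-dir (λ d → unit (rotL d) ≡ unit d ⊕ (unit (rotL d) ⊕ unit (rotL (rotL d)))) refl refl refl refl d))
        (sym (⊕-assoc q (unit d) _))) refl c₄))

  center-diag : ∀ q d → Full D q → Full D (q ⊕ (unit d ⊕ unit (rotL d))) → Full C (o ⊕ (θ q ⊕ unit (rotL d)))
  center-diag q d f f' = face q d (full⇒cov fold-D f d)
    (cov-at (trans (⊕-assoc q _ _)
      (cong (q ⊕_) (by-dir (λ d → (unit d ⊕ unit (rotL d)) ⊕ unit (opp (rotL d)) ≡ unit d) refl refl refl refl d)))
      (opp-opp (rotL d))
      (cov-sym (full⇒cov fold-D f' (opp (rotL d)))))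
    (full⇒cov fold-D f' (opp d))
    (cov-sym (full⇒cov fold-D f (rotL d)))

  -- The edges leaving both ends of `d` to its right bend towards each other and meet at a common
  -- neighbour of the two images.
  side : ∀ q d → β q ≡ neg → Full D q → Full D (q ⊕ unit d) → Full C (o ⊕ (θ q ⊕ unit d))
  side q d bq f f' = subst (λ x → Full C (o ⊕ (θ q ⊕ unit x))) (rotL-rotR d)
    (center q (rotR d) bq (full⇒cov fold-D f (rotR d))
      (cov-at (trans (⊕-assoc q (unit d) (unit (rotR d)))
        (cong (q ⊕_) (by-dir (λ d → unit d ⊕ unit (rotR d) ≡ unit (rotR d) ⊕ unit
        (rotL (rotR d))) refl refl refl refl d))) refl
        (cov-sym (full⇒cov fold-D f' (rotR d)))))

-- Large squares on a single curve

record ParentOf (C : Curve) : Set where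
  field
    h   : ℤ
    lh  : AtLevel (assoc C) 0 h
    o   : Point
    der : Derived C h o

opaque
  parent : ∀ {C} → FoldCurve C → ParentOf C
  parent {C} fc with derive (assoc C) (FoldCurve.cfs fc)
  ... | h , lh , cfsb = record { h = h ; lh = lh ; o = start (C h) ; der = derived fc h lh cfsb (start (C h)) refl }

module Parent {C : Curve} (fc : FoldCurve C) where
  open ParentOf (parent fc) public
  open Derived der public using (D; fold-D)
  open Inflate fc h lh o der public

step-step : ∀ s d → step s (step s d) ≡ opp d
step-step pos = by-dir _ refl refl refl refl
step-step neg = by-dir _ refl refl refl refl

step-negate : ∀ s d → step s (step (negate s) d) ≡ d
step-negate pos = by-dir _ refl refl refl refl
step-negate neg = by-dir _ refl refl refl refl

module Square {D : Curve} (fd : FoldCurve D) (t : Triple (assoc D)) where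
  open FoldCurve fd
  open Triple t
  j₁ = j + + 1
  j₂ = j₁ + + 1
  j₃ = j₂ + + 1
  j₄ = j₃ + + 1
  q : Point
  q = start (D j₁)
  d : Dir
  d = dir (D j₁)
  f : Dir
  f = step σ d

  dir₂ : dir (D j₂) ≡ f
  dir₂ = trans (dir-suc j₁) (cong (λ s → step s d) first)
  dir₃ : dir (D j₃) ≡ opp d
  dir₃ = trans (dir-suc j₂) (trans (cong₂ step second dir₂) (step-step σ d))
  dir₄ : dir (D j₄) ≡ opp f
  dir₄ = trans (dir-suc j₃) (trans (cong₂ step third dir₃) (step-opp σ d))
  dir₀ : dir (D j) ≡ f
  dir₀ = trans (sym (step-negate σ (dir (D j))))
    (cong (step σ) (trans (cong (λ s → step s (dir (D j))) (sym before)) (sym (dir-suc j))))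

  start₂ : start (D j₂) ≡ q ⊕ unit d
  start₂ = sym (conn j₁)
  start₃ : start (D j₃) ≡ q ⊕ (unit d ⊕ unit f)
  start₃ = trans (sym (conn j₂)) (trans (cong₂ _⊕_ start₂ (cong unit dir₂)) (⊕-assoc q (unit d) (unit f)))
  start₄ : start (D j₄) ≡ q ⊕ unit f
  start₄ = trans (sym (conn j₃)) (trans (cong₂ _⊕_ start₃ (cong unit dir₃))
    (trans (⊕-assoc q (unit d ⊕ unit f) (unit (opp d)))
    (trans (cong (λ v → q ⊕ (v ⊕ unit (opp d))) (⊕-comm (unit d) (unit f))) (cong (q ⊕_) (⊕-unit-opp (unit f) d)))))
  finish₄ : finish (D j₄) ≡ q
  finish₄ = trans (cong₂ _⊕_ start₄ (cong unit dir₄)) (⊕-unit-opp q f)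

  corner-full : Full D q
  corner-full = full j j₄ (conn j) finish₄ (trans dir₄ (cong opp (sym dir₀))) (trans before (sym after))

  c₁ : Cov D q d
  c₁ = out j₁ refl refl
  c₂ : Cov D (q ⊕ unit d) f
  c₂ = out j₂ start₂ dir₂
  c₃ : Cov D (q ⊕ (unit d ⊕ unit f)) (opp d)
  c₃ = out j₃ start₃ dir₃
  c₄ : Cov D (q ⊕ unit f) (opp f)
  c₄ = out j₄ start₄ dir₄

record AdjacentPair (C : Curve) : Set where
  field
    {q} : Point
    {d} : Dir
    corner : Full C q
    next   : Full C (q ⊕ unit d)

record Corner (C : Curve) : Set where
  field
    {b} : Point
    {y} : Dir
    corner : Full C b
    arm₁ : Full C (b ⊕ unit y)
    arm₂ : Full C (b ⊕ unit (rotL y))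

lin : Dir → ℕ → ℕ → Point
lin d i j = scale (+ i) (unit d) ⊕ scale (+ j) (unit (rotL d))

record FullSquare (C : Curve) (m : ℕ) : Set where
  field
    s : Point
    d : Dir
    isFull : ∀ i j → i ℕ.≤ m → j ℕ.≤ m → Full C (s ⊕ lin d i j)

move : ∀ {C} o p {v w} → v ≡ w → Full C (o ⊕ (p ⊕ v)) → Full C ((o ⊕ p) ⊕ w)
move {C} o p {v} refl f = subst (Full C) (sym (⊕-assoc o p v)) f

θ-unit : ∀ d → θ (unit d) ≡ unit d ⊕ unit (rotL d)
θ-unit = by-dir _ refl refl refl refl

-- The corner passed twice stays full, and the centre of the closed unit square, full by `face`, is
-- adjacent to its image.
triple⇒pair : ∀ {C} (fc : FoldCurve C) → Triple (assoc (Parent.D fc)) → AdjacentPair C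
triple⇒pair {C} fc t = go σ refl
  where
  open Parent fc
  open Triple t using (σ)
  open Square fold-D t
  mk : ∀ x → Full C (o ⊕ (θ q ⊕ unit (rotL x))) → AdjacentPair C
  mk x g = record { q = o ⊕ θ q ; d = rotL x ; corner = keep corner-full ; next = move o (θ q) refl g }
  go : ∀ s → σ ≡ s → AdjacentPair C
  go pos e = mk d (face q d c₁
    (cov-at refl f≡ c₂) (cov-at (cong (λ x → q ⊕ (unit d ⊕ unit x)) f≡) refl c₃)
      (cov-at (cong (λ x → q ⊕ unit x) f≡) (cong opp f≡) c₄))
    where
    f≡ : f ≡ rotL d
    f≡ = cong (λ s → step s d) e
  -- A square on the right is read in the reverse direction, so that it lies on the left.
  go neg e = mk x (face q x
    (cov-at (⊕-unit-opp q f) (trans (opp-opp f) f≡) (cov-sym c₄))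
    (cov-at (trans (⊕-assoc q (unit d ⊕ unit f) (unit (opp d)))
      (trans (cong (λ y → q ⊕ ((unit d ⊕ unit y) ⊕ unit (opp d))) f≡)
      (cong (q ⊕_) (by-dir (λ d → (unit d ⊕ unit (rotR d)) ⊕ unit (opp d) ≡ unit (rotR d)) refl refl refl refl d))))
        (trans (opp-opp d) d≡) (cov-sym c₃))
    (cov-at (trans (⊕-assoc q (unit d) (unit f))
      (cong (q ⊕_) (trans (⊕-comm (unit d) (unit f)) (cong₂ (λ y z → unit y ⊕ unit z) f≡ d≡)))) (cong opp f≡)
      (cov-sym c₂))
    (cov-at (cong (λ y → q ⊕ unit y) d≡) (cong opp d≡) (cov-sym c₁)))
    where
    x = rotR d
    f≡ : f ≡ x
    f≡ = cong (λ s → step s d) e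
    d≡ : d ≡ rotL x
    d≡ = sym (rotL-rotR d)

adjacentPair : ∀ {C} → FoldCurve C → AdjacentPair C
adjacentPair fc = triple⇒pair fc (triple (assoc (Parent.D fc)) (FoldCurve.cfs (Parent.fold-D fc)))

-- The vertex given by `side` is adjacent to the images of both members of the pair, at a right
-- angle. Of the two ends, one has the value of `β` that `side` needs.
pair⇒corner : ∀ {C} (fc : FoldCurve C) → AdjacentPair (Parent.D fc) → Corner C
pair⇒corner {C} fc ap = go (sgn-cases (β q) neg)
  where
  open Parent fc
  open AdjacentPair ap
  mk : ∀ q d → β q ≡ neg → Full D q → Full D (q ⊕ unit d) → Corner C
  mk q d bq g g' = record
    { b = (o ⊕ θ q) ⊕ unit d ; y = rotL d
    ; corner = move o (θ q) refl (side q d bq g g')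
    ; arm₁ = subst (Full C)
      (sym (trans (⊕-assoc (o ⊕ θ q) (unit d) (unit (rotL d))) (trans (cong ((o ⊕ θ q) ⊕_) (sym (θ-unit d)))
        (trans (⊕-assoc o (θ q) (θ (unit d))) (cong (o ⊕_) (sym (θ-⊕ q (unit d)))))))) (keep g')
    ; arm₂ = subst (Full C) (sym (trans (⊕-assoc (o ⊕ θ q) (unit d) (unit (rotL (rotL d))))
        (trans (cong ((o ⊕ θ q) ⊕_)
          (by-dir (λ d → unit d ⊕ unit (rotL (rotL d)) ≡ (+ 0 , + 0)) refl refl refl refl d))
          (⊕-identityʳ (o ⊕ θ q))))) (keep g) }
  go : (β q ≡ neg) ⊎ (β q ≡ pos) → Corner C
  go (inj₁ bq) = mk q d bq corner next
  go (inj₂ bq) = mk (q ⊕ unit d) (opp d) (trans (β-unit q d) (cong negate bq)) next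
    (subst (Full D) (sym (⊕-unit-opp q d)) corner)

-- The images of `b` and of one arm are opposite vertices of the new unit square. Of the remaining
-- two, one is the centre of the square spanned by both arms, the other comes from `side`; `β b`
-- decides which arm is used.
corner⇒square : ∀ {C} (fc : FoldCurve C) → Corner (Parent.D fc) → FullSquare C 1
corner⇒square {C} fc cr = go (sgn-cases (β b) neg)
  where
  open Parent fc
  open Corner cr
  x = rotL y
  s₀ = o ⊕ θ b
  mk : ∀ d → Full C (s₀ ⊕ unit d) → Full C (s₀ ⊕ unit (rotL d)) → Full C (o ⊕ θ (b ⊕ unit d)) → FullSquare C 1
  mk d g₁₀ g₀₁ g₁₁ = record { s = s₀ ; d = d ; isFull = isF }
    where
    isF : ∀ i j → i ℕ.≤ 1 → j ℕ.≤ 1 → Full C (s₀ ⊕ lin d i j)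
    isF 0 0 _ _ = subst (Full C)
      (trans (sym (⊕-identityʳ s₀)) (cong (s₀ ⊕_) (by-dir (λ d → (+ 0 , + 0) ≡ lin d 0 0) refl refl refl refl d)))
      (keep corner)
    isF 1 0 _ _ = subst (λ v → Full C (s₀ ⊕ v)) (by-dir (λ d → unit d ≡ lin d 1 0) refl refl refl refl d) g₁₀
    isF 0 1 _ _ = subst (λ v → Full C (s₀ ⊕ v)) (by-dir (λ d → unit (rotL d) ≡ lin d 0 1) refl refl refl refl d) g₀₁
    isF 1 1 _ _ = subst (Full C) (trans (cong (o ⊕_) (θ-⊕ b (unit d))) (trans (sym (⊕-assoc o (θ b) (θ (unit d))))
      (cong (s₀ ⊕_) (by-dir (λ d → θ (unit d) ≡ lin d 1 1) refl refl refl refl d)))) g₁₁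
    isF (suc (suc _)) _ (s≤s ()) _
    isF 0 (suc (suc _)) _ (s≤s ())
    isF 1 (suc (suc _)) _ (s≤s ())
  m : Full C (s₀ ⊕ unit x)
  m = subst (Full C) (trans
    (cong (o ⊕_) (trans (cong (_⊕ unit (rotL x)) (θ-⊕ b (unit y))) (trans (⊕-assoc (θ b) (θ (unit y)) (unit (rotL x)))
        (cong (θ b ⊕_) (by-dir (λ y → θ (unit y) ⊕ unit (rotL (rotL y)) ≡ unit (rotL y)) refl refl refl refl y)))))
          (sym (⊕-assoc o (θ b) (unit x))))
    (center-diag (b ⊕ unit y) x arm₁
      (subst (Full D) (sym (trans (⊕-assoc b (unit y) (unit x ⊕ unit (rotL x)))
        (cong (b ⊕_) (by-dir (λ y → unit y ⊕ (unit (rotL y) ⊕ unit (rotL (rotL y))) ≡ unit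
        (rotL y)) refl refl refl refl y)))) arm₂))
  go : (β b ≡ neg) ⊎ (β b ≡ pos) → FullSquare C 1
  go (inj₁ bb) = mk y (move o (θ b) refl (side b y bb corner arm₁)) m (keep arm₁)
  go (inj₂ bb) = mk x m
    (subst (Full C) (trans
      (cong (o ⊕_) (trans (cong (_⊕ unit (opp x)) (θ-⊕ b (unit x))) (trans (⊕-assoc (θ b) (θ (unit x)) (unit (opp x)))
        (cong (θ b ⊕_) (by-dir (λ x → θ (unit x) ⊕ unit (opp x) ≡ unit (rotL x)) refl refl refl refl x)))))
          (sym (⊕-assoc o (θ b) (unit (rotL x)))))
      (side (b ⊕ unit x) (opp x) (trans (β-unit b x) (cong negate bb)) arm₂
        (subst (Full D) (sym (⊕-unit-opp b x)) corner)))
    (keep arm₂)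

halve : ∀ u → Σ ℕ λ i → (u ≡ dbl i) ⊎ (u ≡ suc (dbl i))
halve zero = 0 , inj₁ refl
halve (suc u) with halve u
... | i , inj₁ refl = i , inj₂ refl
... | i , inj₂ refl = suc i , inj₁ refl

dbl-≤⁻¹ : ∀ i m → dbl i ℕ.≤ dbl m → i ℕ.≤ m
dbl-≤⁻¹ zero m _ = z≤n
dbl-≤⁻¹ (suc i) (suc m) (s≤s (s≤s p)) = s≤s (dbl-≤⁻¹ i m p)

dbl-<⁻¹ : ∀ i m → suc (dbl i) ℕ.≤ dbl m → suc i ℕ.≤ m
dbl-<⁻¹ zero (suc m) _ = s≤s z≤n
dbl-<⁻¹ (suc i) (suc m) (s≤s (s≤s p)) = s≤s (dbl-<⁻¹ i m p)

lin-suc₁ : ∀ d i j → lin d (suc i) j ≡ lin d i j ⊕ unit d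
lin-suc₁ d i j = cong₂ _,_ (lem (+ i) (proj₁ (unit d)) (+ j * proj₁ (unit (rotL d))))
  (lem (+ i) (proj₂ (unit d)) (+ j * proj₂ (unit (rotL d))))
  where
  lem : ∀ i x z → (+ 1 + i) * x + z ≡ i * x + z + x
  lem = solve-∀

lin-suc₂ : ∀ d i j → lin d i (suc j) ≡ lin d i j ⊕ unit (rotL d)
lin-suc₂ d i j = cong₂ _,_ (lem (+ j) (proj₁ (unit (rotL d))) (+ i * proj₁ (unit d)))
  (lem (+ j) (proj₂ (unit (rotL d))) (+ i * proj₂ (unit d)))
  where
  lem : ∀ j x z → z + (+ 1 + j) * x ≡ z + j * x + x
  lem = solve-∀

θθ-lin : ∀ d i j → θ (θ (lin d i j)) ≡ lin (rotL d) (dbl i) (dbl j)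
θθ-lin d i j = trans (go d) (cong₂ (λ x y → scale x (unit (rotL d)) ⊕ scale y (unit (rotL (rotL d))))
  (sym (dbl-*2 i)) (sym (dbl-*2 j)))
  where
  go : ∀ d → θ (θ (scale (+ i) (unit d) ⊕ scale (+ j) (unit (rotL d)))) ≡ scale (+ i * + 2) (unit (rotL d)) ⊕ scale
    (+ j * + 2) (unit (rotL (rotL d)))
  go E = cong₂ _,_ (l₁ (+ i) (+ j)) (l₂ (+ i) (+ j))
    where
    l₁ : ∀ i j → i * + 1 + j * + 0 - (i * + 0 + j * + 1) - (i * + 1 + j * + 0 + (i * + 0 + j * + 1)) ≡
      i * + 2 * + 0 + j * + 2 * - + 1
    l₁ = solve-∀
    l₂ : ∀ i j → i * + 1 + j * + 0 - (i * + 0 + j * + 1) + (i * + 1 + j * + 0 + (i * + 0 + j * + 1)) ≡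
      i * + 2 * + 1 + j * + 2 * + 0
    l₂ = solve-∀
  go N = cong₂ _,_ (l₁ (+ i) (+ j)) (l₂ (+ i) (+ j))
    where
    l₁ : ∀ i j → i * + 0 + j * - + 1 - (i * + 1 + j * + 0) - (i * + 0 + j * - + 1 + (i * + 1 + j * + 0)) ≡
      i * + 2 * - + 1 + j * + 2 * + 0
    l₁ = solve-∀
    l₂ : ∀ i j → i * + 0 + j * - + 1 - (i * + 1 + j * + 0) + (i * + 0 + j * - + 1 + (i * + 1 + j * + 0)) ≡
      i * + 2 * + 0 + j * + 2 * - + 1
    l₂ = solve-∀
  go W = cong₂ _,_ (l₁ (+ i) (+ j)) (l₂ (+ i) (+ j))
    where
    l₁ : ∀ i j → i * - + 1 + j * + 0 - (i * + 0 + j * - + 1) - (i * - + 1 + j * + 0 + (i * + 0 + j * - + 1)) ≡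
      i * + 2 * + 0 + j * + 2 * + 1
    l₁ = solve-∀
    l₂ : ∀ i j → i * - + 1 + j * + 0 - (i * + 0 + j * - + 1) + (i * - + 1 + j * + 0 + (i * + 0 + j * - + 1)) ≡
      i * + 2 * - + 1 + j * + 2 * + 0
    l₂ = solve-∀
  go S = cong₂ _,_ (l₁ (+ i) (+ j)) (l₂ (+ i) (+ j))
    where
    l₁ : ∀ i j → i * + 0 + j * + 1 - (i * - + 1 + j * + 0) - (i * + 0 + j * + 1 + (i * - + 1 + j * + 0)) ≡
      i * + 2 * + 1 + j * + 2 * + 0
    l₁ = solve-∀
    l₂ : ∀ i j → i * + 0 + j * + 1 - (i * - + 1 + j * + 0) + (i * + 0 + j * + 1 + (i * - + 1 + j * + 0)) ≡
      i * + 2 * + 0 + j * + 2 * + 1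
    l₂ = solve-∀

-- Applying θ twice multiplies by 2i. Vertices with two even coordinates are old vertices kept
-- twice; those with two odd ones are centres of old unit squares, kept once; the mixed ones are
-- centres of unit squares of D with images of old neighbours as diagonal corners.
double-square : ∀ {C} (fc : FoldCurve C) {m} → FullSquare (Parent.D (Parent.fold-D fc)) m → FullSquare C (dbl m)
double-square {C} fc {m} sq = record { s = o ⊕ θ (o₁ ⊕ θ s) ; d = rotL d ; isFull = isF }
  where
  open Parent fc
  module P₁ = Parent fold-D
  o₁ = P₁.o
  open FullSquare sq
  base = o ⊕ θ (o₁ ⊕ θ s)
  A : ℕ → ℕ → Point
  A i j = o₁ ⊕ θ (s ⊕ lin d i j)
  A-full : ∀ i j → i ℕ.≤ m → j ℕ.≤ m → Full D (A i j)
  A-full i j i≤ j≤ = P₁.keep (isFull i j i≤ j≤)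
  B-full : ∀ i j → suc i ℕ.≤ m → suc j ℕ.≤ m → Full D (o₁ ⊕ (θ (s ⊕ lin d i j) ⊕ unit (rotL d)))
  B-full i j i< j< = P₁.center-diag (s ⊕ lin d i j) d (isFull i j (ℕP.<⇒≤ i<) (ℕP.<⇒≤ j<))
    (subst (Full _) (trans
      (cong (s ⊕_) (trans (lin-suc₂ d (suc i) j) (trans (cong (_⊕ unit (rotL d)) (lin-suc₁ d i j))
      (⊕-assoc (lin d i j) (unit d) (unit (rotL d))))))
      (sym (⊕-assoc s (lin d i j) (unit d ⊕ unit (rotL d))))) (isFull (suc i) (suc j) i< j<))
  A-shift : ∀ i j w → θ (s ⊕ (lin d i j ⊕ w)) ≡ θ (s ⊕ lin d i j) ⊕ θ w
  A-shift i j w = trans (cong θ (sym (⊕-assoc s (lin d i j) w))) (θ-⊕ (s ⊕ lin d i j) w)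
  A-suc₁ : ∀ i j → A (suc i) j ≡ A i j ⊕ (unit d ⊕ unit (rotL d))
  A-suc₁ i j = trans (cong (o₁ ⊕_) (trans (cong (λ v → θ (s ⊕ v)) (lin-suc₁ d i j))
    (trans (A-shift i j (unit d)) (cong (θ (s ⊕ lin d i j) ⊕_) (θ-unit d)))))
    (sym (⊕-assoc o₁ (θ (s ⊕ lin d i j)) (unit d ⊕ unit (rotL d))))
  A-suc₂ : ∀ i j → A i (suc j) ≡ A i j ⊕ (unit (rotL d) ⊕ unit (rotL (rotL d)))
  A-suc₂ i j = trans (cong (o₁ ⊕_) (trans (cong (λ v → θ (s ⊕ v)) (lin-suc₂ d i j))
    (trans (A-shift i j (unit (rotL d))) (cong (θ (s ⊕ lin d i j) ⊕_) (θ-unit (rotL d))))))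
    (sym (⊕-assoc o₁ (θ (s ⊕ lin d i j)) (unit (rotL d) ⊕ unit (rotL (rotL d)))))
  θA : ∀ i j → o ⊕ θ (A i j) ≡ base ⊕ lin (rotL d) (dbl i) (dbl j)
  θA i j = trans (cong (o ⊕_) (begin
      θ (o₁ ⊕ θ (s ⊕ v))            ≡⟨ cong (λ z → θ (o₁ ⊕ z)) (θ-⊕ s v) ⟩
      θ (o₁ ⊕ (θ s ⊕ θ v))          ≡⟨ cong θ (sym (⊕-assoc o₁ (θ s) (θ v))) ⟩
      θ ((o₁ ⊕ θ s) ⊕ θ v)          ≡⟨ θ-⊕ (o₁ ⊕ θ s) (θ v) ⟩
      θ (o₁ ⊕ θ s) ⊕ θ (θ v)        ≡⟨ cong (θ (o₁ ⊕ θ s) ⊕_) (θθ-lin d i j) ⟩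
      θ (o₁ ⊕ θ s) ⊕ lin (rotL d) (dbl i) (dbl j) ∎)) (sym (⊕-assoc o (θ (o₁ ⊕ θ s)) _))
    where
    open ≡-Reasoning
    v = lin d i j
  θA-shift : ∀ i j w → o ⊕ (θ (A i j) ⊕ w) ≡ base ⊕ (lin (rotL d) (dbl i) (dbl j) ⊕ w)
  θA-shift i j w = trans (sym (⊕-assoc o (θ (A i j)) w)) (trans (cong (_⊕ w) (θA i j)) (⊕-assoc base _ w))
  isF : ∀ u v → u ℕ.≤ dbl m → v ℕ.≤ dbl m → Full C (base ⊕ lin (rotL d) u v)
  isF u v u≤ v≤ with halve u | halve v
  ... | i , inj₁ refl | j , inj₁ refl = subst (Full C) (θA i j) (keep (A-full i j (dbl-≤⁻¹ i m u≤) (dbl-≤⁻¹ j m v≤)))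
  ... | i , inj₂ refl | j , inj₁ refl = subst (Full C) (trans (θA-shift i j (unit (rotL d)))
    (cong (base ⊕_) (sym (lin-suc₁ (rotL d) (dbl i) (dbl j)))))
    (center-diag (A i j) d (A-full i j (ℕP.<⇒≤ (dbl-<⁻¹ i m u≤)) (dbl-≤⁻¹ j m v≤))
      (subst (Full D) (A-suc₁ i j) (A-full (suc i) j (dbl-<⁻¹ i m u≤) (dbl-≤⁻¹ j m v≤))))
  ... | i , inj₁ refl | j , inj₂ refl = subst (Full C) (trans (θA-shift i j (unit (rotL (rotL d))))
    (cong (base ⊕_) (sym (lin-suc₂ (rotL d) (dbl i) (dbl j)))))
    (center-diag (A i j) (rotL d) (A-full i j (dbl-≤⁻¹ i m u≤) (ℕP.<⇒≤ (dbl-<⁻¹ j m v≤)))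
      (subst (Full D) (A-suc₂ i j) (A-full i (suc j) (dbl-≤⁻¹ i m u≤) (dbl-<⁻¹ j m v≤))))
  ... | i , inj₂ refl | j , inj₂ refl = subst (Full C)
    (trans (cong (λ z → o ⊕ θ z) (sym (⊕-assoc o₁ (θ (s ⊕ lin d i j)) (unit (rotL d)))))
      (trans (cong (o ⊕_) (trans (θ-⊕ (A i j) (unit (rotL d))) (cong (θ (A i j) ⊕_) (θ-unit (rotL d)))))
        (trans (θA-shift i j (unit (rotL d) ⊕ unit (rotL (rotL d))))
          (cong (base ⊕_) (sym (trans (lin-suc₂ (rotL d) (suc (dbl i)) (dbl j))
            (trans (cong (_⊕ unit (rotL (rotL d))) (lin-suc₁ (rotL d) (dbl i) (dbl j)))
            (⊕-assoc (lin (rotL d) (dbl i) (dbl j)) (unit (rotL d)) (unit (rotL (rotL d)))))))))))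
    (keep (B-full i j (dbl-<⁻¹ i m u≤) (dbl-<⁻¹ j m v≤)))

side-length : ℕ → ℕ
side-length zero = 1
side-length (suc k) = dbl (side-length k)

opaque
  full-squares : ∀ k {C} → FoldCurve C → FullSquare C (side-length k)
  -- The triple is taken on the third derivative: one step back to a pair, one to a corner, one to a
  -- square.
  full-squares zero fc = corner⇒square fc
    (pair⇒corner (Parent.fold-D fc) (adjacentPair (Parent.fold-D (Parent.fold-D fc))))
  full-squares (suc k) fc = double-square fc (full-squares k (Parent.fold-D (Parent.fold-D fc)))

-- From local isomorphism to equal invariants

-- Multiplication by -i, which turns (1 + i)^2 = 2i into 2.
rotate : Point → Point
rotate (x , y) = (y , - x)

θ-rotate : ∀ p → θ (rotate p) ≡ rotate (θ p)
θ-rotate (x , y) = cong₂ _,_ (l₁ x y) (l₂ x y)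
  where
  l₁ : ∀ x y → y - - x ≡ x + y
  l₁ = solve-∀
  l₂ : ∀ x y → y + - x ≡ - (x - y)
  l₂ = solve-∀

Λ-rotate : ∀ {n p} → Λ n p → Λ n (rotate p)
Λ-rotate Λ-all = Λ-all
Λ-rotate (Λ-θ {n} {q} l) = subst (Λ (suc n)) (θ-rotate q) (Λ-θ (Λ-rotate l))

Λ-twice : ∀ {n} p → Λ n p → Λ (suc (suc n)) (scale (+ 2) p)
Λ-twice {n} p@(x , y) l = subst (Λ (suc (suc n))) (cong₂ _,_ (l₁ x y) (l₂ x y)) (Λ-θ (Λ-θ (Λ-rotate l)))
  where
  l₁ : ∀ x y → y - - x - (y + - x) ≡ + 2 * x
  l₁ = solve-∀
  l₂ : ∀ x y → y - - x + (y + - x) ≡ + 2 * y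
  l₂ = solve-∀

Λ-twice⁻¹ : ∀ {n p} → Λ (suc (suc n)) p → Σ Point λ q → p ≡ scale (+ 2) q × Λ n q
Λ-twice⁻¹ {n} (Λ-θ (Λ-θ {q = q@(x , y)} l)) = (+ 0 , + 0) ⊖ rotate q , cong₂ _,_ (l₁ x y) (l₂ x y) , Λ-⊖
  (Λ-origin n) (Λ-rotate l)
  where
  l₁ : ∀ x y → x - y - (x + y) ≡ + 2 * (+ 0 - y)
  l₁ = solve-∀
  l₂ : ∀ x y → x - y + (x + y) ≡ + 2 * (+ 0 - - x)
  l₂ = solve-∀

-- `InΛ` with the generators as an argument, so that they can be rewritten without meeting its
-- `with`.
Span : Point × Point → Point → Set
Span (g , g') p = Σ ℤ λ a → Σ ℤ λ b → p ≡ scale a g ⊕ scale b g'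

InΛ⇒Span : ∀ n p → InΛ n p → Span (gens n) p
InΛ⇒Span n p l with gens n
... | (g , g') = l

Span⇒InΛ : ∀ n p → Span (gens n) p → InΛ n p
Span⇒InΛ n p l with gens n
... | (g , g') = l

gens-twice : ∀ n → gens (suc (suc n)) ≡ (scale (+ 2) (proj₁ (gens n)) , scale (+ 2) (proj₂ (gens n)))
gens-twice n with gens n
... | (g , g') = refl

scale-twice : ∀ a b g g' → scale a (scale (+ 2) g) ⊕ scale b (scale (+ 2) g') ≡ scale (+ 2) (scale a g ⊕ scale b g')
scale-twice a b (x , y) (z , w) = cong₂ _,_ (lem a b x z) (lem a b y w)
  where
  lem : ∀ a b x z → a * (+ 2 * x) + b * (+ 2 * z) ≡ + 2 * (a * x + b * z)
  lem = solve-∀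

Span⇒Λ : ∀ n p → Span (gens n) p → Λ n p
Span⇒Λ zero p _ = Λ-all
Span⇒Λ (suc zero) p (a , b , e) = subst (Λ 1) (sym (trans e (cong₂ _,_ (l₁ a b) (l₂ a b)))) (Λ-θ {q = a , - b} Λ-all)
  where
  l₁ : ∀ a b → a * + 1 + b * + 1 ≡ a - - b
  l₁ = solve-∀
  l₂ : ∀ a b → a * + 1 + b * - + 1 ≡ a + - b
  l₂ = solve-∀
Span⇒Λ (suc (suc n)) p sp with subst (λ g → Span g p) (gens-twice n) sp
... | a , b , e = subst (Λ (suc (suc n))) (sym (trans e (scale-twice a b _ _)))
  (Λ-twice _ (Span⇒Λ n _ (a , b , refl)))

Λ⇒Span : ∀ n p → Λ n p → Span (gens n) p
Λ⇒Span zero (x , y) _ = x , y , cong₂ _,_ (l₁ x y) (l₂ x y)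
  where
  l₁ : ∀ x y → x ≡ x * + 1 + y * + 0
  l₁ = solve-∀
  l₂ : ∀ x y → y ≡ x * + 0 + y * + 1
  l₂ = solve-∀
Λ⇒Span (suc zero) _ (Λ-θ {q = x , y} _) = x , - y , cong₂ _,_ (l₁ x y) (l₂ x y)
  where
  l₁ : ∀ a b → a - b ≡ a * + 1 + - b * + 1
  l₁ = solve-∀
  l₂ : ∀ a b → a + b ≡ a * + 1 + - b * - + 1
  l₂ = solve-∀
Λ⇒Span (suc (suc n)) p l with Λ-twice⁻¹ l
... | q , refl , lq with Λ⇒Span n q lq
... | a , b , e = subst (λ g → Span g p) (sym (gens-twice n)) (a , b , trans (cong (scale (+ 2)) e)
  (sym (scale-twice a b _ _)))

InΛ⇒Λ : ∀ n p → InΛ n p → Λ n p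
InΛ⇒Λ n p l = Span⇒Λ n p (InΛ⇒Span n p l)

Λ⇒InΛ : ∀ n p → Λ n p → InΛ n p
Λ⇒InΛ n p l = Span⇒InΛ n p (Λ⇒Span n p l)

shift : Point → Segment → Segment
shift v s = seg (start s ⊕ v) (dir s)

⊕-swapʳ : ∀ p q r → (p ⊕ q) ⊕ r ≡ (p ⊕ r) ⊕ q
⊕-swapʳ p q r = trans (⊕-assoc p q r) (trans (cong (p ⊕_) (⊕-comm q r)) (sym (⊕-assoc p r q)))

finish-shift : ∀ v s → finish (shift v s) ≡ finish s ⊕ v
finish-shift v s = ⊕-swapʳ (start s) v (unit (dir s))

support-shift : ∀ v s → support (shift v s) ≡ translateE v (support s)
support-shift v (seg p E) = refl
support-shift v (seg p N) = refl
support-shift v (seg p W) = cong (_, hor) (⊕-swapʳ p v (unit W))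
support-shift v (seg p S) = cong (_, ver) (⊕-swapʳ p v (unit S))

support-opp : ∀ p d → support (seg (p ⊕ unit d) (opp d)) ≡ support (seg p d)
support-opp p E = cong (_, hor) (trans (⊕-assoc p (unit E) (unit W)) (⊕-identityʳ p))
support-opp p N = cong (_, ver) (trans (⊕-assoc p (unit N) (unit S)) (⊕-identityʳ p))
support-opp p W = refl
support-opp p S = refl

cov⇒support : ∀ {C q d} → Cov C q d → Σ ℤ λ i → support (C i) ≡ support (seg q d)
cov⇒support (out i refl refl) = i , refl
cov⇒support {C} {d = d} (into i refl f) = i , trans (sym (support-opp (start (C i)) (dir (C i))))
  (cong (λ x → support (seg (finish (C i)) x)) (trans (cong opp f) (opp-opp d)))

dec : Curve → ℤ → DecSeg
dec C i = dseg (support (C (i - + 1))) (C i) (support (C (i + + 1)))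

foldCurve : ∀ {C} → CompleteFoldingCurve C → FoldCurve C
foldCurve ((conn , perp , _) , cfs) = record { conn = conn ; perp = perp ; cfs = cfs }

square-root-≤ : ∀ a b r → a ℕ.* a ℕ.+ b ℕ.≤ r ℕ.* r → a ℕ.≤ r
square-root-≤ a b r p with a ℕP.≤? r
... | yes q = q
... | no q = ⊥-elim (ℕP.<⇒≱ (ℕP.*-mono-< (ℕP.≰⇒> q) (ℕP.≰⇒> q)) (ℕP.≤-trans (ℕP.m≤m+n (a ℕ.* a) b) p))

centred : ∀ r x → ∣ x ∣ ℕ.≤ r → Σ ℕ λ i → + i ≡ + r + x × i ℕ.≤ r ℕ.+ r
centred r (+ n) p = r ℕ.+ n , refl , ℕP.+-monoʳ-≤ r p
centred r -[1+ n ] p = r ℕ.∸ suc n , sym (ℤP.⊖-≥ p) , ℕP.≤-trans (ℕP.m∸n≤m r (suc n)) (ℕP.m≤m+n r r)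

-- The square of side 2r with the same centre bounds the disk; its frame may point in any of the
-- four directions, which permutes and reflects the coordinates.
disk-in-square : ∀ s d r p → InDisk (s ⊕ lin d r r) r p →
  Σ ℕ λ i → Σ ℕ λ j → i ℕ.≤ r ℕ.+ r × j ℕ.≤ r ℕ.+ r × p ≡ s ⊕ lin d i j
disk-in-square s@(sx , sy) d r p@(px , py) dk = go d refl
  where
  c = s ⊕ lin d r r
  x = px - proj₁ c
  y = py - proj₂ c
  ∣x∣≤ : ∣ x ∣ ℕ.≤ r
  ∣x∣≤ = square-root-≤ ∣ x ∣ (sq y) r dk
  ∣y∣≤ : ∣ y ∣ ℕ.≤ r
  ∣y∣≤ = square-root-≤ ∣ y ∣ (sq x) r (ℕP.≤-trans (ℕP.≤-reflexive (ℕP.+-comm (sq y) (sq x))) dk)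
  +x = centred r x ∣x∣≤
  +y = centred r y ∣y∣≤
  -x = centred r (- x) (ℕP.≤-trans (ℕP.≤-reflexive (ℤP.∣-i∣≡∣i∣ x)) ∣x∣≤)
  -y = centred r (- y) (ℕP.≤-trans (ℕP.≤-reflexive (ℤP.∣-i∣≡∣i∣ y)) ∣y∣≤)
  Goal = Σ ℕ λ i → Σ ℕ λ j → i ℕ.≤ r ℕ.+ r × j ℕ.≤ r ℕ.+ r × p ≡ s ⊕ lin d i j
  mk : (A B : Σ ℤ λ z → Σ ℕ λ i → + i ≡ + r + z × i ℕ.≤ r ℕ.+ r) →
    p ≡ s ⊕ (scale (+ r + proj₁ A) (unit d) ⊕ scale (+ r + proj₁ B) (unit (rotL d))) → Goal
  mk (z , i , ei , i≤) (w , j , ej , j≤) e = i , j , i≤ , j≤ ,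
    trans e (cong₂ (λ a b → s ⊕ (scale a (unit d) ⊕ scale b (unit (rotL d)))) (sym ei) (sym ej))
  go : ∀ e → d ≡ e → Goal
  go E refl = mk (x , +x) (y , +y) (cong₂ _,_ (l₁ sx (+ r) px (+ r + y)) (l₂ sy (+ r) py (+ r + x)))
    where
    l₁ : ∀ s r p z → p ≡ s + ((r + (p - (s + (r * + 1 + r * + 0)))) * + 1 + z * + 0)
    l₁ = solve-∀
    l₂ : ∀ s r p z → p ≡ s + (z * + 0 + (r + (p - (s + (r * + 0 + r * + 1)))) * + 1)
    l₂ = solve-∀
  go N refl = mk (y , +y) (- x , -x) (cong₂ _,_ (l₁ sx (+ r) px (+ r + y)) (l₂ sy (+ r) py (+ r + - x)))
    where
    l₁ : ∀ s r p z → p ≡ s + (z * + 0 + (r + - (p - (s + (r * + 0 + r * - + 1)))) * - + 1)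
    l₁ = solve-∀
    l₂ : ∀ s r p z → p ≡ s + ((r + (p - (s + (r * + 1 + r * + 0)))) * + 1 + z * + 0)
    l₂ = solve-∀
  go W refl = mk (- x , -x) (- y , -y) (cong₂ _,_ (l₁ sx (+ r) px (+ r + - y)) (l₂ sy (+ r) py (+ r + - x)))
    where
    l₁ : ∀ s r p z → p ≡ s + ((r + - (p - (s + (r * - + 1 + r * + 0)))) * - + 1 + z * + 0)
    l₁ = solve-∀
    l₂ : ∀ s r p z → p ≡ s + (z * + 0 + (r + - (p - (s + (r * + 0 + r * - + 1)))) * - + 1)
    l₂ = solve-∀
  go S refl = mk (- y , -y) (x , +x) (cong₂ _,_ (l₁ sx (+ r) px (+ r + - y)) (l₂ sy (+ r) py (+ r + x)))
    where
    l₁ : ∀ s r p z → p ≡ s + (z * + 0 + (r + (p - (s + (r * + 0 + r * + 1)))) * + 1)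
    l₁ = solve-∀
    l₂ : ∀ s r p z → p ≡ s + ((r + - (p - (s + (r * - + 1 + r * + 0)))) * - + 1 + z * + 0)
    l₂ = solve-∀

dbl-mono : ∀ {m n} → m ℕ.≤ n → dbl m ℕ.≤ dbl n
dbl-mono z≤n = z≤n
dbl-mono (s≤s p) = s≤s (s≤s (dbl-mono p))

m≤dbl : ∀ m → m ℕ.≤ dbl m
m≤dbl zero = z≤n
m≤dbl (suc m) = s≤s (ℕP.≤-trans (m≤dbl m) (ℕP.n≤1+n _))

side-length-large : ∀ k → suc k ℕ.≤ side-length k
side-length-large zero = ℕP.≤-refl
side-length-large (suc k) = ℕP.≤-trans (s≤s (s≤s (m≤dbl k))) (dbl-mono (side-length-large k))

OnE-exists : ∀ n a → CompleteFoldingSeq a → Σ ℤ (OnE a n)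
OnE-exists zero a cfs = + 0 , OnE₀ cfs (+ 0)
OnE-exists (suc n) a cfs with derive a cfs
... | h , lh , cfsb with OnE-exists n (derivedSeq a h) cfsb
... | k , oe = h + k * + 2 + + 1 , Derivation.OnE-lift a h lh oe

record Copy (C C' : Curve) (v : Point) (i : ℤ) (m : ℕ) : Set where
  field
    j    : ℤ
    copy : ∀ k → k ℕ.≤ m → C' (j + + k) ≡ shift v (C (i + + k))

  copy₀ : C' j ≡ shift v (C i)
  copy₀ = trans (cong C' (sym (ℤP.+-identityʳ j)))
    (trans (copy 0 z≤n) (cong (λ z → shift v (C z)) (ℤP.+-identityʳ i)))

  copy-agree : Agree (assoc C) i (assoc C') j m
  copy-agree = agree λ k k<m → sym (cong₂ turn (cong dir (copy k (ℕP.<⇒≤ k<m)))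
    (cong dir (trans (cong C' (suc-index j k))
      (trans (copy (suc k) k<m) (cong (λ z → shift v (C z)) (sym (suc-index i k)))))))
    where
    suc-index : ∀ j k → j + + k + + 1 ≡ j + + suc k
    suc-index j k = trans (ℤP.+-assoc j (+ k) (+ 1)) (cong (λ z → j + + z) (ℕP.+-comm k 1))

  copy-finish : finish (C' j) ≡ finish (C i) ⊕ v
  copy-finish = trans (cong finish copy₀) (finish-shift v (C i))

module Forward (𝒞 : CurveSet) (cv : Covering 𝒞) (lip : LocalIsoProperty 𝒞) where
  private
    folds = proj₁ cv
    cover = proj₁ (proj₂ cv)
    uniq  = proj₂ (proj₂ cv)

  fold : ∀ {C} → 𝒞 C → FoldCurve C
  fold {C} c = foldCurve (folds C c)

  -- One `v` serves both pieces, so it cancels when their positions are compared. The disk is placed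
  -- inside a square of full vertices of C', hence every translated segment has its support on C',
  -- and uniqueness in the covering makes it a segment of C'.
  find-copies : ∀ {C C'} → 𝒞 C → 𝒞 C' → ∀ i i' m → Σ Point λ v → Copy C C' v i m × Copy C' C' v i' m
  find-copies {C} {C'} c c' i i' m = found (lip F all-F)
    where
    F = applyUpTo (λ k → dec C (i + + k)) (suc m) ++ applyUpTo (λ k → dec C' (i' + + k)) (suc m)
    all-F : All (IsDecSeg 𝒞) F
    all-F = AllP.++⁺ (AllP.applyUpTo⁺₂ _ (suc m) (λ k → C , i + + k , c , refl))
      (AllP.applyUpTo⁺₂ _ (suc m) (λ k → C' , i' + + k , c' , refl))

    Found = Σ Point λ v → Copy C C' v i m × Copy C' C' v i' m

    module At (r : ℕ) (sq : FullSquare C' (side-length (r ℕ.+ r))) where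
      open FullSquare sq renaming (d to e)
      ctr = s ⊕ lin e r r

      locate : ∀ v {X} x → IsDecSeg 𝒞 (translateD v (dec X x)) → DecInDisk ctr r (translateD v (dec X x)) →
        Σ ℤ λ j → (C' j ≡ shift v (X x)) × (support (C' (j + + 1)) ≡ translateE v (support (X (x + + 1))))
      locate v {X} x (C″ , i″ , c″ , eq) (dk , _) with disk-in-square s e r (start (X x) ⊕ v) dk
      ... | a , b , a≤ , b≤ , p≡ with cov⇒support
        (full⇒cov (fold c') (subst (Full C') (sym p≡) (isFull a b (bound a≤) (bound b≤))) (dir (X x)))
        where
        bound : ∀ {n} → n ℕ.≤ r ℕ.+ r → n ℕ.≤ side-length (r ℕ.+ r)
        bound p = ℕP.≤-trans p (ℕP.<⇒≤ (side-length-large (r ℕ.+ r)))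
      ... | j , sj = j , trans at₀ (sym (cong DecSeg.theSeg eq)) , trans (cong support (same (+ 1)))
        (sym (cong DecSeg.nextSupp eq))
        where
        same : SameSeg C' j C″ i″
        same = uniq (support (shift v (X x))) C' j C″ i″ c' c″ sj (cong support (sym (cong DecSeg.theSeg eq)))
        at₀ : C' j ≡ C″ i″
        at₀ = trans (cong C' (sym (ℤP.+-identityʳ j))) (trans (same (+ 0)) (cong C″ (ℤP.+-identityʳ i″)))

      chain : ∀ v {X} x → (∀ k → k ℕ.< suc m → IsDecSeg 𝒞 (translateD v (dec X (x + + k))) × DecInDisk ctr r
        (translateD v (dec X (x + + k)))) →
        Copy X C' v x m
      chain v {X} x ds = record { j = pos₀ 0 z≤n ; copy = λ k k≤ → trans (cong C' (sym (pos-+ k k≤)))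
        (proj₁ (proj₂ (at-k k k≤))) }
        where
        at-k : ∀ k → k ℕ.≤ m → _
        at-k k k≤ = locate v {X} (x + + k) (proj₁ (ds k (s≤s k≤))) (proj₂ (ds k (s≤s k≤)))
        pos₀ : ∀ k → k ℕ.≤ m → ℤ
        pos₀ k k≤ = proj₁ (at-k k k≤)
        -- The decoration names the support of the successor; as supports on C' are distinct,
        -- consecutive segments get consecutive indices.
        pos-suc : ∀ k (k< : suc k ℕ.≤ m) (k≤ : k ℕ.≤ m) → pos₀ (suc k) k< ≡ pos₀ k k≤ + + 1
        pos-suc k k< k≤ = sym (proj₂ (proj₂ (proj₁ (folds C' c'))) _ _
          (trans (proj₂ (proj₂ (at-k k k≤)))
            (trans (cong (λ z → translateE v (support (X z)))
            (trans (ℤP.+-assoc x (+ k) (+ 1)) (cong (λ z → x + + z) (ℕP.+-comm k 1))))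
            (trans (sym (support-shift v (X (x + + suc k))))
              (cong support (sym (proj₁ (proj₂ (at-k (suc k) k<)))))))))
        pos-+ : ∀ k (k≤ : k ℕ.≤ m) → pos₀ k k≤ ≡ pos₀ 0 z≤n + + k
        pos-+ zero z≤n = sym (ℤP.+-identityʳ (pos₀ 0 z≤n))
        pos-+ (suc k) k< = trans (pos-suc k k< (ℕP.<⇒≤ k<)) (trans (cong (_+ + 1) (pos-+ k (ℕP.<⇒≤ k<)))
          (trans (ℤP.+-assoc (pos₀ 0 z≤n) (+ k) (+ 1)) (cong (λ z → pos₀ 0 z≤n + + z) (ℕP.+-comm k 1))))

      result : (Σ Point λ v → All (λ d → IsDecSeg 𝒞 d × DecInDisk ctr r d) (map (translateD v) F)) → Found
      result (v , al) = v ,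
        chain v i (λ k k< → All.lookup al
          (∈-map⁺ (translateD v) (∈-++⁺ˡ (∈-applyUpTo⁺ (λ k → dec C (i + + k)) k<)))) ,
        chain v i' (λ k k< → All.lookup al
          (∈-map⁺ (translateD v) (∈-++⁺ʳ (applyUpTo (λ k → dec C (i + + k)) (suc m))
          (∈-applyUpTo⁺ (λ k → dec C' (i' + + k)) k<))))

    found : (Σ ℕ λ r → (0 ℕ.< r) × (∀ ctr → Σ Point λ v → All (λ d → IsDecSeg 𝒞 d × DecInDisk ctr r d)
      (map (translateD v) F))) → Found
    found (r , _ , place) = At.result r big (place (At.ctr r big))
      where big = full-squares (r ℕ.+ r) (fold c')

  opaque
    copies : ∀ {C C'} → 𝒞 C → 𝒞 C' → ∀ i i' m → Σ Point λ v → Copy C C' v i m × Copy C' C' v i' m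
    copies = find-copies

  loc-iso : ∀ {C C'} → 𝒞 C → 𝒞 C' → LocIso (assoc C) (assoc C')
  loc-iso {C} {C'} c c' = one c c' , one c' c
    where
    one : ∀ {C C'} → 𝒞 C → 𝒞 C' → ∀ h m → Σ ℤ λ h' → window (assoc C) h m ≡ window (assoc C') h' m
    one c c' h m with copies c c' h h m
    ... | v , cp , _ = Copy.j cp , agree⇒window (Copy.copy-agree cp)

  -- Windows of length `detect k` recognise E_k, so both copies end on E_k(C'). Their ends differ by
  -- an element of Λ_k, and `v` cancels.
  same-E : ∀ {C C'} → 𝒞 C → 𝒞 C' → ∀ k p → InEC C k p → InEC C' k p
  same-E {C} {C'} c c' k p (i , ie , l) with OnE-exists k (assoc C') (FoldCurve.cfs (fold c'))
  ... | i' , oe' with copies c c' i i' (detect k)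
  ... | v , cp , cp' = i' , OnE⇒InE oe' , Λ⇒InΛ k _ (Λ-telescope p (finish (C i)) (finish (C' i')) (InΛ⇒Λ k _ l)
    (subst (Λ k) (trans (cong₂ _⊖_ (trans (Copy.copy-finish cp) (⊕-comm (finish (C i)) v))
      (trans (Copy.copy-finish cp') (⊕-comm (finish (C' i')) v))) (⊖-cancelˡ v (finish (C i)) (finish (C' i'))))
      (E-points k (fold c') (agree-OnE k (FoldCurve.cfs (fold c)) (FoldCurve.cfs (fold c')) (Copy.copy-agree cp)
        (InE⇒OnE ie))
        (agree-OnE k (FoldCurve.cfs (fold c')) (FoldCurve.cfs (fold c')) (Copy.copy-agree cp') oe'))))

  -- Translation keeps directions, and on C' indices of E_1 differ by even numbers, which keep the
  -- orientation.
  same-orient : ∀ {C C'} → 𝒞 C → 𝒞 C' → ∀ i i' → OnE (assoc C) 1 i → OnE (assoc C') 1 i' → orient (dir (C i)) ≡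
    orient (dir (C' i'))
  same-orient {C} {C'} c c' i i' oe oe' with copies c c' i i (detect 1)
  ... | v , cp , _ with OnE-unique 1 (assoc C') (FoldCurve.cfs (fold c')) (Copy.j cp) i'
    (agree-OnE 1 (FoldCurve.cfs (fold c)) (FoldCurve.cfs (fold c')) (Copy.copy-agree cp) oe) oe'
  ... | k , ej = orientSgn-inj (dir (C i)) (dir (C' i')) (trans (cong orientSgn (sym (cong dir (Copy.copy₀ cp))))
    (trans (cong (λ z → orientSgn (dir (C' z))) ej) (trans (FoldCurve.orient-alt (fold c') i' (k * + 2))
      (alt-even k _))))

  same-type-etc : SameTypeEtc 𝒞
  same-type-etc = types , (λ C C' c c' k p → same-E c c' k p , same-E c' c k p) , (λ C C' c c' → loc-iso c c')
    where
    Types = (∀ C → 𝒞 C → TypeH C) ⊎ (∀ C → 𝒞 C → TypeV C)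
    from : ∀ {C₁} → 𝒞 C₁ → Σ ℤ (OnE (assoc C₁) 1) → Types
    from {C₁} c₁ (i₁ , oe₁) = go (orient (dir (C₁ i₁))) refl
      where
      go : ∀ o → orient (dir (C₁ i₁)) ≡ o → Types
      go hor eq = inj₁ (λ C c i ie → trans (same-orient c c₁ i i₁ (InE⇒OnE ie) oe₁) eq)
      go ver eq = inj₂ (λ C c i ie → trans (same-orient c c₁ i i₁ (InE⇒OnE ie) oe₁) eq)
    types : Types
    types = let (C₁ , _ , c₁ , _) = cover ((+ 0 , + 0) , hor) in
      from c₁ (OnE-exists 1 (assoc C₁) (FoldCurve.cfs (fold c₁)))

-- From equal invariants to local isomorphism

pow2-suc-* : ∀ m x → + 2 * (pow2 m * x) ≡ pow2 (suc m) * x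
pow2-suc-* m x = trans (sym (ℤP.*-assoc (+ 2) (pow2 m) x)) (cong (_* x) (sym (pow2-suc m)))

Λ-pow2 : ∀ m q → Λ (dbl m) (scale (pow2 m) q)
Λ-pow2 zero q = Λ-all
Λ-pow2 (suc m) q@(x , y) = subst (Λ (dbl (suc m))) (cong₂ _,_ (pow2-suc-* m x) (pow2-suc-* m y))
  (Λ-twice (scale (pow2 m) q) (Λ-pow2 m q))

Λ-pow2⁻¹ : ∀ m {p} → Λ (dbl m) p → Σ Point λ q → p ≡ scale (pow2 m) q
Λ-pow2⁻¹ zero {x , y} _ = (x , y) , cong₂ _,_ (sym (ℤP.*-identityˡ x)) (sym (ℤP.*-identityˡ y))
Λ-pow2⁻¹ (suc m) l with Λ-twice⁻¹ l
... | r , refl , lr with Λ-pow2⁻¹ m lr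
... | q@(x , y) , refl = q , cong₂ _,_ (pow2-suc-* m x) (pow2-suc-* m y)

norm : Point → ℕ
norm (x , y) = ∣ x ∣ ℕ.+ ∣ y ∣

n<2^n : ∀ n → n ℕ.< 2 ℕ.^ n
n<2^n zero = s≤s z≤n
n<2^n (suc n) = ℕP.≤-trans (s≤s (n<2^n n))
  (ℕP.+-mono-≤ (ℕP.m^n>0 2 n) (ℕP.≤-trans (ℕP.≤-refl {2 ℕ.^ n}) (ℕP.m≤m+n (2 ℕ.^ n) 0)))

small-multiple : ∀ m q → ∣ pow2 m * q ∣ ℕ.< 2 ℕ.^ m → pow2 m * q ≡ + 0
small-multiple m (+ zero) _ = ℤP.*-zeroʳ (pow2 m)
small-multiple m (+ suc n) p = ⊥-elim
  (ℕP.<⇒≱ p (ℕP.≤-trans (ℕP.m≤m*n (2 ℕ.^ m) (suc n)) (ℕP.≤-reflexive (sym (ℤP.abs-* (pow2 m) (+ suc n))))))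
small-multiple m -[1+ n ] p = ⊥-elim
  (ℕP.<⇒≱ p (ℕP.≤-trans (ℕP.m≤m*n (2 ℕ.^ m) (suc n)) (ℕP.≤-reflexive (sym (ℤP.abs-* (pow2 m) -[1+ n ])))))

Λ-separates : ∀ b p q → norm p ℕ.≤ b → norm q ℕ.≤ b → Λ (dbl (b ℕ.+ b)) (p ⊖ q) → p ≡ q
Λ-separates b p@(x , y) q@(z , w) np nq l with Λ-pow2⁻¹ (b ℕ.+ b) l
... | (r , t) , e = cong₂ _,_
    (close x z r (cong proj₁ e) (ℕP.≤-trans (ℕP.m≤m+n ∣ x ∣ ∣ y ∣) np) (ℕP.≤-trans (ℕP.m≤m+n ∣ z ∣ ∣ w ∣) nq))
    (close y w t (cong proj₂ e) (ℕP.≤-trans (ℕP.m≤n+m ∣ y ∣ ∣ x ∣) np) (ℕP.≤-trans (ℕP.m≤n+m ∣ w ∣ ∣ z ∣) nq))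
  where
  close : ∀ x z r → x - z ≡ pow2 (b ℕ.+ b) * r → ∣ x ∣ ℕ.≤ b → ∣ z ∣ ℕ.≤ b → x ≡ z
  close x z r e bx bz = ℤP.i-j≡0⇒i≡j x z
    (trans e (small-multiple (b ℕ.+ b) r (subst (λ u → ∣ u ∣ ℕ.< 2 ℕ.^ (b ℕ.+ b)) e
    (ℕP.≤-<-trans (ℕP.≤-trans (ℤP.∣i-j∣≤∣i∣+∣j∣ x z) (ℕP.+-mono-≤ bx bz)) (n<2^n (b ℕ.+ b))))))

support-cases : ∀ s t → support s ≡ support t → (s ≡ t) ⊎ (start s ≡ finish t × dir s ≡ opp (dir t))
support-cases (seg p E) (seg q E) refl = inj₁ refl
support-cases (seg p N) (seg q N) refl = inj₁ refl
support-cases (seg p W) (seg q W) e = inj₁ (cong (λ r → seg r W) (⊕-cancelʳ (unit W) (cong proj₁ e)))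
support-cases (seg p S) (seg q S) e = inj₁ (cong (λ r → seg r S) (⊕-cancelʳ (unit S) (cong proj₁ e)))
support-cases (seg p E) (seg q W) e = inj₂ (cong proj₁ e , refl)
support-cases (seg p N) (seg q S) e = inj₂ (cong proj₁ e , refl)
support-cases (seg p W) (seg q E) e = inj₂ (trans (trans (sym (⊕-identityʳ p)) (sym (⊕-assoc p (unit W) (unit E))))
  (cong (_⊕ unit E) (cong proj₁ e)) , refl)
support-cases (seg p S) (seg q N) e = inj₂ (trans (trans (sym (⊕-identityʳ p)) (sym (⊕-assoc p (unit S) (unit N))))
  (cong (_⊕ unit N) (cong proj₁ e)) , refl)
support-cases (seg p E) (seg q N) ()
support-cases (seg p E) (seg q S) ()
support-cases (seg p W) (seg q N) ()
support-cases (seg p W) (seg q S) ()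
support-cases (seg p N) (seg q E) ()
support-cases (seg p N) (seg q W) ()
support-cases (seg p S) (seg q E) ()
support-cases (seg p S) (seg q W) ()

agree-shift : ∀ {a i a' j} m n → Agree a i a' j (m ℕ.+ n) → Agree a (i + + m) a' (j + + m) n
agree-shift {a} {i} {a'} {j} m n ag = agree λ t t<n → trans (cong a (ℤP.+-assoc i (+ m) (+ t)))
  (trans (at ag (m ℕ.+ t) (ℕP.+-monoʳ-< m t<n)) (cong a' (sym (ℤP.+-assoc j (+ m) (+ t)))))

alt-same : ∀ k l x y → alt k x ≡ alt l x → alt k y ≡ alt l y
alt-same k l x y e with sgn-cases y x
... | inj₁ refl = e
... | inj₂ refl = trans (alt-negate k x) (trans (cong negate e) (sym (alt-negate l x)))

segment-≡ : ∀ {s t : Segment} → start s ≡ start t → dir s ≡ dir t → s ≡ t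
segment-≡ {seg p d} {seg .p .d} refl refl = refl

⊕-⊖-cancel : ∀ p v → (p ⊕ v) ⊖ p ≡ v
⊕-⊖-cancel (a , b) (c , d) = cong₂ _,_ (lem a c) (lem b d)
  where
  lem : ∀ a c → a + c - a ≡ c
  lem = solve-∀

orient-dir : ∀ d e → orientSgn d ≡ orientSgn e → (e ≡ d) ⊎ (e ≡ opp d)
orient-dir d e oe with dir-cases pos d e
... | inj₁ x = inj₁ x
... | inj₂ (inj₁ x) = inj₂ x
... | inj₂ (inj₂ (inj₁ refl)) = ⊥-elim (s≢negate (trans oe (orientSgn-step pos d)))
... | inj₂ (inj₂ (inj₂ refl)) = ⊥-elim
  (s≢negate (trans oe (trans (orientSgn-step pos (opp d)) (cong negate (orientSgn-opp d)))))

module Backward (𝒞 : CurveSet) (cv : Covering 𝒞) (st : SameTypeEtc 𝒞) where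
  private
    folds = proj₁ cv
    cover = proj₁ (proj₂ cv)
    uniq  = proj₂ (proj₂ cv)

  fold : ∀ {C} → 𝒞 C → FoldCurve C
  fold {C} c = foldCurve (folds C c)

  private
    cfs : ∀ {C} → 𝒞 C → CompleteFoldingSeq (assoc C)
    cfs c = FoldCurve.cfs (fold c)

  compat : ∀ {C C'} → 𝒞 C → 𝒞 C' → Compat C C'
  compat {C} {C'} c c' = record { E-compat = E-c ; type-compat = λ oi oj → type-c (proj₁ st) oi oj ; fold-compat =
    fold-c }
    where
    a = assoc C
    a' = assoc C'
    E-c : ∀ k {i j} → OnE a k i → OnE a' k j → Λ k (finish (C i) ⊖ finish (C' j))
    E-c k {i} {j} oi oj = go (proj₁ (proj₁ (proj₂ st) C C' c c' k (finish (C i)))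
      (i , OnE⇒InE oi , Λ⇒InΛ k _ (subst (Λ k) (sym (⊖-self (finish (C i)))) (Λ-origin k))))
      where
      go : InEC C' k (finish (C i)) → Λ k (finish (C i) ⊖ finish (C' j))
      go (j₀ , ie , l) = Λ-telescope (finish (C i)) (finish (C' j₀)) (finish (C' j)) (InΛ⇒Λ k _ l)
        (E-points k (fold c') (InE⇒OnE ie) oj)
    type-c : (∀ C → 𝒞 C → TypeH C) ⊎ (∀ C → 𝒞 C → TypeV C) → ∀ {i j} → OnE a 1 i → OnE a' 1 j → orientSgn
      (dir (C i)) ≡ orientSgn (dir (C' j))
    type-c (inj₁ ty) {i} {j} oi oj = orientSgn-cong _ _
      (trans (ty C c i (OnE⇒InE oi)) (sym (ty C' c' j (OnE⇒InE oj))))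
    type-c (inj₂ ty) {i} {j} oi oj = orientSgn-cong _ _
      (trans (ty C c i (OnE⇒InE oi)) (sym (ty C' c' j (OnE⇒InE oj))))
    fold-c : ∀ k {i j} → AtLevel a k i → AtLevel a' k j → a i ≡ a' j →
      OnE a (suc (suc k)) (i + pow2 k) → OnE a' (suc (suc k)) (j + pow2 k)
    fold-c k {i} {j} li lj e oe = go (proj₁ (proj₂ (proj₂ st) C C' c c') i size)
      where
      m = detect (suc (suc k))
      -- Long enough to recognise level k at `i` and E_{k+2} at i + 2^k; the successor makes the
      -- window visibly nonempty, for comparing the turns at its head.
      size = 2 ℕ.^ k ℕ.+ (m ℕ.+ suc (detect k))
      go : (Σ ℤ λ i' → window a i size ≡ window a' i' size) → OnE a' (suc (suc k)) (j + pow2 k)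
      -- On C' the indices i' and j have the same level and turn, so they differ by a multiple of
      -- 2^(k+2), a period of E_{k+2}.
      go (i' , we) = go₂ (level-unique-sign k a' (cfs c') j i' lj
          (agree-level k (cfs c) (cfs c') (agree-≤ (ℕP.≤-trans (ℕP.n≤1+n (detect k)) tail≤) ag) li)
          (trans (sym e) (agree-head (agree-≤ tail≤ ag))))
        where
        ag : Agree a i a' i' size
        ag = window⇒agree we
        tail≤ : suc (detect k) ℕ.≤ size
        tail≤ = ℕP.≤-trans (ℕP.m≤n+m (suc (detect k)) m) (ℕP.m≤n+m (m ℕ.+ suc (detect k)) (2 ℕ.^ k))
        oe' : OnE a' (suc (suc k)) (i' + pow2 k)
        oe' = agree-OnE (suc (suc k)) (cfs c) (cfs c') (agree-≤ (ℕP.m≤m+n m (suc (detect k)))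
          (agree-shift (2 ℕ.^ k) (m ℕ.+ suc (detect k)) ag)) oe
        go₂ : (Σ ℤ λ l → j ≡ i' + l * pow2 (suc (suc k))) → OnE a' (suc (suc k)) (j + pow2 k)
        go₂ (l , refl) = subst (OnE a' (suc (suc k))) (lem i' (pow2 k) l (pow2 (suc (suc k)))) (OnE-shift l oe')
          where
          lem : ∀ i P l Q → i + P + l * Q ≡ i + l * Q + P
          lem = solve-∀

  module _ {C C' : Curve} (c : 𝒞 C) (c' : 𝒞 C') where
    private
      fc = fold c
      fc' = fold c'
      back : ∀ i j → i + (j - i) ≡ j
      back = solve-∀

    -- Orientation and colour of the start both alternate along a curve, so one pair of indices at
    -- which both agree links the two properties at every pair.
    coherent : Σ ℤ λ i₀ → Σ ℤ λ j₀ → orientSgn (dir (C i₀)) ≡ orientSgn (dir (C' j₀)) × par (start (C i₀)) ≡ par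
      (start (C' j₀))
    coherent = go (OnE-exists 1 (assoc C) (cfs c)) (OnE-exists 1 (assoc C') (cfs c'))
      where
      go : Σ ℤ (OnE (assoc C) 1) → Σ ℤ (OnE (assoc C') 1) → _
      go (i , oi) (j , oj) = i , j , Compat.type-compat (compat c c') oi oj ,
        negate-inj (trans (sym (par-unit (start (C i)) (dir (C i))))
          (trans (Λ₁⇒par (finish (C i)) (finish (C' j)) (Compat.E-compat (compat c c') 1 oi oj))
          (par-unit (start (C' j)) (dir (C' j)))))

    orient⇒par : ∀ i j → orientSgn (dir (C i)) ≡ orientSgn (dir (C' j)) → par (start (C i)) ≡ par (start (C' j))
    orient⇒par i j e = go coherent
      where
      go : _ → par (start (C i)) ≡ par (start (C' j))
      go (i₀ , j₀ , oo , pp) = trans (cong (λ z → par (start (C z))) (sym (back i₀ i)))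
        (trans (FoldCurve.par-alt fc i₀ (i - i₀))
        (trans (alt-same (i - i₀) (j - j₀) _ _ (trans (sym (FoldCurve.orient-alt fc i₀ (i - i₀)))
          (trans (cong (λ z → orientSgn (dir (C z))) (back i₀ i))
          (trans e (trans (cong (λ z → orientSgn (dir (C' z))) (sym (back j₀ j)))
            (trans (FoldCurve.orient-alt fc' j₀ (j - j₀)) (cong (alt (j - j₀)) (sym oo))))))))
          (trans (cong (alt (j - j₀)) pp) (trans (sym (FoldCurve.par-alt fc' j₀ (j - j₀)))
            (cong (λ z → par (start (C' z))) (back j₀ j))))))

    par⇒orient : ∀ i j → par (start (C i)) ≡ par (start (C' j)) → orientSgn (dir (C i)) ≡ orientSgn (dir (C' j))
    par⇒orient i j e = go coherent
      where
      go : _ → orientSgn (dir (C i)) ≡ orientSgn (dir (C' j))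
      go (i₀ , j₀ , oo , pp) = trans (cong (λ z → orientSgn (dir (C z))) (sym (back i₀ i)))
        (trans (FoldCurve.orient-alt fc i₀ (i - i₀))
        (trans (alt-same (i - i₀) (j - j₀) _ _ (trans (sym (FoldCurve.par-alt fc i₀ (i - i₀)))
          (trans (cong (λ z → par (start (C z))) (back i₀ i))
          (trans e (trans (cong (λ z → par (start (C' z))) (sym (back j₀ j)))
            (trans (FoldCurve.par-alt fc' j₀ (j - j₀)) (cong (alt (j - j₀)) (sym pp))))))))
          (trans (cong (alt (j - j₀)) oo) (trans (sym (FoldCurve.orient-alt fc' j₀ (j - j₀)))
            (cong (λ z → orientSgn (dir (C' z))) (back j₀ j))))))

    -- A reversed segment would have the same orientation but start at the other colour, and Λ_1
    -- preserves colours.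
    same-segment : ∀ v i j → Λ 1 v → support (C' j) ≡ translateE v (support (C i)) → C' j ≡ shift v (C i)
    same-segment v i j l e = go (support-cases (C' j) (shift v (C i)) (trans e (sym (support-shift v (C i)))))
      where
      go : _ → C' j ≡ shift v (C i)
      go (inj₁ x) = x
      go (inj₂ (s , d)) = ⊥-elim
        (s≢negate (trans (orient⇒par i j (sym (trans (cong orientSgn d) (orientSgn-opp (dir (C i))))))
        (trans (cong par (trans s (finish-shift v (C i))))
          (trans (Λ₁⇒par (finish (C i) ⊕ v) (finish (C i)) (subst (Λ 1) (sym (⊕-⊖-cancel (finish (C i)) v)) l))
          (par-unit (start (C i)) (dir (C i)))))))

    -- Arrivals at one vertex are parallel. Opposite arrivals with different turns would leave along
    -- the same segment, and uniqueness would make the arrivals equal too.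
    same-vertex : ∀ i j → finish (C i) ≡ finish (C' j) → assoc C i ≡ assoc C' j
    same-vertex i j e = go (orient-dir (dir (C i)) (dir (C' j))
      (par⇒orient i j (negate-inj (trans (sym (par-unit (start (C i)) (dir (C i))))
      (trans (cong par e) (par-unit (start (C' j)) (dir (C' j))))))))
      where
      same-seg : ∀ i j → C i ≡ C' j → SameSeg C i C' j
      same-seg i j x = uniq (support (C i)) C i C' j c c' refl (cong support (sym x))
      go : (dir (C' j) ≡ dir (C i)) ⊎ (dir (C' j) ≡ opp (dir (C i))) → assoc C i ≡ assoc C' j
      go (inj₁ d) = cong₂ turn (sym d) (cong dir (same-seg i j (segment-≡ starts (sym d)) (+ 1)))
        where
        starts : start (C i) ≡ start (C' j)
        starts = trans (start-from-finish (C i)) (trans (cong₂ (λ p x → p ⊕ unit (opp x)) e (sym d))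
          (sym (start-from-finish (C' j))))
      go (inj₂ d) = go₂ (sgn-cases (assoc C i) (assoc C' j))
        where
        go₂ : _ → assoc C i ≡ assoc C' j
        go₂ (inj₁ x) = x
        go₂ (inj₂ x) = ⊥-elim
          (opp≢ (dir (C i)) (trans
          (cong dir (trans (cong C (sym (lem i))) (trans (nexts (- + 1)) (cong C' (lem j))))) d))
          where
          lem : ∀ i → i + + 1 + - + 1 ≡ i
          lem = solve-∀
          opp≢ : ∀ d → d ≢ opp d
          opp≢ E ()
          opp≢ N ()
          opp≢ W ()
          opp≢ S ()
          step-negate-opp : ∀ s d → step (negate s) d ≡ step s (opp d)
          step-negate-opp pos = by-dir _ refl refl refl refl
          step-negate-opp neg = by-dir _ refl refl refl refl
          nexts : SameSeg C (i + + 1) C' (j + + 1)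
          nexts = same-seg (i + + 1) (j + + 1)
            (segment-≡ (trans (sym (FoldCurve.conn fc i)) (trans e (FoldCurve.conn fc' j)))
            (trans (FoldCurve.dir-suc fc i) (trans (cong (λ s → step s (dir (C i))) x)
              (trans (step-negate-opp (assoc C' j) (dir (C i)))
              (trans (cong (step (assoc C' j)) (sym d)) (sym (FoldCurve.dir-suc fc' j)))))))

  -- Turns that recur under translation

  Vertex : Set
  Vertex = Σ Curve λ C → 𝒞 C × ℤ

  point : Vertex → Point
  point (C , _ , i) = finish (C i)

  -- All visits to the translated vertex are covered, since the curve passing there is not known
  -- beforehand.
  Good : Point → Vertex → Set
  Good v (C , _ , i) = ∀ C' (c' : 𝒞 C') j → finish (C' j) ≡ finish (C i) ⊕ v → assoc C' j ≡ assoc C i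

  good-level : ∀ v {C} (c : 𝒞 C) i k → AtLevel (assoc C) k i → Λ (suc (suc k)) v → Good v (C , c , i)
  good-level v {C} c i k li l C' c' j e = turn-determined k (fold c) (fold c') (compat c c') li
    (subst (Λ (suc (suc k))) (sym (trans (cong (_⊖ finish (C i)) e) (⊕-⊖-cancel (finish (C i)) v))) l)

  pred-suc : ∀ i → i - + 1 + + 1 ≡ i
  pred-suc = solve-∀

  -- Λ_1 excludes reversal of the segment; then the turn at its end gives the successor and the turn
  -- at its start the predecessor.
  decorated : ∀ v {C} (c : 𝒞 C) i → Λ 1 v → Good v (C , c , i) → Good v (C , c , i - + 1) → IsDecSeg 𝒞
    (translateD v (dec C i))
  decorated v {C} c i l g g' = go (cover (translateE v (support (C i))))
    where
    fc = fold c
    go : (Σ Curve λ C' → Σ ℤ λ j → 𝒞 C' × support (C' j) ≡ translateE v (support (C i))) → IsDecSeg 𝒞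
      (translateD v (dec C i))
    go (C' , j , c' , e) = C' , j , c' , dseg-≡
      (trans (sym (support-shift v (C (i - + 1)))) (cong support (sym prev)))
      (sym here)
      (trans (sym (support-shift v (C (i + + 1)))) (cong support (sym next)))
      where
      dseg-≡ : ∀ {e₁ e₂ f₁ f₂ s t} → e₁ ≡ f₁ → s ≡ t → e₂ ≡ f₂ → dseg e₁ s e₂ ≡ dseg f₁ t f₂
      dseg-≡ refl refl refl = refl
      fc' = fold c'
      here : C' j ≡ shift v (C i)
      here = same-segment c c' v i j l e
      turn₁ : assoc C' j ≡ assoc C i
      turn₁ = g C' c' j (trans (cong finish here) (finish-shift v (C i)))
      next : C' (j + + 1) ≡ shift v (C (i + + 1))
      next = segment-≡ (trans (sym (FoldCurve.conn fc' j))
        (trans (cong finish here) (trans (finish-shift v (C i)) (cong (_⊕ v) (FoldCurve.conn fc i)))))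
        (trans (FoldCurve.dir-suc fc' j) (trans (cong₂ step turn₁ (cong dir here)) (sym (FoldCurve.dir-suc fc i))))
      fin : finish (C' (j - + 1)) ≡ finish (C (i - + 1)) ⊕ v
      fin = trans (finish-pred fc' j) (trans (cong start here) (cong (_⊕ v) (sym (finish-pred fc i))))
      turn₂ : assoc C' (j - + 1) ≡ assoc C (i - + 1)
      turn₂ = g' C' c' (j - + 1) fin
      step-inj : ∀ s d d' → step s d ≡ step s d' → d ≡ d'
      step-inj s d d' x = trans (sym (back s d)) (trans (cong (step (negate s)) x) (back s d'))
        where
        back : ∀ s d → step (negate s) (step s d) ≡ d
        back s d = trans (cong (λ t → step (negate s) (step t d)) (sym (negate-invol s))) (step-negate (negate s) d)
      dir-here : ∀ {X} (fx : FoldCurve X) x → step (assoc X (x - + 1)) (dir (X (x - + 1))) ≡ dir (X x)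
      dir-here {X} fx x = trans (sym (FoldCurve.dir-suc fx (x - + 1))) (cong (λ z → dir (X z)) (pred-suc x))
      dirs : dir (C' (j - + 1)) ≡ dir (C (i - + 1))
      dirs = step-inj (assoc C (i - + 1)) _ _ (trans (cong (λ s → step s (dir (C' (j - + 1)))) (sym turn₂))
        (trans (dir-here fc' j) (trans (cong dir here) (sym (dir-here fc i)))))
      prev : C' (j - + 1) ≡ shift v (C (i - + 1))
      prev = segment-≡ (trans (start-from-finish (C' (j - + 1))) (trans (cong₂ (λ p x → p ⊕ unit (opp x)) fin dirs)
          (trans (⊕-swapʳ (finish (C (i - + 1))) v _) (cong (_⊕ v) (sym (start-from-finish (C (i - + 1)))))))) dirs

  -- Both ends of each segment, its start being recorded as the end of its predecessor.
  vertices : ∀ {F} → All (IsDecSeg 𝒞) F → List Vertex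
  vertices [] = []
  vertices ((C , i , c , _) ∷ as) = (C , c , i) ∷ (C , c , i - + 1) ∷ vertices as

  Bounded : ℕ → Vertex → Set
  Bounded b κ = norm (point κ) ℕ.≤ b

  bound : ∀ ks → Σ ℕ λ b → All (Bounded b) ks
  bound [] = 0 , []
  bound (κ ∷ ks) with bound ks
  ... | b , al = norm (point κ) ℕ.+ b , ℕP.m≤m+n _ b ∷ All.map (λ p → ℕP.≤-trans p (ℕP.m≤n+m b _)) al

  Low High : ℕ → Vertex → Set
  Low n (C , _ , i) = Σ ℕ λ m → m ℕ.< n × AtLevel (assoc C) m i
  High n (C , _ , i) = OnE (assoc C) n i

  low-or-high : ∀ n κ → Low n κ ⊎ High n κ
  low-or-high n (C , c , i) with level-cases n (assoc C) (cfs c) i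
  ... | inj₁ oe = inj₂ oe
  ... | inj₂ lv = inj₁ lv

  GoodShifts : List Vertex → Set
  GoodShifts ks = Σ Point λ v₀ → Σ ℕ λ n → ∀ w → Λ n w → Λ 1 (v₀ ⊕ w) × All (Good (v₀ ⊕ w)) ks

  good-low : ∀ n v κ → Low n κ → Λ (suc n) v → Good v κ
  good-low n v (C , c , i) (k , k<n , li) l = good-level v c i k li (Λ-≤ (s≤s k<n) l)

  -- At most one vertex x of the list lies in E_{4b}.  If x is in E_{4b+1}, it is moved to a vertex y of level
  -- exactly 4b + 1 with the same turn, whose translates by Λ_{4b+3} again have that turn.
  high-shifts : ∀ b ks → All (Bounded b) ks → ∀ κ → Bounded b κ → High (suc (dbl (b ℕ.+ b))) κ → GoodShifts ks
  high-shifts b ks bs (C₀ , c₀ , i₀) b₀ oe₀@(onE {h₀} lev _ _) = go choose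
    where
    K = dbl (b ℕ.+ b)
    a₀ = assoc C₀
    choose : Σ ℤ λ h → AtLevel a₀ (suc K) h × a₀ h ≡ a₀ i₀
    choose with sgn-cases (a₀ h₀) (a₀ i₀)
    ... | inj₁ e = h₀ , lev , e
    ... | inj₂ e = h₀ + + 1 * pow2 (suc (suc K)) , level-shift (+ 1) lev ,
      trans (alternates lev (+ 1)) (trans (cong negate e) (negate-invol _))
    go : (Σ ℤ λ h → AtLevel a₀ (suc K) h × a₀ h ≡ a₀ i₀) → GoodShifts ks
    go (h , lh , e) = v₀ , suc (suc (suc K)) , λ w lw → Λ-≤ (s≤s z≤n) (l₁ w lw) , All.map (λ {κ} → good w lw κ) bs
      where
      x = finish (C₀ i₀)
      y = finish (C₀ h)
      v₀ = y ⊖ x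
      l₁ : ∀ w → Λ (suc (suc (suc K))) w → Λ (suc K) (v₀ ⊕ w)
      l₁ w lw = Λ-⊕ (E-points (suc K) (fold c₀) (level⇒OnE lh) oe₀) (Λ-mono (Λ-mono lw))
      good : ∀ w → Λ (suc (suc (suc K))) w → ∀ κ → Bounded b κ → Good (v₀ ⊕ w) κ
      good w lw κ@(C , c , i) bκ with low-or-high K κ
      ... | inj₁ lv = good-low K (v₀ ⊕ w) κ lv (l₁ w lw)
      ... | inj₂ oe = λ C' c' j ej → trans (good-level w c₀ h (suc K) lh lw C' c' j
        (trans ej (trans (cong (_⊕ (v₀ ⊕ w)) z≡x) shift-x)))
          (trans e (same-vertex c₀ c i₀ i (sym z≡x)))
        where
        z≡x : finish (C i) ≡ x
        z≡x = sym (Λ-separates b x (finish (C i)) b₀ bκ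
          (Compat.E-compat (compat c₀ c) K (OnE-mono K a₀ (cfs c₀) i₀ oe₀) oe))
        shift-x : x ⊕ (v₀ ⊕ w) ≡ y ⊕ w
        shift-x = trans (sym (⊕-assoc x v₀ w)) (cong (_⊕ w) (⊕-⊖ x y))

  good-shifts : ∀ b ks → All (Bounded b) ks → GoodShifts ks
  good-shifts b ks bs = go (All.decide (low-or-high (suc K)) ks)
    where
    K = dbl (b ℕ.+ b)
    go : All (Low (suc K)) ks ⊎ Any (High (suc K)) ks → GoodShifts ks
    -- All levels are at most K, so Λ_{K+2} preserves every turn.
    go (inj₁ lows) = (+ 0 , + 0) , suc (suc K) , λ w lw →
      Λ-⊕ (Λ-origin 1) (Λ-≤ (s≤s z≤n) lw) , All.map (λ {κ} lv → good-low (suc K) ((+ 0 , + 0) ⊕ w) κ lv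
        (Λ-⊕ (Λ-origin (suc (suc K))) lw)) lows
    go (inj₂ highs) = let (κ , κ∈ , oe) = find highs in high-shifts b ks bs κ (All.lookup bs κ∈) oe

  -- `w` is the centre rounded down to multiples of 2^n. Each coordinate of a translated point is
  -- then within `ρ` of the centre, and ρ r + ρ r = r r for r = 2ρ.
  module Place (b : ℕ) (v₀ : Point) (n : ℕ) (c : Point) where
    instance
      2^n≢0 : ℕ.NonZero (2 ℕ.^ n)
      2^n≢0 = ℕP.m^n≢0 2 n

    ρ r : ℕ
    ρ = b ℕ.+ norm v₀ ℕ.+ 2 ℕ.^ n
    r = ρ ℕ.+ ρ

    quotient : Point
    quotient = (proj₁ c ℤD./ℕ (2 ℕ.^ n) , proj₂ c ℤD./ℕ (2 ℕ.^ n))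

    w : Point
    w = scale (pow2 n) quotient

    w-Λ : Λ n w
    w-Λ = Λ-≤ (m≤dbl n) (Λ-pow2 n quotient)

    near : ∀ p v c → ∣ p ∣ ℕ.≤ b → ∣ v ∣ ℕ.≤ norm v₀ → ∣ p + (v + pow2 n * (c ℤD./ℕ (2 ℕ.^ n))) - c ∣ ℕ.≤ ρ
    near p v c bp bv = ℕP.≤-trans
      (ℕP.≤-reflexive (cong ∣_∣ (trans (cong (λ z → p + (v + pow2 n * q) - z) (ℤD.a≡a%ℕn+[a/ℕn]*n c (2 ℕ.^ n)))
      (lem p v (pow2 n) q (+ t)))))
      (ℕP.≤-trans (ℤP.∣i-j∣≤∣i∣+∣j∣ (p + v) (+ t))
        (ℕP.+-mono-≤ (ℕP.≤-trans (ℤP.∣i+j∣≤∣i∣+∣j∣ p v) (ℕP.+-mono-≤ bp bv)) (ℕP.<⇒≤ (ℤD.n%ℕd<d c (2 ℕ.^ n)))))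
      where
      q = c ℤD./ℕ (2 ℕ.^ n)
      t = c ℤD.%ℕ (2 ℕ.^ n)
      lem : ∀ p v P q r → p + (v + P * q) - (r + q * P) ≡ p + v - r
      lem = solve-∀

    in-disk : ∀ p → norm p ℕ.≤ b → InDisk c r (p ⊕ (v₀ ⊕ w))
    in-disk p@(x , y) bp = ℕP.≤-trans (ℕP.+-mono-≤ (square X) (square Y))
      (ℕP.≤-reflexive (sym (ℕP.*-distribʳ-+ r ρ ρ)))
      where
      X = near x (proj₁ v₀) (proj₁ c) (ℕP.≤-trans (ℕP.m≤m+n ∣ x ∣ ∣ y ∣) bp) (ℕP.m≤m+n ∣ proj₁ v₀ ∣ ∣ proj₂ v₀ ∣)
      Y = near y (proj₂ v₀) (proj₂ c) (ℕP.≤-trans (ℕP.m≤n+m ∣ y ∣ ∣ x ∣) bp) (ℕP.m≤n+m ∣ proj₂ v₀ ∣ ∣ proj₁ v₀ ∣)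
      square : ∀ {m} → m ℕ.≤ ρ → m ℕ.* m ℕ.≤ ρ ℕ.* r
      square m≤ρ = ℕP.*-mono-≤ m≤ρ (ℕP.≤-trans m≤ρ (ℕP.m≤m+n ρ ρ))

    placed : Λ 1 (v₀ ⊕ w) → ∀ {F} (as : All (IsDecSeg 𝒞) F) → All (Good (v₀ ⊕ w)) (vertices as) → All (Bounded b)
      (vertices as) →
      All (λ d → IsDecSeg 𝒞 d × DecInDisk c r d) (map (translateD (v₀ ⊕ w)) F)
    placed l [] _ _ = []
    placed l ((C , i , cc , refl) ∷ as) (g ∷ g' ∷ gs) (bf ∷ bs ∷ bds) =
      (decorated v cc i l g g' ,
        subst (λ p → InDisk c r (p ⊕ v)) (finish-pred (fold cc) i) (in-disk (finish (C (i - + 1))) bs) ,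
        subst (InDisk c r) (sym (finish-shift v (C i))) (in-disk (finish (C i)) bf)) ∷ placed l as gs bds
      where v = v₀ ⊕ w

  local-iso : LocalIsoProperty 𝒞
  local-iso F as = go (bound (vertices as))
    where
    Goal = Σ ℕ λ r → (0 ℕ.< r) × (∀ c → Σ Point λ v → All (λ d → IsDecSeg 𝒞 d × DecInDisk c r d)
      (map (translateD v) F))
    go : (Σ ℕ λ b → All (Bounded b) (vertices as)) → Goal
    go (b , bs) = go₂ (good-shifts b (vertices as) bs)
      where
      go₂ : GoodShifts (vertices as) → Goal
      go₂ (v₀ , n , good) = r , ℕP.≤-trans (ℕP.m^n>0 2 n) (ℕP.≤-trans (ℕP.m≤n+m (2 ℕ.^ n) (b ℕ.+ norm v₀))
        (ℕP.m≤m+n ρ ρ)) ,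
        λ c → let open Place b v₀ n c in v₀ ⊕ w , placed (proj₁ (good w w-Λ)) as (proj₂ (good w w-Λ)) bs
        -- The radius has to be fixed before the centre; it does not mention the centre, so it is
        -- taken from the instance at the origin.
        where open Place b v₀ n (+ 0 , + 0) using (ρ; r)

theorem3p5 : (𝒞 : CurveSet) → Covering 𝒞 →
    (LocalIsoProperty 𝒞 → SameTypeEtc 𝒞) × (SameTypeEtc 𝒞 → LocalIsoProperty 𝒞)
theorem3p5 𝒞 cv = Forward.same-type-etc 𝒞 cv , Backward.local-iso 𝒞 cv
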